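{- Let $p,q$ be distinct odd primes and $\alpha,\beta$ positive integers. Then $$\sum_{\substack{i+j+k=2p^{\alpha}q^{\beta}\\ i,j,k\in\mathcal{P}_{pq}}}\frac{(-1)^{i}}{ijk}\equiv-\frac{1}{2}Z(p^{\alpha}q^{\beta})\equiv (q-2)\Bigl(1-\frac{1}{q^{3}}\Bigr)p^{\alpha-1}q^{\beta-1}B_{p-3}\pmod{p^{\alpha}}.$$
   Context: For a positive integer $n$, $\mathcal{P}_n$ denotes the set of positive integers coprime to $n$, and $Z(n)=\sum_{i+j+k=n,\ i,j,k\in\mathcal{P}_n}\frac{1}{ijk}$. All sums are over ordered triples $(i,j,k)$ of positive integers. The Bernoulli numbers $B_k$ are defined by $B_0=1$ and $\sum_{i=0}^{n}\binom{n+1}{i}B_i=0$ for $n\ge1$. A congruence between rational numbers modulo $p^{\alpha}$ means that the difference, written in lowest terms, has numerator divisible by $p^{\alpha}$ and denominator coprime to $p$. -}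

module Defs where

open import Data.Bool using (Bool; true; false; _∧_; if_then_else_)
open import Data.Nat as ℕ using (ℕ; zero; suc; _^_; _≡ᵇ_)
open import Data.Nat.Divisibility using (_∣_)
open import Data.Nat.Coprimality using (Coprime; coprime?)
open import Data.Nat.Combinatorics using (_C_)
open import Data.Integer as ℤ using (+_)
open import Data.Rational using (ℚ; 0ℚ; 1ℚ; _+_; _*_; _-_; -_; _/_; ↥_; ↧ₙ_)
open import Data.List using (List; []; _∷_; _++_; map; foldr; filter; filterᵇ; applyUpTo; concatMap; upTo; zipWith)
open import Data.Product using (_×_; _,_)
open import Relation.Nullary using (does)

ℕ→ℚ : ℕ → ℚ
ℕ→ℚ n = + n / 1

-- reciprocal of a natural number (only ever applied to positive arguments)
inv : ℕ → ℚ
inv zero    = 0ℚ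
inv (suc n) = + 1 / suc n

sumℚ : List ℚ → ℚ
sumℚ = foldr _+_ 0ℚ

sign : ℕ → ℚ
sign zero          = 1ℚ
sign (suc zero)    = - 1ℚ
sign (suc (suc i)) = sign i

-- does i belong to 𝒫_n (positive and coprime to n)?  Positivity is
-- enforced by the index range below.
inP : ℕ → ℕ → Bool
inP n i = does (coprime? i n)

triples : (m N : ℕ) → List (ℕ × ℕ × ℕ)
triples m N =
  filterᵇ (λ { (i , j , k) → ((i ℕ.+ j ℕ.+ k) ≡ᵇ N) ∧ inP m i ∧ inP m j ∧ inP m k })
    (concatMap (λ i → concatMap (λ j → map (λ k → (i , j , k)) pos) pos) pos)
  where
  pos : List ℕ
  pos = applyUpTo suc N

Z : ℕ → ℚ
Z n = sumℚ (map (λ { (i , j , k) → inv (i ℕ.* j ℕ.* k) }) (triples n n))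

altSum : (m N : ℕ) → ℚ
altSum m N = sumℚ (map (λ { (i , j , k) → sign i * inv (i ℕ.* j ℕ.* k) }) (triples m N))

-- Bernoulli numbers: B_0 = 1, Σ_{i=0}^{n} C(n+1,i) B_i = 0 for n ≥ 1,
-- i.e. B_{n+1} = -(1/(n+2)) Σ_{i=0}^{n} C(n+2,i) B_i.
-- bernList n = [B_0, ..., B_n]
bernList : ℕ → List ℚ
bernList zero    = 1ℚ ∷ []
bernList (suc n) = bs ++ (b ∷ [])
  where
  bs : List ℚ
  bs = bernList n
  b : ℚ
  b = - (inv (suc (suc n)) * sumℚ (zipWith (λ i Bi → ℕ→ℚ (suc (suc n) C i) * Bi) (upTo (suc n)) bs))

lastOr : ℚ → List ℚ → ℚ
lastOr d []       = d
lastOr d (x ∷ xs) = lastOr x xs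

bernoulli : ℕ → ℚ
bernoulli n = lastOr 0ℚ (bernList n)

-- x ≡ y (mod p^a): the difference in lowest terms (ℚ is normalised) has
-- numerator divisible by p^a and denominator coprime to p
CongQ : (p a : ℕ) → ℚ → ℚ → Set
CongQ p a x y = (p ^ a) ∣ ℤ.∣ ↥ (x - y) ∣ × Coprime (↧ₙ (x - y)) p

-- Let P = p^α and let u(i) be the inverse of i modulo P, or 0 when p ∣ i: an odd function of period P.
-- With G(x) = Σ_{j+k=x} u(j) u(k), oddness gives, for P ∣ N and an even weight w of period dividing N,
--   Σ_{i+j+k=N} w(i) u(i) u(j) u(k) ≡ - Σ_{x<N} w(x) u(x) G(x)  (mod P),
-- and G(x + P) - G(x) ≡ -2 p^(α-1) u(x)² for p ∤ x.  So the unweighted sum W(t P) equals t W(P), and the part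
-- of the sum over i + j + k = t P m with m ∣ i equals t W(P) + 2 t p^(α-1) m⁻³ Σ_{r<P} ⌊r m / P⌋ u(r)³, where
-- by Voronoi's congruence 3 Σ_{r<P} ⌊r m / P⌋ u(r)³ ≡ (m³ - m) B_{p-3} (mod p).  For m = 2, t = 1 a parity
-- count of the same part yields W(P) ≡ -2 p^(α-1) B_{p-3}; for m = q inclusion-exclusion over the multiples
-- of q then yields Z(p^α q^β).
--
-- For the alternating sum A, let n = p^α q^β and let T be the sum over i + j + k = 2 n without signs.  Reducing
-- the indices modulo n gives T ≡ 2 Z(n), while the triples with even entries contribute
-- Z(n) / 8 = (T + 3 A) / 4; hence 6 A ≡ -3 Z(n).
module Submission where

-- The prime 3 shapes the argument. Voronoi's congruence evaluates only 3 times the floor sum, the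
-- parity count gives only 6 W ≡ -12 X with X = p^(α-1) B_{p-3}, and the alternating sum enters as 6
-- A ≡ -3 Z; none of these factors can be cancelled when p = 3, so the congruences are carried with
-- them. For Z the loss is harmless: at p = 3 the polynomials in q that multiply W and X are
-- divisible by 3, and 3 p^(α-1) = p^α. For A it is repaired by inverting modulo p^(α+1), where n
-- need not vanish but n² and 3 n do; this is why reciprocals are expanded to first order, 1/(n + i)
-- = 1/i - n/i², and not treated as periodic.
--
-- The increment of G over a period is a cyclic convolution, evaluated by partial fractions: 1/(j k)
-- = (1/j + 1/k) / x for j + k = x. What does not cancel is the sum of u over the class of x modulo
-- p, congruent to p^(α-1) u(x). It is removed once for j and once for k, which is the origin of the
-- factor -2 p^(α-1).

module Proof where

  open import Defs
  open import Algebra.Structures using (IsCommutativeRing)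
  open import Data.Bool using (Bool; true; false; _∧_; if_then_else_)
  open import Data.Empty using (⊥-elim)
  open import Data.Integer as ℤ using (ℤ; +_; -[1+_]; 0ℤ; 1ℤ)
  import Data.Integer.Properties as ℤₚ
  open import Data.List using (List; []; _∷_; _++_; applyUpTo; zipWith; upTo; map; foldr; filterᵇ; concatMap)
  open import Data.List.Properties using (applyUpTo-∷ʳ; map-∘; map-++)
  open import Data.Maybe using (just; nothing)
  open import Data.Nat as ℕ using (ℕ; zero; suc; s≤s; z≤n; NonZero)
  open import Data.Nat.Combinatorics using (_C_; nC1≡n; nCn≡1; k>n⇒nCk≡0; nCk+nC[k+1]≡[n+1]C[k+1])
  open import Data.Nat.Coprimality as Coprime using (Coprime; coprime?; coprime-Bézout)
  open import Data.Nat.Divisibility using (_∣_; divides; _∣?_; _∣0; ∣-refl; ∣-trans; ∣⇒≤; m∣m*n; n∣m*n; ∣m⇒∣m*n; ∣n⇒∣m*n; ∣m∣n⇒∣m+n; ∣m+n∣m⇒∣n; m%n≡0⇒n∣m; *-pres-∣; *-monoʳ-∣)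
  open import Data.Nat.DivMod using (_%_; _/_; m%n<n; m≡m%n+[m/n]*n; m<n⇒m%n≡m; m<n⇒m/n≡0; [m+kn]%n≡m%n; m*n%n≡0; %-distribˡ-*; m%n%n≡m%n; m<n*o⇒m/o<n; +-distrib-/-∣ʳ; m*n/n≡m)
  open import Data.Nat.GCD using (module Bézout)
  open import Data.Nat.Primality using (Prime; prime?; prime[2]; ¬prime[0]; ¬prime[1]; prime⇒nonZero; prime⇒nonTrivial; prime⇒irreducible; euclidsLemma)
  import Data.Nat.Properties as ℕₚ
  import Data.Nat.Tactic.RingSolver as ℕ-Solver
  open import Data.Product using (_×_; _,_; ∃; proj₁; proj₂)
  open import Data.Rational as ℚ using (ℚ; 0ℚ; 1ℚ; mkℚ; toℚᵘ; ↥_; ↧ₙ_)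
  import Data.Rational.Properties as ℚₚ
  open import Data.Rational.Unnormalised using (mkℚᵘ; *≡*; _≃_)
  import Data.Rational.Unnormalised.Properties as ℚᵘₚ
  open import Data.Sum using (inj₁; inj₂; [_,_]′)
  open import Function using (_∘_; id)
  open import Level using (0ℓ)
  open import Relation.Binary.Bundles using (Setoid)
  open import Relation.Binary.PropositionalEquality
  import Relation.Binary.Reasoning.Setoid
  open import Relation.Nullary using (¬_; Dec; yes; no; does)
  open import Relation.Nullary.Decidable using (¬?; decidable-stable; from-yes)
  open import Tactic.RingSolver using (solve-∀)
  open import Tactic.RingSolver.Core.AlmostCommutativeRing using (AlmostCommutativeRing; fromCommutativeRing)

  -- Integers and congruences

  infixl 6 _+_ _-_
  infixl 7 _*_
  infix  8 -_

  -- The operations of ℤ unfold on neutral arguments, which defeats unification; sealing them restores it.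
  opaque
    _+_ _*_ : ℤ → ℤ → ℤ
    x + y = x ℤ.+ y
    x * y = x ℤ.* y
    -_ : ℤ → ℤ
    - x = ℤ.- x

  _-_ : ℤ → ℤ → ℤ
  x - y = x + (- y)

  opaque
    unfolding _+_

    +-*-isCommutativeRing : IsCommutativeRing _≡_ _+_ _*_ -_ 0ℤ 1ℤ
    +-*-isCommutativeRing = ℤₚ.+-*-isCommutativeRing

  ring : AlmostCommutativeRing 0ℓ 0ℓ
  ring = fromCommutativeRing (record { isCommutativeRing = +-*-isCommutativeRing })
    λ { (+ 0) → just refl ; _ → nothing }

  opaque
    unfolding _+_

    pos-+ : ∀ m n → + (m ℕ.+ n) ≡ + m + + n
    pos-+ m n = refl

    pos-* : ∀ m n → + (m ℕ.* n) ≡ + m * + n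
    pos-* = ℤₚ.pos-*

    +-comm : ∀ x y → x + y ≡ y + x
    +-comm = ℤₚ.+-comm

    +-assoc : ∀ x y z → x + y + z ≡ x + (y + z)
    +-assoc = ℤₚ.+-assoc

    +-identityˡ : ∀ x → 0ℤ + x ≡ x
    +-identityˡ = ℤₚ.+-identityˡ

    +-identityʳ : ∀ x → x + 0ℤ ≡ x
    +-identityʳ = ℤₚ.+-identityʳ

    *-comm : ∀ x y → x * y ≡ y * x
    *-comm = ℤₚ.*-comm

    *-assoc : ∀ x y z → x * y * z ≡ x * (y * z)
    *-assoc = ℤₚ.*-assoc

    *-identityˡ : ∀ x → 1ℤ * x ≡ x
    *-identityˡ = ℤₚ.*-identityˡ

    *-zeroˡ : ∀ x → 0ℤ * x ≡ 0ℤ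
    *-zeroˡ = ℤₚ.*-zeroˡ

    *-zeroʳ : ∀ x → x * 0ℤ ≡ 0ℤ
    *-zeroʳ = ℤₚ.*-zeroʳ

    *-distribˡ-+ : ∀ x y z → x * (y + z) ≡ x * y + x * z
    *-distribˡ-+ = ℤₚ.*-distribˡ-+

    *-distribʳ-+ : ∀ x y z → (y + z) * x ≡ y * x + z * x
    *-distribʳ-+ = ℤₚ.*-distribʳ-+

    +-cancelˡ : ∀ c {x y} → c + x ≡ c + y → x ≡ y
    +-cancelˡ c {x} {y} h = trans (sym (cancel c x)) (trans (cong (_+_ (- c)) h) (cancel c y))
      where
      cancel : ∀ c x → - c + (c + x) ≡ x
      cancel = solve-∀ ring

  module Mod (M : ℤ) where

    infix 4 _≈_

    -- A record with an explicit quotient keeps both sides visible to unification, and matching on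
    -- it replaces `x` by `y + quotient * M`.
    record _≈_ (x y : ℤ) : Set where
      constructor modulo
      field
        quotient : ℤ
        equality : x ≡ y + quotient * M

    opaque
      unfolding _+_

      ≈-reflexive : ∀ {x y} → x ≡ y → x ≈ y
      ≈-reflexive {x} refl = modulo 0ℤ (lem x M)
        where
        lem : ∀ x m → x ≡ x + 0ℤ * m
        lem = solve-∀ ring

      ≈-sym : ∀ {x y} → x ≈ y → y ≈ x
      ≈-sym {x} {y} (modulo k refl) = modulo (- k) (lem y k M)
        where
        lem : ∀ y k m → y ≡ y + k * m + - k * m
        lem = solve-∀ ring

      ≈-trans : ∀ {x y z} → x ≈ y → y ≈ z → x ≈ z
      ≈-trans {z = z} (modulo k refl) (modulo l refl) = modulo (l + k) (lem z l k M)
        where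
        lem : ∀ z l k m → z + l * m + k * m ≡ z + (l + k) * m
        lem = solve-∀ ring

      +-cong : ∀ {x y z w} → x ≈ y → z ≈ w → x + z ≈ y + w
      +-cong {y = y} {w = w} (modulo k refl) (modulo l refl) = modulo (k + l) (lem y k w l M)
        where
        lem : ∀ y k w l m → y + k * m + (w + l * m) ≡ y + w + (k + l) * m
        lem = solve-∀ ring

      *-cong : ∀ {x y z w} → x ≈ y → z ≈ w → x * z ≈ y * w
      *-cong {y = y} {w = w} (modulo k refl) (modulo l refl) =
        modulo (k * w + y * l + k * l * M) (lem y k w l M)
        where
        lem : ∀ y k w l m → (y + k * m) * (w + l * m) ≡ y * w + (k * w + y * l + k * l * m) * m
        lem = solve-∀ ring

      -‿cong : ∀ {x y} → x ≈ y → - x ≈ - y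
      -‿cong {y = y} (modulo k refl) = modulo (- k) (lem y k M)
        where
        lem : ∀ y k m → - (y + k * m) ≡ - y + - k * m
        lem = solve-∀ ring

      *M≈0 : ∀ k → k * M ≈ 0ℤ
      *M≈0 k = modulo k (sym (ℤₚ.+-identityˡ _))

    ≈-refl : ∀ {x} → x ≈ x
    ≈-refl = ≈-reflexive refl

    *-congˡ : ∀ c {x y} → x ≈ y → c * x ≈ c * y
    *-congˡ c = *-cong (≈-refl {c})

    *-congʳ : ∀ c {x y} → x ≈ y → x * c ≈ y * c
    *-congʳ c h = *-cong h (≈-refl {c})

    +-congˡ : ∀ c {x y} → x ≈ y → c + x ≈ c + y
    +-congˡ c = +-cong (≈-refl {c})

    +-congʳ : ∀ c {x y} → x ≈ y → x + c ≈ y + c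
    +-congʳ c h = +-cong h (≈-refl {c})

    ≈-setoid : Setoid 0ℓ 0ℓ
    ≈-setoid = record
      { _≈_ = _≈_ ; isEquivalence = record { refl = ≈-refl ; sym = ≈-sym ; trans = ≈-trans } }

    module ≈-Reasoning = Relation.Binary.Reasoning.Setoid ≈-setoid

    *-cancel : ∀ c′ c {x y} → c′ * c ≈ 1ℤ → c * x ≈ c * y → x ≈ y
    *-cancel c′ c {x} {y} inverse h = ≈-trans (≈-sym (step x)) (≈-trans (*-congˡ c′ h) (step y))
      where
      step : ∀ z → c′ * (c * z) ≈ z
      step z = ≈-trans (≈-reflexive (sym (*-assoc c′ c z)))
              (≈-trans (*-congʳ z inverse) (≈-reflexive (*-identityˡ z)))

  infix 4 _≈_[mod_]

  _≈_[mod_] : ℤ → ℤ → ℤ → Set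
  x ≈ y [mod M ] = Mod._≈_ M x y

  -- Finite sums

  Σ : ℕ → (ℕ → ℤ) → ℤ
  Σ zero    f = 0ℤ
  Σ (suc n) f = f 0 + Σ n (f ∘ suc)

  Σ-cong : ∀ n {f g : ℕ → ℤ} → (∀ i → i ℕ.< n → f i ≡ g i) → Σ n f ≡ Σ n g
  Σ-cong zero    h = refl
  Σ-cong (suc n) h = cong₂ _+_ (h 0 (s≤s z≤n)) (Σ-cong n λ i i<n → h (suc i) (s≤s i<n))

  Σ-zero : ∀ n {f : ℕ → ℤ} → (∀ i → i ℕ.< n → f i ≡ 0ℤ) → Σ n f ≡ 0ℤ
  Σ-zero zero    h = refl
  Σ-zero (suc n) h = trans (cong₂ _+_ (h 0 (s≤s z≤n)) (Σ-zero n λ i i<n → h (suc i) (s≤s i<n))) (+-identityˡ 0ℤ)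

  Σ-+ : ∀ n (f g : ℕ → ℤ) → Σ n (λ i → f i + g i) ≡ Σ n f + Σ n g
  Σ-+ zero    f g = sym (+-identityˡ 0ℤ)
  Σ-+ (suc n) f g = trans (cong (_+_ (f 0 + g 0)) (Σ-+ n (f ∘ suc) (g ∘ suc))) (lem _ _ _ _)
    where
    opaque
      unfolding _+_
      lem : ∀ a b c d → a + b + (c + d) ≡ a + c + (b + d)
      lem = solve-∀ ring

  Σ-*ˡ : ∀ n c (f : ℕ → ℤ) → Σ n (λ i → c * f i) ≡ c * Σ n f
  Σ-*ˡ zero    c f = sym (*-zeroʳ c)
  Σ-*ˡ (suc n) c f = trans (cong (_+_ (c * f 0)) (Σ-*ˡ n c (f ∘ suc))) (sym (*-distribˡ-+ c _ _))

  Σ-const : ∀ n c → Σ n (λ _ → c) ≡ + n * c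
  Σ-const zero    c = sym (*-zeroˡ c)
  Σ-const (suc n) c = trans (cong (_+_ c) (Σ-const n c)) (sym (trans (cong (_* c) (pos-+ 1 n)) (lem (+ n) c)))
    where
    opaque
      unfolding _+_
      lem : ∀ n c → (1ℤ + n) * c ≡ c + n * c
      lem = solve-∀ ring

  Σ-swap : ∀ m n (f : ℕ → ℕ → ℤ) → Σ m (λ i → Σ n (λ j → f i j)) ≡ Σ n (λ j → Σ m (λ i → f i j))
  Σ-swap zero    n f = sym (Σ-zero n λ _ _ → refl)
  Σ-swap (suc m) n f = trans (cong (_+_ (Σ n (f 0))) (Σ-swap m n (f ∘ suc))) (sym (Σ-+ n _ _))

  Σ-split : ∀ m n (f : ℕ → ℤ) → Σ (m ℕ.+ n) f ≡ Σ m f + Σ n (λ i → f (m ℕ.+ i))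
  Σ-split zero    n f = sym (+-identityˡ _)
  Σ-split (suc m) n f = trans (cong (_+_ (f 0)) (Σ-split m n (f ∘ suc))) (sym (+-assoc (f 0) _ _))

  Σ-last : ∀ n (f : ℕ → ℤ) → Σ (suc n) f ≡ Σ n f + f n
  Σ-last n f = begin
    Σ (suc n) f               ≡⟨ cong (λ k → Σ k f) (ℕₚ.+-comm 1 n) ⟩
    Σ (n ℕ.+ 1) f             ≡⟨ Σ-split n 1 f ⟩
    Σ n f + (f (n ℕ.+ 0) + 0ℤ) ≡⟨ cong (_+_ (Σ n f)) (+-identityʳ _) ⟩
    Σ n f + f (n ℕ.+ 0)       ≡⟨ cong (λ k → Σ n f + f k) (ℕₚ.+-identityʳ n) ⟩
    Σ n f + f n               ∎
    where open ≡-Reasoning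

  Σ-block : ∀ n t (f : ℕ → ℤ) → Σ (t ℕ.* n) f ≡ Σ t (λ s → Σ n (λ r → f (r ℕ.+ s ℕ.* n)))
  Σ-block n zero    f = refl
  Σ-block n (suc t) f = begin
    Σ (n ℕ.+ t ℕ.* n) f
      ≡⟨ Σ-split n (t ℕ.* n) f ⟩
    Σ n f + Σ (t ℕ.* n) (λ i → f (n ℕ.+ i))
      ≡⟨ cong₂ _+_ (Σ-cong n λ i _ → cong f (sym (ℕₚ.+-identityʳ i))) (Σ-block n t _) ⟩
    Σ n (λ r → f (r ℕ.+ 0)) + Σ t (λ s → Σ n (λ r → f (n ℕ.+ (r ℕ.+ s ℕ.* n))))
      ≡⟨ cong (_+_ _) (Σ-cong t λ s _ → Σ-cong n λ r _ → cong f (shift r (s ℕ.* n))) ⟩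
    Σ n (λ r → f (r ℕ.+ 0)) + Σ t (λ s → Σ n (λ r → f (r ℕ.+ (n ℕ.+ s ℕ.* n)))) ∎
    where
    open ≡-Reasoning
    shift : ∀ r k → n ℕ.+ (r ℕ.+ k) ≡ r ℕ.+ (n ℕ.+ k)
    shift r k = trans (sym (ℕₚ.+-assoc n r k)) (trans (cong (ℕ._+ k) (ℕₚ.+-comm n r)) (ℕₚ.+-assoc r n k))

  -- Trades the range 1, ..., n for 0, ..., n - 1. Functions that vanish at multiples of p have
  -- equal end values.
  Σ-rotate : ∀ n (f : ℕ → ℤ) → f 0 ≡ f n → Σ n (f ∘ suc) ≡ Σ n f
  Σ-rotate n f eq = +-cancelˡ (f 0) (begin
    f 0 + Σ n (f ∘ suc) ≡⟨ Σ-last n f ⟩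
    Σ n f + f n         ≡⟨ cong (λ x → Σ n f + x) (sym eq) ⟩
    Σ n f + f 0         ≡⟨ +-comm _ (f 0) ⟩
    f 0 + Σ n f         ∎)
    where
    open ≡-Reasoning

  Σ-reverse : ∀ n (f : ℕ → ℤ) → Σ n (λ i → f (n ℕ.∸ i)) ≡ Σ n (f ∘ suc)
  Σ-reverse zero    f = refl
  Σ-reverse (suc n) f = begin
    f (suc n) + Σ n (λ i → f (n ℕ.∸ i)) ≡⟨ cong (_+_ (f (suc n))) (Σ-reverse n f) ⟩
    f (suc n) + Σ n (f ∘ suc)           ≡⟨ +-comm (f (suc n)) _ ⟩
    Σ n (f ∘ suc) + f (suc n)           ≡⟨ sym (Σ-last n (f ∘ suc)) ⟩
    Σ (suc n) (f ∘ suc)                 ∎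
    where open ≡-Reasoning

  Σ-reflect : ∀ n (f : ℕ → ℤ) → f 0 ≡ f n → Σ n (λ i → f (n ℕ.∸ i)) ≡ Σ n f
  Σ-reflect n f eq = trans (Σ-reverse n f) (Σ-rotate n f eq)

  -- The Kronecker delta and reindexing of sums

  δ : ℕ → ℕ → ℤ
  δ a b = if a ℕ.≡ᵇ b then 1ℤ else 0ℤ

  δ-refl : ∀ a → δ a a ≡ 1ℤ
  δ-refl zero    = refl
  δ-refl (suc a) = δ-refl a

  δ-≢ : ∀ {a b} → a ≢ b → δ a b ≡ 0ℤ
  δ-≢ {zero}  {zero}  ne = ⊥-elim (ne refl)
  δ-≢ {zero}  {suc b} ne = refl
  δ-≢ {suc a} {zero}  ne = refl
  δ-≢ {suc a} {suc b} ne = δ-≢ (ne ∘ cong suc)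

  δ-+ : ∀ c a b → δ (c ℕ.+ a) (c ℕ.+ b) ≡ δ a b
  δ-+ zero    a b = refl
  δ-+ (suc c) a b = δ-+ c a b

  δ-cong : ∀ a b c d → (a ≡ b → c ≡ d) → (c ≡ d → a ≡ b) → δ a b ≡ δ c d
  δ-cong a b c d f g with a ℕ.≟ b
  ... | yes a≡b rewrite f a≡b | a≡b = trans (δ-refl b) (sym (δ-refl d))
  ... | no  a≢b = trans (δ-≢ a≢b) (sym (δ-≢ (a≢b ∘ g)))

  δ-*-cong : ∀ a b {x y} → (a ≡ b → x ≡ y) → δ a b * x ≡ δ a b * y
  δ-*-cong a b {x} {y} h with a ℕ.≟ b
  ... | yes a≡b = cong (δ a b *_) (h a≡b)
  ... | no  a≢b = trans (kill x) (sym (kill y))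
    where
    kill : ∀ z → δ a b * z ≡ 0ℤ
    kill z = trans (cong (_* z) (δ-≢ a≢b)) (*-zeroˡ z)

  Σ-δ-≢ : ∀ n k (f : ℕ → ℤ) → n ℕ.≤ k → Σ n (λ i → δ i k * f i) ≡ 0ℤ
  Σ-δ-≢ n k f n≤k = Σ-zero n λ i i<n → trans (cong (_* f i) (δ-≢ (ℕₚ.<⇒≢ (ℕₚ.<-≤-trans i<n n≤k)))) (*-zeroˡ (f i))

  Σ-δ : ∀ n k (f : ℕ → ℤ) → k ℕ.< n → Σ n (λ i → δ i k * f i) ≡ f k
  Σ-δ (suc n) zero    f k<n = begin
    1ℤ * f 0 + Σ n (λ i → 0ℤ * f (suc i)) ≡⟨ cong₂ _+_ (*-identityˡ (f 0)) (Σ-zero n λ i _ → *-zeroˡ (f (suc i))) ⟩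
    f 0 + 0ℤ                              ≡⟨ +-identityʳ (f 0) ⟩
    f 0                                   ∎
    where open ≡-Reasoning
  Σ-δ (suc n) (suc k) f (s≤s k<n) = trans (cong (_+ Σ n (λ i → δ i k * f (suc i))) (*-zeroˡ (f 0))) (trans (+-identityˡ _) (Σ-δ n k (f ∘ suc) k<n))

  -- Double counting: `g (σ i)` is written as a sum over k against `δ k (σ i)`, the sums are
  -- exchanged, and the delta is solved for i through `τ`.
  Σ-permute : ∀ n (σ τ : ℕ → ℕ) →
              (∀ i → i ℕ.< n → σ i ℕ.< n) → (∀ k → k ℕ.< n → τ k ℕ.< n) →
              (∀ i → i ℕ.< n → τ (σ i) ≡ i) → (∀ k → k ℕ.< n → σ (τ k) ≡ k) →
              ∀ g → Σ n (g ∘ σ) ≡ Σ n g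
  Σ-permute n σ τ σ< τ< τσ στ g = begin
    Σ n (g ∘ σ)
      ≡⟨ Σ-cong n (λ i i<n → sym (Σ-δ n (σ i) g (σ< i i<n))) ⟩
    Σ n (λ i → Σ n (λ k → δ k (σ i) * g k))
      ≡⟨ Σ-swap n n _ ⟩
    Σ n (λ k → Σ n (λ i → δ k (σ i) * g k))
      ≡⟨ Σ-cong n (λ k k<n → Σ-cong n (λ i i<n → cong (_* g k) (δ-cong k (σ i) i (τ k)
           (λ { refl → sym (τσ i i<n) }) (λ { refl → sym (στ k k<n) })))) ⟩
    Σ n (λ k → Σ n (λ i → δ i (τ k) * g k))
      ≡⟨ Σ-cong n (λ k k<n → Σ-δ n (τ k) (λ _ → g k) (τ< k k<n)) ⟩
    Σ n g ∎
    where open ≡-Reasoning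

  module _ (M : ℤ) where
    open Mod M

    Σ-cong≈ : ∀ n {f g : ℕ → ℤ} → (∀ i → i ℕ.< n → f i ≈ g i) → Σ n f ≈ Σ n g
    Σ-cong≈ zero    h = ≈-refl
    Σ-cong≈ (suc n) h = +-cong (h 0 (s≤s z≤n)) (Σ-cong≈ n λ i i<n → h (suc i) (s≤s i<n))

  -- Sums over triples i + j + k = t

  -- The condition on the sum is a factor in front of a sum over the full box of indices below N, so
  -- that ranges can be split, swapped, reflected or dilated one coordinate at a time.
  tri : ℕ → ℕ → (ℕ → ℕ → ℕ → ℤ) → ℤ
  tri N t φ = Σ N λ i → Σ N λ j → Σ N λ k → δ (i ℕ.+ j ℕ.+ k) t * φ i j k

  prod : (f g h : ℕ → ℤ) → ℕ → ℕ → ℕ → ℤ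
  prod f g h i j k = f i * g j * h k

  Σ³-cong : ∀ N {F G : ℕ → ℕ → ℕ → ℤ} →
            (∀ i j k → i ℕ.< N → j ℕ.< N → k ℕ.< N → F i j k ≡ G i j k) →
            Σ N (λ i → Σ N λ j → Σ N (F i j)) ≡ Σ N (λ i → Σ N λ j → Σ N (G i j))
  Σ³-cong N h = Σ-cong N λ i i< → Σ-cong N λ j j< → Σ-cong N λ k k< → h i j k i< j< k<

  Σ³-+ : ∀ N (F G : ℕ → ℕ → ℕ → ℤ) →
         Σ N (λ i → Σ N λ j → Σ N λ k → F i j k + G i j k) ≡
         Σ N (λ i → Σ N λ j → Σ N (F i j)) + Σ N (λ i → Σ N λ j → Σ N (G i j))
  Σ³-+ N F G = trans
    (Σ-cong N λ i _ → trans (Σ-cong N λ j _ → Σ-+ N (F i j) (G i j)) (Σ-+ N _ _))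
    (Σ-+ N _ _)

  Σ³-*ˡ : ∀ N c (F : ℕ → ℕ → ℕ → ℤ) →
          Σ N (λ i → Σ N λ j → Σ N λ k → c * F i j k) ≡ c * Σ N (λ i → Σ N λ j → Σ N (F i j))
  Σ³-*ˡ N c F = trans
    (Σ-cong N λ i _ → trans (Σ-cong N λ j _ → Σ-*ˡ N c (F i j)) (Σ-*ˡ N c _))
    (Σ-*ˡ N c _)

  tri-cong : ∀ N t {φ ψ} → (∀ i j k → i ℕ.+ j ℕ.+ k ≡ t → φ i j k ≡ ψ i j k) → tri N t φ ≡ tri N t ψ
  tri-cong N t h = Σ³-cong N λ i j k _ _ _ → δ-*-cong (i ℕ.+ j ℕ.+ k) t (h i j k)

  tri-+ : ∀ N t φ ψ → tri N t (λ i j k → φ i j k + ψ i j k) ≡ tri N t φ + tri N t ψ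
  tri-+ N t φ ψ = trans (Σ³-cong N λ i j k _ _ _ → *-distribˡ-+ (δ (i ℕ.+ j ℕ.+ k) t) (φ i j k) (ψ i j k))
    (Σ³-+ N _ _)

  tri-*ˡ : ∀ N t c φ → tri N t (λ i j k → c * φ i j k) ≡ c * tri N t φ
  tri-*ˡ N t c φ = trans (Σ³-cong N λ i j k _ _ _ → lem (δ (i ℕ.+ j ℕ.+ k) t) c (φ i j k)) (Σ³-*ˡ N c _)
    where
    opaque
      unfolding _+_
      lem : ∀ d c x → d * (c * x) ≡ c * (d * x)
      lem = solve-∀ ring

  tri-swap₁₂ : ∀ N t φ → tri N t φ ≡ tri N t (λ i j k → φ j i k)
  tri-swap₁₂ N t φ = trans (Σ-swap N N _)
    (Σ³-cong N λ i j k _ _ _ → cong (λ s → δ (s ℕ.+ k) t * φ j i k) (ℕₚ.+-comm j i))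

  tri-swap₂₃ : ∀ N t φ → tri N t φ ≡ tri N t (λ i j k → φ i k j)
  tri-swap₂₃ N t φ = trans (Σ-cong N λ i _ → Σ-swap N N _)
    (Σ³-cong N λ i j k _ _ _ → cong (λ s → δ s t * φ i k j) (lem i j k))
    where
    lem : ∀ i j k → i ℕ.+ k ℕ.+ j ≡ i ℕ.+ j ℕ.+ k
    lem = ℕ-Solver.solve-∀

  module _ (f g : ℕ → ℤ) (N t : ℕ) where

    private
      swapˡ : ∀ x y z → x * y * z ≡ y * x * z
      swapˡ x y z = cong (_* z) (*-comm x y)

      opaque
        unfolding _+_
        swapʳ : ∀ x y z → x * y * z ≡ x * z * y
        swapʳ = solve-∀ ring

    -- The condition i + j + k = t is symmetric, so the position of a distinguished factor is
    -- immaterial; symmetric expansions thereby yield three equal terms.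
    tri-prod₂ : tri N t (prod g f g) ≡ tri N t (prod f g g)
    tri-prod₂ = trans (tri-swap₁₂ N t _) (tri-cong N t λ i j k _ → swapˡ (g j) (f i) (g k))

    tri-prod₃ : tri N t (prod g g f) ≡ tri N t (prod f g g)
    tri-prod₃ = trans (trans (tri-swap₂₃ N t _) (tri-cong N t λ i j k _ → swapʳ (g i) (g k) (f j))) tri-prod₂

  -- Reflection and dilation of triple sums

  Vanishes : (ℕ → ℕ → ℕ → ℤ) → ℕ → Set
  Vanishes φ a = (∀ j k → φ a j k ≡ 0ℤ) × (∀ i k → φ i a k ≡ 0ℤ) × (∀ i j → φ i j a ≡ 0ℤ)

  prod-vanishes : ∀ {f} a → f a ≡ 0ℤ → Vanishes (prod f f f) a
  prod-vanishes {f} a fa≡0 =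
    (λ j k → trans (cong (λ x → x * f j * f k) fa≡0) (lem₁ (f j) (f k))) ,
    (λ i k → trans (cong (λ x → f i * x * f k) fa≡0) (lem₂ (f i) (f k))) ,
    (λ i j → trans (cong (f i * f j *_) fa≡0) (*-zeroʳ (f i * f j)))
    where
    opaque
      unfolding _+_
      lem₁ : ∀ x y → 0ℤ * x * y ≡ 0ℤ
      lem₁ = solve-∀ ring
      lem₂ : ∀ x y → x * 0ℤ * y ≡ 0ℤ
      lem₂ = solve-∀ ring

  -- Replacing each entry by its complement to N turns the total 2 N into 3 N - 2 N = N. The
  -- complement of 0 is N, outside the range, hence the vanishing at both ends.
  tri-reflect : ∀ N φ → Vanishes φ 0 → Vanishes φ N →
                tri N (N ℕ.+ N) φ ≡ tri N N (λ i j k → φ (N ℕ.∸ i) (N ℕ.∸ j) (N ℕ.∸ k))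
  tri-reflect N φ (a₀ , b₀ , c₀) (aₙ , bₙ , cₙ) = begin
    tri N (N ℕ.+ N) φ
      ≡⟨ sym (Σ-reflect N _ (trans (zero₁ 0 a₀) (sym (zero₁ N aₙ)))) ⟩
    Σ N (λ i → Σ N λ j → Σ N λ k → F (N ℕ.∸ i) j k)
      ≡⟨ (Σ-cong N λ i _ → sym (Σ-reflect N (λ j → Σ N λ k → F (N ℕ.∸ i) j k)
           (trans (zero₂ (N ℕ.∸ i) 0 b₀) (sym (zero₂ (N ℕ.∸ i) N bₙ))))) ⟩
    Σ N (λ i → Σ N λ j → Σ N λ k → F (N ℕ.∸ i) (N ℕ.∸ j) k)
      ≡⟨ (Σ-cong N λ i _ → Σ-cong N λ j _ → sym (Σ-reflect N (λ k → F (N ℕ.∸ i) (N ℕ.∸ j) k)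
           (trans (zero₃ (N ℕ.∸ i) (N ℕ.∸ j) 0 c₀) (sym (zero₃ (N ℕ.∸ i) (N ℕ.∸ j) N cₙ))))) ⟩
    Σ N (λ i → Σ N λ j → Σ N λ k → F (N ℕ.∸ i) (N ℕ.∸ j) (N ℕ.∸ k))
      ≡⟨ (Σ³-cong N λ i j k i< j< k< → cong (_* φ (N ℕ.∸ i) (N ℕ.∸ j) (N ℕ.∸ k))
           (reflect-δ {i} {N ℕ.∸ i} {j} {N ℕ.∸ j} {k} {N ℕ.∸ k} (ℕₚ.m∸n+n≡m (ℕₚ.<⇒≤ i<)) (ℕₚ.m∸n+n≡m (ℕₚ.<⇒≤ j<)) (ℕₚ.m∸n+n≡m (ℕₚ.<⇒≤ k<)))) ⟩
    tri N N (λ i j k → φ (N ℕ.∸ i) (N ℕ.∸ j) (N ℕ.∸ k)) ∎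
    where
    open ≡-Reasoning
    F : ℕ → ℕ → ℕ → ℤ
    F i j k = δ (i ℕ.+ j ℕ.+ k) (N ℕ.+ N) * φ i j k

    zero₃ : ∀ i j a → (∀ i j → φ i j a ≡ 0ℤ) → F i j a ≡ 0ℤ
    zero₃ i j a h = trans (cong (δ (i ℕ.+ j ℕ.+ a) (N ℕ.+ N) *_) (h i j)) (*-zeroʳ (δ (i ℕ.+ j ℕ.+ a) (N ℕ.+ N)))

    zero₂ : ∀ i a → (∀ i k → φ i a k ≡ 0ℤ) → Σ N (λ k → F i a k) ≡ 0ℤ
    zero₂ i a h = Σ-zero N λ k _ →
      trans (cong (δ (i ℕ.+ a ℕ.+ k) (N ℕ.+ N) *_) (h i k)) (*-zeroʳ (δ (i ℕ.+ a ℕ.+ k) (N ℕ.+ N)))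

    zero₁ : ∀ a → (∀ j k → φ a j k ≡ 0ℤ) → Σ N (λ j → Σ N λ k → F a j k) ≡ 0ℤ
    zero₁ a h = Σ-zero N λ j _ → Σ-zero N λ k _ →
      trans (cong (δ (a ℕ.+ j ℕ.+ k) (N ℕ.+ N) *_) (h j k)) (*-zeroʳ (δ (a ℕ.+ j ℕ.+ k) (N ℕ.+ N)))

    reflect-δ : ∀ {i i′ j j′ k k′} → i′ ℕ.+ i ≡ N → j′ ℕ.+ j ≡ N → k′ ℕ.+ k ≡ N →
                δ (i′ ℕ.+ j′ ℕ.+ k′) (N ℕ.+ N) ≡ δ (i ℕ.+ j ℕ.+ k) N
    reflect-δ {i} {i′} {j} {j′} {k} {k′} p q r =
      δ-cong (i′ ℕ.+ j′ ℕ.+ k′) (N ℕ.+ N) (i ℕ.+ j ℕ.+ k) N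
        (λ h → ℕₚ.+-cancelˡ-≡ (N ℕ.+ N) _ _ (trans (cong (ℕ._+ (i ℕ.+ j ℕ.+ k)) (sym h)) total))
        (λ h → ℕₚ.+-cancelʳ-≡ N _ _ (trans (cong ((i′ ℕ.+ j′ ℕ.+ k′) ℕ.+_) (sym h)) total))
      where
      lem : ∀ i i′ j j′ k k′ → (i′ ℕ.+ j′ ℕ.+ k′) ℕ.+ (i ℕ.+ j ℕ.+ k) ≡ (i′ ℕ.+ i) ℕ.+ (j′ ℕ.+ j) ℕ.+ (k′ ℕ.+ k)
      lem = ℕ-Solver.solve-∀
      total : (i′ ℕ.+ j′ ℕ.+ k′) ℕ.+ (i ℕ.+ j ℕ.+ k) ≡ N ℕ.+ N ℕ.+ N
      total = trans (lem i i′ j j′ k k′) (cong₂ ℕ._+_ (cong₂ ℕ._+_ p q) r)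

  -- Covers the parity `ε`, the divisibility indicator `𝟙∣` and the constant 1 (for m = 1) at once.
  -- The field `symmetric` makes the weight even under i ↦ N - i whenever m divides N.
  record Indicates (m : ℕ) (χ : ℕ → ℤ) : Set where
    field
      multiple    : ∀ s → χ (s ℕ.* m) ≡ 1ℤ
      nonmultiple : ∀ r s → suc r ℕ.< m → χ (suc r ℕ.+ s ℕ.* m) ≡ 0ℤ
      symmetric   : ∀ i j s → i ℕ.+ j ≡ s ℕ.* m → χ i ≡ χ j

  module _ {m : ℕ} {χ : ℕ → ℤ} (ind : Indicates m χ) (m>0 : 0 ℕ.< m) where
    open Indicates ind

    Σ-dilate : ∀ N (g : ℕ → ℤ) → Σ (N ℕ.* m) (λ i → χ i * g i) ≡ Σ N (λ s → g (s ℕ.* m))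
    Σ-dilate N g = trans (Σ-block m N (λ i → χ i * g i)) (Σ-cong N λ s _ → block m refl s)
      where
      open ≡-Reasoning
      -- The length is a separate variable, so that its first element can be split off while
      -- `s ℕ.* m` keeps its form.
      block : ∀ m′ → m ≡ m′ → ∀ s → Σ m′ (λ r → χ (r ℕ.+ s ℕ.* m) * g (r ℕ.+ s ℕ.* m)) ≡ g (s ℕ.* m)
      block zero m≡0 s = ⊥-elim (ℕₚ.<⇒≢ m>0 (sym m≡0))
      block (suc m′) m≡ s = begin
        χ (s ℕ.* m) * g (s ℕ.* m) + Σ m′ (λ r → χ (suc r ℕ.+ s ℕ.* m) * g (suc r ℕ.+ s ℕ.* m))
          ≡⟨ cong₂ _+_ (trans (cong (_* g (s ℕ.* m)) (multiple s)) (*-identityˡ _))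
               (Σ-zero m′ λ r r< → trans (cong (_* g (suc r ℕ.+ s ℕ.* m))
                  (nonmultiple r s (subst (suc r ℕ.<_) (sym m≡) (s≤s r<)))) (*-zeroˡ _)) ⟩
        g (s ℕ.* m) + 0ℤ ≡⟨ +-identityʳ _ ⟩
        g (s ℕ.* m) ∎

    tri-dilate : ∀ N (φ : ℕ → ℕ → ℕ → ℤ) → tri (N ℕ.* m) (N ℕ.* m) (λ i j k → χ i * (χ j * (χ k * φ i j k))) ≡
                         tri N N (λ i j k → φ (i ℕ.* m) (j ℕ.* m) (k ℕ.* m))
    tri-dilate N φ = begin
      tri S S (λ i j k → χ i * (χ j * (χ k * φ i j k)))
        ≡⟨ Σ³-cong S (λ i j k _ _ _ → lem (δ (i ℕ.+ j ℕ.+ k) S) (χ i) (χ j) (χ k) (φ i j k)) ⟩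
      Σ S (λ i → Σ S λ j → Σ S λ k → χ i * (χ j * (χ k * F i j k)))
        ≡⟨ (Σ-cong S λ i _ → trans
              (Σ-cong S λ j _ → trans (Σ-*ˡ S (χ i) _) (cong (χ i *_) (Σ-*ˡ S (χ j) _)))
              (Σ-*ˡ S (χ i) _)) ⟩
      Σ S (λ i → χ i * Σ S (λ j → χ j * Σ S (λ k → χ k * F i j k)))
        ≡⟨ trans (Σ-dilate N (λ i → Σ S (λ j → χ j * Σ S (λ k → χ k * F i j k))))
             (Σ-cong N λ i _ → trans (Σ-dilate N (λ j → Σ S (λ k → χ k * F (i ℕ.* m) j k)))
               (Σ-cong N λ j _ → Σ-dilate N (F (i ℕ.* m) (j ℕ.* m)))) ⟩
      Σ N (λ i → Σ N λ j → Σ N λ k → F (i ℕ.* m) (j ℕ.* m) (k ℕ.* m))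
        ≡⟨ (Σ³-cong N λ i j k _ _ _ → cong (_* φ (i ℕ.* m) (j ℕ.* m) (k ℕ.* m)) (dilate-δ i j k)) ⟩
      tri N N (λ i j k → φ (i ℕ.* m) (j ℕ.* m) (k ℕ.* m)) ∎
      where
      open ≡-Reasoning
      S : ℕ
      S = N ℕ.* m

      F : ℕ → ℕ → ℕ → ℤ
      F i j k = δ (i ℕ.+ j ℕ.+ k) S * φ i j k

      opaque
        unfolding _+_
        lem : ∀ d a b c x → d * (a * (b * (c * x))) ≡ a * (b * (c * (d * x)))
        lem = solve-∀ ring

      collect : ∀ i j k m → i ℕ.* m ℕ.+ j ℕ.* m ℕ.+ k ℕ.* m ≡ (i ℕ.+ j ℕ.+ k) ℕ.* m
      collect = ℕ-Solver.solve-∀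

      dilate-δ : ∀ i j k → δ (i ℕ.* m ℕ.+ j ℕ.* m ℕ.+ k ℕ.* m) S ≡ δ (i ℕ.+ j ℕ.+ k) N
      dilate-δ i j k = δ-cong (i ℕ.* m ℕ.+ j ℕ.* m ℕ.+ k ℕ.* m) S (i ℕ.+ j ℕ.+ k) N
        (λ h → ℕₚ.*-cancelʳ-≡ (i ℕ.+ j ℕ.+ k) N m {{ℕ.>-nonZero m>0}} (trans (sym (collect i j k m)) h))
        (λ h → trans (collect i j k m) (cong (ℕ._* m) h))

  module _ (M : ℤ) where
    open Mod M

    tri-cong≈ : ∀ N t {φ ψ} →
                (∀ i j k → i ℕ.< N → j ℕ.< N → k ℕ.< N → i ℕ.+ j ℕ.+ k ≡ t → φ i j k ≈ ψ i j k) →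
                tri N t φ ≈ tri N t ψ
    tri-cong≈ N t {φ} {ψ} h = Σ-cong≈ M N λ i i< → Σ-cong≈ M N λ j j< → Σ-cong≈ M N λ k k< → term i j k i< j< k<
      where
      term : ∀ i j k → i ℕ.< N → j ℕ.< N → k ℕ.< N →
             δ (i ℕ.+ j ℕ.+ k) t * φ i j k ≈ δ (i ℕ.+ j ℕ.+ k) t * ψ i j k
      term i j k i< j< k< with i ℕ.+ j ℕ.+ k ℕ.≟ t
      ... | yes eq = *-congˡ (δ (i ℕ.+ j ℕ.+ k) t) (h i j k i< j< k< eq)
      ... | no neq = ≈-reflexive (δ-*-cong (i ℕ.+ j ℕ.+ k) t (λ eq → ⊥-elim (neq eq)))

  -- Parity

  ε : ℕ → ℤ
  ε zero          = 1ℤ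
  ε (suc zero)    = 0ℤ
  ε (suc (suc i)) = ε i

  -- Writing (-1)^i through the indicator of even i makes the alternating sum a combination of the
  -- sum over even i and the unsigned sum.
  sgn : ℕ → ℤ
  sgn i = + 2 * ε i - 1ℤ

  ε-double : ∀ n → ε (n ℕ.+ n) ≡ 1ℤ
  ε-double zero    = refl
  ε-double (suc n) = trans (cong (ε ∘ suc) (ℕₚ.+-suc n n)) (ε-double n)

  ε-indicates : Indicates 2 ε
  ε-indicates = record
    { multiple    = even
    ; nonmultiple = λ { zero s _ → odd s ; (suc r) s (s≤s (s≤s ())) }
    ; symmetric   = λ i j s h → same-parity i j (trans (cong ε h) (even s))
    }
    where
    same-parity : ∀ i j → ε (i ℕ.+ j) ≡ 1ℤ → ε i ≡ ε j
    same-parity (suc (suc i)) j             h = same-parity i j h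
    same-parity zero          j             h = sym h
    same-parity (suc zero)    zero          ()
    same-parity (suc zero)    (suc zero)    h = refl
    same-parity (suc zero)    (suc (suc j)) h = same-parity 1 j h
    even : ∀ s → ε (s ℕ.* 2) ≡ 1ℤ
    even zero    = refl
    even (suc s) = even s
    odd : ∀ s → ε (1 ℕ.+ s ℕ.* 2) ≡ 0ℤ
    odd zero    = refl
    odd (suc s) = odd s

  opaque
    unfolding _+_

    -- A triple with even sum has three even entries or exactly one: 2 = 3 - 1 in the first case, 0
    -- = 1 - 1 in the second.
    ε-even-sum : ∀ i j k → ε (i ℕ.+ j ℕ.+ k) ≡ 1ℤ →
                 + 2 * (ε i * (ε j * ε k)) ≡ ε i + ε j + ε k - 1ℤ
    ε-even-sum (suc (suc i)) j             k             h = ε-even-sum i j k h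
    ε-even-sum zero          (suc (suc j)) k             h = ε-even-sum zero j k h
    ε-even-sum (suc zero)    (suc (suc j)) k             h = ε-even-sum (suc zero) j k h
    ε-even-sum zero          zero          (suc (suc k)) h = ε-even-sum zero zero k h
    ε-even-sum zero          (suc zero)    (suc (suc k)) h = ε-even-sum zero (suc zero) k h
    ε-even-sum (suc zero)    zero          (suc (suc k)) h = ε-even-sum (suc zero) zero k h
    ε-even-sum (suc zero)    (suc zero)    (suc (suc k)) h = ε-even-sum (suc zero) (suc zero) k h
    ε-even-sum zero          zero          zero          h = refl
    ε-even-sum zero          (suc zero)    (suc zero)    h = refl
    ε-even-sum (suc zero)    zero          (suc zero)    h = refl
    ε-even-sum (suc zero)    (suc zero)    zero          h = refl
    ε-even-sum zero          zero          (suc zero)    ()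
    ε-even-sum zero          (suc zero)    zero          ()
    ε-even-sum (suc zero)    zero          zero          ()
    ε-even-sum (suc zero)    (suc zero)    (suc zero)    ()

  -- The value f i stands for 1/i modulo M, where M divides n² and 3n; the correction terms in
  -- 1/(n ± i) = ±1/i - n/i² then only enter the symmetric sums through multiples of 3n.
  module Double (M : ℤ) (f : ℕ → ℤ) (n : ℕ)
    (f-0     : f 0 ≡ 0ℤ)
    (f-n     : f n ≡ 0ℤ)
    (f-shift : ∀ i → f (n ℕ.+ i) ≈ f i - + n * (f i * f i) [mod M ])
    (f-refl  : ∀ i → i ℕ.< n → f (n ℕ.∸ i) ≈ - f i - + n * (f i * f i) [mod M ])
    (n²≈0    : + n * + n ≈ 0ℤ [mod M ])
    (3n≈0    : + 3 * + n ≈ 0ℤ [mod M ])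
    where
    open Mod M

    private
      f² : ℕ → ℤ
      f² i = f i * f i

      -- `pert` is the first-order part: the coefficient of - n when the three factors are expanded
      -- as ± f - n f².
      fff pert : ℕ → ℕ → ℕ → ℤ
      fff = prod f f f
      pert i j k = prod f² f f i j k + prod f f² f i j k + prod f f f² i j k

      T Zₙ : ℤ
      T = tri (n ℕ.+ n) (n ℕ.+ n) fff
      Zₙ = tri n n fff

    -- The three terms of `pert` have the same sum by symmetry, which produces the factor 3 n.
    pert≈0 : + n * tri n n pert ≈ 0ℤ
    pert≈0 = begin
      + n * tri n n pert
        ≡⟨ cong (+ n *_) (trans (tri-+ n n (λ i j k → prod f² f f i j k + prod f f² f i j k) (prod f f f²))
             (cong (_+ tri n n (prod f f f²)) (tri-+ n n (prod f² f f) (prod f f² f)))) ⟩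
      + n * (tri n n (prod f² f f) + tri n n (prod f f² f) + tri n n (prod f f f²))
        ≡⟨ cong₂ (λ x y → + n * (tri n n (prod f² f f) + x + y)) (tri-prod₂ f² f n n) (tri-prod₃ f² f n n) ⟩
      + n * (tri n n (prod f² f f) + tri n n (prod f² f f) + tri n n (prod f² f f))
        ≡⟨ lem (+ n) (tri n n (prod f² f f)) ⟩
      + 3 * + n * tri n n (prod f² f f)
        ≈⟨ *-congʳ (tri n n (prod f² f f)) 3n≈0 ⟩
      0ℤ * tri n n (prod f² f f)
        ≡⟨ *-zeroˡ _ ⟩
      0ℤ ∎
      where
      open ≈-Reasoning
      opaque
        unfolding _+_
        lem : ∀ n y → n * (y + y + y) ≡ + 3 * n * y
        lem = solve-∀ ring

    -- After reflection the three signs multiply to -1, the first-order terms cancel by `pert≈0`,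
    -- and all others carry n².
    tri-reflected : tri n (n ℕ.+ n) fff ≈ - Zₙ
    tri-reflected = begin
      tri n (n ℕ.+ n) fff
        ≡⟨ tri-reflect n fff (prod-vanishes 0 f-0) (prod-vanishes n f-n) ⟩
      tri n n (λ i j k → fff (n ℕ.∸ i) (n ℕ.∸ j) (n ℕ.∸ k))
        ≈⟨ tri-cong≈ M n n (λ i j k i< j< k< _ →
             ≈-trans (*-cong (*-cong (f-refl i i<) (f-refl j j<)) (f-refl k k<))
                     (≈-trans (≈-reflexive (expand (f i) (f j) (f k) (+ n)))
                     (≈-trans (+-congˡ _ (*-congʳ (R (f i) (f j) (f k) (+ n)) n²≈0))
                              (≈-reflexive (drop _ (R (f i) (f j) (f k) (+ n))))))) ⟩
      tri n n (λ i j k → - 1ℤ * fff i j k + - + n * pert i j k)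
        ≡⟨ tri-+ n n (λ i j k → - 1ℤ * fff i j k) (λ i j k → - + n * pert i j k) ⟩
      tri n n (λ i j k → - 1ℤ * fff i j k) + tri n n (λ i j k → - + n * pert i j k)
        ≡⟨ cong₂ _+_ (tri-*ˡ n n (- 1ℤ) fff) (tri-*ˡ n n (- + n) pert) ⟩
      - 1ℤ * Zₙ + - + n * tri n n pert
        ≡⟨ neg Zₙ (+ n) (tri n n pert) ⟩
      - (Zₙ + + n * tri n n pert)
        ≈⟨ -‿cong (+-congˡ Zₙ pert≈0) ⟩
      - (Zₙ + 0ℤ)
        ≡⟨ cong -_ (+-identityʳ Zₙ) ⟩
      - Zₙ ∎
      where
      open ≈-Reasoning
      -- The cofactor of n² in the expanded product.
      R : ℤ → ℤ → ℤ → ℤ → ℤ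
      R x y z n = - (x * x * (y * y) * z + x * x * y * (z * z) + x * (y * y) * (z * z) + n * (x * x) * (y * y) * (z * z))
      opaque
        unfolding _+_
        expand : ∀ x y z n → (- x - n * (x * x)) * (- y - n * (y * y)) * (- z - n * (z * z)) ≡
          (- 1ℤ * (x * y * z) + - n * (x * x * y * z + x * (y * y) * z + x * y * (z * z))) + n * n *
          (- (x * x * (y * y) * z + x * x * y * (z * z) + x * (y * y) * (z * z) + n * (x * x) * (y * y) * (z * z)))
        expand = solve-∀ ring
        drop : ∀ a r → a + 0ℤ * r ≡ a
        drop = solve-∀ ring
        neg : ∀ z n p → - 1ℤ * z + - n * p ≡ - (z + n * p)
        neg = solve-∀ ring

    private
      F : ℕ → ℕ → ℕ → ℤ
      F i j k = δ (i ℕ.+ j ℕ.+ k) (n ℕ.+ n) * fff i j k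

      fold : ∀ g → Σ (n ℕ.+ n) g ≡ Σ n (λ i → g i + g (n ℕ.+ i))
      fold g = trans (Σ-split n n g) (sym (Σ-+ n g (λ i → g (n ℕ.+ i))))

      -- Each adds the translate by n in one more coordinate, so that `F₃ i j k` collects all eight
      -- lifts of a residue triple to indices below 2 n.
      F₁ F₂ F₃ : ℕ → ℕ → ℕ → ℤ
      F₁ i j k = F i j k + F i j (n ℕ.+ k)
      F₂ i j k = F₁ i j k + F₁ i (n ℕ.+ j) k
      F₃ i j k = F₂ i j k + F₂ (n ℕ.+ i) j k

      T-fold : T ≡ Σ n (λ i → Σ n λ j → Σ n (F₃ i j))
      T-fold = trans (fold (λ i → Σ (n ℕ.+ n) (λ j → Σ (n ℕ.+ n) (F i j))))
        (Σ-cong n λ i _ → trans (cong₂ _+_ (two i) (two (n ℕ.+ i)))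
          (trans (sym (Σ-+ n (λ j → Σ n (F₂ i j)) (λ j → Σ n (F₂ (n ℕ.+ i) j))))
            (Σ-cong n λ j _ → sym (Σ-+ n (F₂ i j) (F₂ (n ℕ.+ i) j)))))
        where
        two : ∀ i → Σ (n ℕ.+ n) (λ j → Σ (n ℕ.+ n) (F i j)) ≡ Σ n (λ j → Σ n (F₂ i j))
        two i = trans (fold (λ j → Σ (n ℕ.+ n) (F i j)))
          (Σ-cong n λ j _ → trans (cong₂ _+_ (fold (F i j)) (fold (F i (n ℕ.+ j))))
            (sym (Σ-+ n (F₁ i j) (F₁ i (n ℕ.+ j)))))

      +-zero : ∀ a k → n ℕ.+ n ℕ.+ (a ℕ.+ k) ≡ n ℕ.+ n → k ≡ 0
      +-zero a k h = ℕₚ.m+n≡0⇒n≡0 a (ℕₚ.+-cancelˡ-≡ (n ℕ.+ n) _ _ (trans h (sym (ℕₚ.+-identityʳ _))))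

      d₂ d₁ : ℕ → ℕ → ℕ → ℤ
      d₂ i j k = δ (i ℕ.+ j ℕ.+ k) (n ℕ.+ n)
      d₁ i j k = δ (i ℕ.+ j ℕ.+ k) n

      shift-δ : ∀ {s i j k} → s ≡ n ℕ.+ (i ℕ.+ j ℕ.+ k) → δ s (n ℕ.+ n) ≡ d₁ i j k
      shift-δ {i = i} {j} {k} refl = δ-+ n (i ℕ.+ j ℕ.+ k) n

      vanish : ∀ i j k a c → i ℕ.+ j ℕ.+ k ≡ n ℕ.+ n ℕ.+ (a ℕ.+ c) → (c ≡ 0 → fff i j k ≡ 0ℤ) → F i j k ≡ 0ℤ
      vanish i j k a c eq h = trans (δ-*-cong (i ℕ.+ j ℕ.+ k) (n ℕ.+ n) {y = 0ℤ} λ e → h (+-zero a c (trans (sym eq) e)))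
        (*-zeroʳ (d₂ i j k))

      fff-0₃ : ∀ i j {k} → f k ≡ 0ℤ → fff i j k ≡ 0ℤ
      fff-0₃ i j h = trans (cong (f i * f j *_) h) (*-zeroʳ (f i * f j))

      fff-0₂ : ∀ i {j} k → f j ≡ 0ℤ → fff i j k ≡ 0ℤ
      fff-0₂ i k h = trans (cong (λ x → f i * x * f k) h) (trans (cong (_* f k) (*-zeroʳ (f i))) (*-zeroˡ (f k)))

      fff-0₁ : ∀ {i} j k → f i ≡ 0ℤ → fff i j k ≡ 0ℤ
      fff-0₁ j k h = trans (cong (λ x → x * f j * f k) h) (trans (cong (_* f k) (*-zeroˡ (f j))) (*-zeroˡ (f k)))

      f-at-0 : ∀ {k} → k ≡ 0 → f k ≡ 0ℤ
      f-at-0 refl = f-0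

      sh : ℕ → ℤ
      sh i = f i - + n * (f i * f i)

      -- The unshifted lift requires i + j + k = 2 n, and a lift shifted in one coordinate requires
      -- i + j + k = n. With two or three shifts, a total of 2 n forces an entry to be 0, where `f`
      -- vanishes.
      term : ∀ i j k → F₃ i j k ≈ d₂ i j k * fff i j k + d₁ i j k * (+ 3 * fff i j k + - + n * pert i j k)
      term i j k = begin
        F₃ i j k
          ≈⟨ +-cong (+-cong (+-cong (≈-refl {F i j k}) ₃) (+-cong ₂ (zero′ ₂₃)))
                    (+-cong (+-cong ₁ (zero′ ₁₃)) (+-cong (zero′ ₁₂) (zero′ ₁₂₃))) ⟩
        d₂ i j k * fff i j k + d₁ i j k * (f i * f j * sh k) + (d₁ i j k * (f i * sh j * f k) + 0ℤ)
          + (d₁ i j k * (sh i * f j * f k) + 0ℤ + (0ℤ + 0ℤ))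
          ≡⟨ lem (d₂ i j k * fff i j k) (d₁ i j k) (f i) (f j) (f k) (+ n) ⟩
        d₂ i j k * fff i j k + d₁ i j k * (+ 3 * fff i j k + - + n * pert i j k) ∎
        where
        open ≈-Reasoning
        opaque
          unfolding _+_
          lem : ∀ a d x y z n →
            a + d * (x * y * (z - n * (z * z))) + (d * (x * (y - n * (y * y)) * z) + 0ℤ)
              + (d * ((x - n * (x * x)) * y * z) + 0ℤ + (0ℤ + 0ℤ)) ≡
            a + d * (+ 3 * (x * y * z) + - n * (x * x * y * z + x * (y * y) * z + x * y * (z * z)))
          lem = solve-∀ ring
        zero′ : ∀ {x} → x ≡ 0ℤ → x ≈ 0ℤ
        zero′ = ≈-reflexive
        e₁ : ∀ n i j k → n ℕ.+ i ℕ.+ j ℕ.+ k ≡ n ℕ.+ (i ℕ.+ j ℕ.+ k)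
        e₁ = ℕ-Solver.solve-∀
        e₂ : ∀ n i j k → i ℕ.+ (n ℕ.+ j) ℕ.+ k ≡ n ℕ.+ (i ℕ.+ j ℕ.+ k)
        e₂ = ℕ-Solver.solve-∀
        e₃ : ∀ n i j k → i ℕ.+ j ℕ.+ (n ℕ.+ k) ≡ n ℕ.+ (i ℕ.+ j ℕ.+ k)
        e₃ = ℕ-Solver.solve-∀
        e₂₃ : ∀ n i j k → i ℕ.+ (n ℕ.+ j) ℕ.+ (n ℕ.+ k) ≡ n ℕ.+ n ℕ.+ (j ℕ.+ k ℕ.+ i)
        e₂₃ = ℕ-Solver.solve-∀
        e₁₃ : ∀ n i j k → n ℕ.+ i ℕ.+ j ℕ.+ (n ℕ.+ k) ≡ n ℕ.+ n ℕ.+ (i ℕ.+ k ℕ.+ j)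
        e₁₃ = ℕ-Solver.solve-∀
        e₁₂ : ∀ n i j k → n ℕ.+ i ℕ.+ (n ℕ.+ j) ℕ.+ k ≡ n ℕ.+ n ℕ.+ (i ℕ.+ j ℕ.+ k)
        e₁₂ = ℕ-Solver.solve-∀
        e₁₂₃ : ∀ n i j k → n ℕ.+ i ℕ.+ (n ℕ.+ j) ℕ.+ (n ℕ.+ k) ≡ n ℕ.+ n ℕ.+ (i ℕ.+ j ℕ.+ (n ℕ.+ k))
        e₁₂₃ = ℕ-Solver.solve-∀
        ₁ : F (n ℕ.+ i) j k ≈ d₁ i j k * (sh i * f j * f k)
        ₁ = *-cong (≈-reflexive (shift-δ {i = i} {j} {k} (e₁ n i j k)))
                   (*-congʳ (f k) (*-congʳ (f j) (f-shift i)))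
        ₂ : F i (n ℕ.+ j) k ≈ d₁ i j k * (f i * sh j * f k)
        ₂ = *-cong (≈-reflexive (shift-δ {i = i} {j} {k} (e₂ n i j k)))
                   (*-congʳ (f k) (*-congˡ (f i) (f-shift j)))
        ₃ : F i j (n ℕ.+ k) ≈ d₁ i j k * (f i * f j * sh k)
        ₃ = *-cong (≈-reflexive (shift-δ {i = i} {j} {k} (e₃ n i j k)))
                   (*-congˡ (f i * f j) (f-shift k))
        ₂₃ : F i (n ℕ.+ j) (n ℕ.+ k) ≡ 0ℤ
        ₂₃ = vanish i (n ℕ.+ j) (n ℕ.+ k) (j ℕ.+ k) i (e₂₃ n i j k) (λ h → fff-0₁ (n ℕ.+ j) (n ℕ.+ k) (f-at-0 h))
        ₁₃ : F (n ℕ.+ i) j (n ℕ.+ k) ≡ 0ℤ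
        ₁₃ = vanish (n ℕ.+ i) j (n ℕ.+ k) (i ℕ.+ k) j (e₁₃ n i j k) (λ h → fff-0₂ (n ℕ.+ i) (n ℕ.+ k) (f-at-0 h))
        ₁₂ : F (n ℕ.+ i) (n ℕ.+ j) k ≡ 0ℤ
        ₁₂ = vanish (n ℕ.+ i) (n ℕ.+ j) k (i ℕ.+ j) k (e₁₂ n i j k) (λ h → fff-0₃ (n ℕ.+ i) (n ℕ.+ j) (f-at-0 h))
        ₁₂₃ : F (n ℕ.+ i) (n ℕ.+ j) (n ℕ.+ k) ≡ 0ℤ
        ₁₂₃ = vanish (n ℕ.+ i) (n ℕ.+ j) (n ℕ.+ k) (i ℕ.+ j) (n ℕ.+ k) (e₁₂₃ n i j k)
                (λ h → fff-0₃ (n ℕ.+ i) (n ℕ.+ j) (f-at-0 h))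

    -- Residue triples with sum n lift in three ways and contribute 3 Z; those with sum 2 n lift in
    -- one way and contribute - Z by reflection.
    T≈2Z : T ≈ + 2 * Zₙ
    T≈2Z = begin
      T
        ≡⟨ T-fold ⟩
      Σ n (λ i → Σ n λ j → Σ n (F₃ i j))
        ≈⟨ (Σ-cong≈ M n λ i _ → Σ-cong≈ M n λ j _ → Σ-cong≈ M n λ k _ → term i j k) ⟩
      Σ n (λ i → Σ n λ j → Σ n λ k → d₂ i j k * fff i j k + d₁ i j k * (+ 3 * fff i j k + - + n * pert i j k))
        ≡⟨ Σ³-+ n (λ i j k → d₂ i j k * fff i j k) (λ i j k → d₁ i j k * (+ 3 * fff i j k + - + n * pert i j k)) ⟩
      tri n (n ℕ.+ n) fff + tri n n (λ i j k → + 3 * fff i j k + - + n * pert i j k)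
        ≡⟨ cong (_+_ (tri n (n ℕ.+ n) fff)) (trans
             (tri-+ n n (λ i j k → + 3 * fff i j k) (λ i j k → - + n * pert i j k))
             (cong₂ _+_ (tri-*ˡ n n (+ 3) fff) (tri-*ˡ n n (- + n) pert))) ⟩
      tri n (n ℕ.+ n) fff + (+ 3 * Zₙ + - + n * tri n n pert)
        ≡⟨ move (tri n (n ℕ.+ n) fff) Zₙ (+ n) (tri n n pert) ⟩
      tri n (n ℕ.+ n) fff + (+ 3 * Zₙ + - (+ n * tri n n pert))
        ≈⟨ +-cong tri-reflected (+-congˡ (+ 3 * Zₙ) (-‿cong pert≈0)) ⟩
      - Zₙ + (+ 3 * Zₙ + - 0ℤ)
        ≡⟨ final Zₙ ⟩
      + 2 * Zₙ ∎
      where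
      open ≈-Reasoning
      opaque
        unfolding _+_
        move : ∀ t z n p → t + (+ 3 * z + - n * p) ≡ t + (+ 3 * z + - (n * p))
        move = solve-∀ ring
        final : ∀ z → - z + (+ 3 * z + - 0ℤ) ≡ + 2 * z
        final = solve-∀ ring

    module _ (f-double : ∀ i → + 2 * f (i ℕ.* 2) ≈ f i) where

      private
        N : ℕ
        N = n ℕ.+ n

        E : ℤ
        E = tri N N (λ i j k → ε i * (ε j * (ε k * fff i j k)))

      V : ℤ
      V = tri N N (λ i j k → ε i * fff i j k)

      8E≈Z : + 8 * E ≈ Zₙ
      8E≈Z = begin
        + 8 * E
          ≡⟨ cong (+ 8 *_) (cong (λ S → tri S S (λ i j k → ε i * (ε j * (ε k * fff i j k)))) (double n)) ⟩
        + 8 * tri (n ℕ.* 2) (n ℕ.* 2) (λ i j k → ε i * (ε j * (ε k * fff i j k)))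
          ≡⟨ cong (+ 8 *_) (tri-dilate ε-indicates (s≤s z≤n) n fff) ⟩
        + 8 * tri n n (λ i j k → fff (i ℕ.* 2) (j ℕ.* 2) (k ℕ.* 2))
          ≡⟨ sym (tri-*ˡ n n (+ 8) _) ⟩
        tri n n (λ i j k → + 8 * fff (i ℕ.* 2) (j ℕ.* 2) (k ℕ.* 2))
          ≈⟨ tri-cong≈ M n n (λ i j k _ _ _ _ →
               ≈-trans (≈-reflexive (eight (f (i ℕ.* 2)) (f (j ℕ.* 2)) (f (k ℕ.* 2))))
                       (*-cong (*-cong (f-double i) (f-double j)) (f-double k))) ⟩
        Zₙ ∎
        where
        open ≈-Reasoning
        double : ∀ n → n ℕ.+ n ≡ n ℕ.* 2
        double = ℕ-Solver.solve-∀
        opaque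
          unfolding _+_
          eight : ∀ x y z → + 8 * (x * y * z) ≡ (+ 2 * x) * (+ 2 * y) * (+ 2 * z)
          eight = solve-∀ ring

      -- The parity identity applies because the total 2 n is even, and its three linear terms all
      -- sum to V by symmetry.
      2E≡3V-T : + 2 * E ≡ + 3 * V - T
      2E≡3V-T = begin
        + 2 * E
          ≡⟨ sym (tri-*ˡ N N (+ 2) _) ⟩
        tri N N (λ i j k → + 2 * (ε i * (ε j * (ε k * fff i j k))))
          ≡⟨ tri-cong N N (λ i j k h → trans (assoc (ε i) (ε j) (ε k) (fff i j k))
               (trans (cong (_* fff i j k) (ε-even-sum i j k (trans (cong ε h) (ε-double n))))
                      (distrib (ε i) (ε j) (ε k) (f i) (f j) (f k)))) ⟩
        tri N N (λ i j k → prod εf f f i j k + prod f εf f i j k + prod f f εf i j k + - 1ℤ * fff i j k)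
          ≡⟨ tri-+ N N (λ i j k → prod εf f f i j k + prod f εf f i j k + prod f f εf i j k) (λ i j k → - 1ℤ * fff i j k) ⟩
        tri N N (λ i j k → prod εf f f i j k + prod f εf f i j k + prod f f εf i j k) + tri N N (λ i j k → - 1ℤ * fff i j k)
          ≡⟨ cong₂ _+_ (trans (tri-+ N N (λ i j k → prod εf f f i j k + prod f εf f i j k) (prod f f εf))
               (cong₂ _+_ (trans (tri-+ N N (prod εf f f) (prod f εf f)) (cong (_+_ V′) (tri-prod₂ εf f N N)))
                          (tri-prod₃ εf f N N)))
               (tri-*ˡ N N (- 1ℤ) fff) ⟩
        V′ + V′ + V′ + - 1ℤ * T
          ≡⟨ final V′ T ⟩
        + 3 * V′ - T
          ≡⟨ cong (λ v → + 3 * v - T) (tri-cong N N λ i j k _ → assoc′ (ε i) (f i) (f j) (f k)) ⟩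
        + 3 * V - T ∎
        where
        open ≡-Reasoning
        εf : ℕ → ℤ
        εf i = ε i * f i
        V′ : ℤ
        V′ = tri N N (prod εf f f)
        opaque
          unfolding _+_
          assoc : ∀ a b c x → + 2 * (a * (b * (c * x))) ≡ + 2 * (a * (b * c)) * x
          assoc = solve-∀ ring
          distrib : ∀ a b c x y z → (a + b + c - 1ℤ) * (x * y * z) ≡
            a * x * y * z + x * (b * y) * z + x * y * (c * z) + - 1ℤ * (x * y * z)
          distrib = solve-∀ ring
          final : ∀ v t → v + v + v + - 1ℤ * t ≡ + 3 * v - t
          final = solve-∀ ring
          assoc′ : ∀ a x y z → a * x * y * z ≡ a * (x * y * z)
          assoc′ = solve-∀ ring

      -- By 2 E = 3 V - T one has 12 V = 8 E + 4 T, which is Z + 8 Z.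
      12V≈9Z : + 12 * V ≈ + 9 * Zₙ
      12V≈9Z = begin
        + 12 * V                          ≡⟨ lem₁ V T ⟩
        + 4 * (+ 3 * V - T) + + 4 * T     ≡⟨ cong (λ x → + 4 * x + + 4 * T) (sym 2E≡3V-T) ⟩
        + 4 * (+ 2 * E) + + 4 * T         ≡⟨ cong (_+ + 4 * T) (lem₂ E) ⟩
        + 8 * E + + 4 * T                 ≈⟨ +-cong 8E≈Z (*-congˡ (+ 4) T≈2Z) ⟩
        Zₙ + + 4 * (+ 2 * Zₙ)               ≡⟨ lem₃ Zₙ ⟩
        + 9 * Zₙ                           ∎
        where
        open ≈-Reasoning
        opaque
          unfolding _+_
          lem₁ : ∀ v t → + 12 * v ≡ + 4 * (+ 3 * v - t) + + 4 * t
          lem₁ = solve-∀ ring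
          lem₂ : ∀ e → + 4 * (+ 2 * e) ≡ + 8 * e
          lem₂ = solve-∀ ring
          lem₃ : ∀ z → z + + 4 * (+ 2 * z) ≡ + 9 * z
          lem₃ = solve-∀ ring

      6A≈-3Z : + 6 * tri N N (λ i j k → sgn i * fff i j k) ≈ - (+ 3 * Zₙ)
      6A≈-3Z = begin
        + 6 * tri N N (λ i j k → sgn i * fff i j k)
          ≡⟨ cong (+ 6 *_) (trans
               (tri-cong N N λ i j k _ → expand (ε i) (fff i j k))
               (trans (tri-+ N N (λ i j k → + 2 * (ε i * fff i j k)) (λ i j k → - 1ℤ * fff i j k))
                 (cong₂ _+_ (tri-*ˡ N N (+ 2) (λ i j k → ε i * fff i j k)) (tri-*ˡ N N (- 1ℤ) fff)))) ⟩
        + 6 * (+ 2 * V + - 1ℤ * T)   ≡⟨ lem₁ V T ⟩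
        + 12 * V - + 6 * T           ≈⟨ +-cong 12V≈9Z (-‿cong (*-congˡ (+ 6) T≈2Z)) ⟩
        + 9 * Zₙ - + 6 * (+ 2 * Zₙ)    ≡⟨ lem₂ Zₙ ⟩
        - (+ 3 * Zₙ)                  ∎
        where
        open ≈-Reasoning
        opaque
          unfolding _+_
          expand : ∀ e x → (+ 2 * e - 1ℤ) * x ≡ + 2 * (e * x) + - 1ℤ * x
          expand = solve-∀ ring
          lem₁ : ∀ v t → + 6 * (+ 2 * v + - 1ℤ * t) ≡ + 12 * v - + 6 * t
          lem₁ = solve-∀ ring
          lem₂ : ∀ z → + 9 * z - + 6 * (+ 2 * z) ≡ - (+ 3 * z)
          lem₂ = solve-∀ ring

  -- Residues

  opaque
    unfolding _+_

    ≈⇒% : ∀ {P a b} .{{_ : NonZero P}} → + a ≈ + b [mod + P ] → a % P ≡ b % P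
    ≈⇒% {P} {a} {b} (Mod.modulo (+ k) eq) = trans (cong (_% P) a≡) ([m+kn]%n≡m%n b k P)
      where
      a≡ : a ≡ b ℕ.+ k ℕ.* P
      a≡ = ℤₚ.+-injective (trans eq (cong (_+_ (+ b)) (sym (ℤₚ.pos-* k P))))
    ≈⇒% {P} {a} {b} (Mod.modulo (-[1+ k ]) eq) = sym (trans (cong (_% P) b≡) ([m+kn]%n≡m%n a (suc k) P))
      where
      lem : ∀ b k p → b ≡ b + - k * p + k * p
      lem = solve-∀ ring
      b≡ : b ≡ a ℕ.+ suc k ℕ.* P
      b≡ = ℤₚ.+-injective (trans (lem (+ b) (+ suc k) (+ P))
        (cong₂ _+_ (sym eq) (sym (ℤₚ.pos-* (suc k) P))))

  ∣⇒≈0 : ∀ {P a} → P ∣ a → + a ≈ 0ℤ [mod + P ]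
  ∣⇒≈0 {P} (divides k refl) = Mod.modulo (+ k) (trans (pos-* k P) (sym (+-identityˡ _)))

  ≈0⇒∣ : ∀ {P a} .{{_ : NonZero P}} → + a ≈ 0ℤ [mod + P ] → P ∣ a
  ≈0⇒∣ {P} {a} h = m%n≡0⇒n∣m a P (trans (≈⇒% h) (m*n%n≡0 0 P))

  %≈ : ∀ a P .{{_ : NonZero P}} → + (a % P) ≈ + a [mod + P ]
  %≈ a P = Mod.≈-sym (+ P) (Mod.modulo (+ (a / P))
    (trans (cong +_ (m≡m%n+[m/n]*n a P)) (trans (pos-+ (a % P) _) (cong (_+_ (+ (a % P))) (pos-* (a / P) P)))))

  weaken : ∀ {p} Q {x y} → x ≈ y [mod + (p ℕ.* Q) ] → x ≈ y [mod + p ]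
  weaken {p} Q {y = y} (Mod.modulo k eq) = Mod.modulo (k * + Q) (trans eq (cong (_+_ y) (trans
    (cong (k *_) (trans (pos-* p Q) (*-comm (+ p) (+ Q)))) (sym (*-assoc k (+ Q) (+ p))))))

  scale : ∀ {p} Q {x y} → x ≈ y [mod + p ] → + Q * x ≈ + Q * y [mod + (p ℕ.* Q) ]
  scale {p} Q {x} {y} (Mod.modulo k refl) = Mod.modulo k (trans (lem (+ Q) y k (+ p)) (cong (λ z → + Q * y + k * z) (sym (pos-* p Q))))
    where
    opaque
      unfolding _+_
      lem : ∀ q y k p → q * (y + k * p) ≡ q * y + k * (p * q)
      lem = solve-∀ ring

  -- Cancels a factor together with its share of the modulus. It serves where the factor is no unit:
  -- `P` in Voronoi's congruence, and 3 in the alternating sum for p = 3.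
  unscale : ∀ {p} Q .{{_ : NonZero Q}} {x y} → + Q * x ≈ + Q * y [mod + (p ℕ.* Q) ] → x ≈ y [mod + p ]
  unscale {p} Q {x} {y} (Mod.modulo k eq) = Mod.modulo k (cancel (trans eq (trans (cong (λ z → + Q * y + k * z) (pos-* p Q)) (sym (lem (+ Q) y k (+ p))))))
    where
    opaque
      unfolding _+_
      lem : ∀ q y k p → q * (y + k * p) ≡ q * y + k * (p * q)
      lem = solve-∀ ring
      cancel : ∀ {a b} → + Q * a ≡ + Q * b → a ≡ b
      cancel {a} {b} = ℤₚ.*-cancelˡ-≡ (+ Q) a b

  coprime⇒inverse : ∀ i P .{{_ : NonZero P}} → Coprime i P → ∃ λ v → v ℕ.< P × + v * + i ≈ 1ℤ [mod + P ]
  coprime⇒inverse i P@(suc P′) i⊥P with coprime-Bézout i⊥P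
  ... | Bézout.+- x y eq = x % P , m%n<n x P , Mod.≈-trans (+ P) (Mod.*-congʳ (+ P) (+ i) (%≈ x P))
          (Mod.modulo (+ y) (trans (sym (pos-* x i)) (trans (cong +_ (sym eq)) (trans (pos-+ 1 (y ℕ.* P)) (cong (_+_ 1ℤ) (pos-* y P))))))
  -- Here 1 + x i = y P, so the inverse is - x; it is represented by the natural number x (P - 1)
  -- reduced modulo P.
  ... | Bézout.-+ x y eq = x ℕ.* P′ % P , m%n<n (x ℕ.* P′) P , Mod.≈-trans (+ P) (Mod.*-congʳ (+ P) (+ i) (%≈ (x ℕ.* P′) P))
          (Mod.modulo (+ x * + i - + y) (trans (cong (_* + i) (pos-* x P′)) (trans
            (lem (+ x) (+ i) (+ y) (+ P′) (+ P) (trans (sym (trans (pos-+ 1 _) (cong (_+_ 1ℤ) (pos-* x i)))) (trans (cong +_ eq) (pos-* y P))) (pos-+ 1 P′)) refl)))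
    where
    opaque
      unfolding _+_
      lem₁ : ∀ x i y p′ → x * p′ * i ≡ 1ℤ + (x * i - y) * (1ℤ + p′) + (y * (1ℤ + p′) - (1ℤ + x * i))
      lem₁ = solve-∀ ring
      lem₂ : ∀ a b → a + (b - b) ≡ a
      lem₂ = solve-∀ ring
    lem : ∀ x i y p′ p → 1ℤ + x * i ≡ y * p → p ≡ 1ℤ + p′ → x * p′ * i ≡ 1ℤ + (x * i - y) * p
    lem x i y p′ _ e refl = trans (lem₁ x i y p′) (trans (cong (λ z → 1ℤ + (x * i - y) * (1ℤ + p′) + (z - (1ℤ + x * i))) (sym e)) (lem₂ _ (1ℤ + x * i)))

  inverse-unique : ∀ M {a b x} → a * x ≈ 1ℤ [mod M ] → b * x ≈ 1ℤ [mod M ] → a ≈ b [mod M ]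
  inverse-unique M {a} {b} {x} ax bx = begin
    a             ≡⟨ sym (trans (*-comm a 1ℤ) (*-identityˡ a)) ⟩
    a * 1ℤ        ≈⟨ *-congˡ a (≈-sym bx) ⟩
    a * (b * x)   ≡⟨ lem a b x ⟩
    a * x * b     ≈⟨ *-congʳ b ax ⟩
    1ℤ * b        ≡⟨ *-identityˡ b ⟩
    b             ∎
    where
    open Mod M
    open ≈-Reasoning
    opaque
      unfolding _+_
      lem : ∀ a b x → a * (b * x) ≡ a * x * b
      lem = solve-∀ ring

  prime∤⇒coprime : ∀ {p i} → Prime p → ¬ (p ∣ i) → Coprime i p
  prime∤⇒coprime pr p∤i (d∣i , d∣p) with prime⇒irreducible pr d∣p
  ... | inj₁ d≡1  = d≡1
  ... | inj₂ refl = ⊥-elim (p∤i d∣i)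

  coprime-* : ∀ {i m n} → Coprime i m → Coprime i n → Coprime i (m ℕ.* n)
  coprime-* {i} {m} {n} i⊥m i⊥n {d} (d∣i , d∣mn) = i⊥n (d∣i , Coprime.coprime-divisor d⊥m d∣mn)
    where
    d⊥m : Coprime d m
    d⊥m (e∣d , e∣m) = i⊥m (∣-trans e∣d d∣i , e∣m)

  coprime-^ : ∀ {i m} → Coprime i m → ∀ n → Coprime i (m ℕ.^ n)
  coprime-^ i⊥m zero    = Coprime.sym (Coprime.1-coprimeTo _)
  coprime-^ i⊥m (suc n) = coprime-* i⊥m (coprime-^ i⊥m n)

  -- Convolutions of periodic functions

  Σ-multiply : ∀ P .{{_ : NonZero P}} m m′ l → m ℕ.* m′ ≡ 1 ℕ.+ l ℕ.* P →
               ∀ (g : ℕ → ℤ) → Σ P (λ r → g (r ℕ.* m % P)) ≡ Σ P g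
  Σ-multiply P m m′ l m-inverse = Σ-permute P (λ r → r ℕ.* m % P) (λ r → r ℕ.* m′ % P)
    (λ i _ → m%n<n _ P) (λ i _ → m%n<n _ P)
    (λ i i< → cancel m m′ i i< m-inverse)
    (λ i i< → cancel m′ m i i< (trans (ℕₚ.*-comm m′ m) m-inverse))
    where
    expand : ∀ i l P → i ℕ.* (1 ℕ.+ l ℕ.* P) ≡ i ℕ.+ i ℕ.* l ℕ.* P
    expand = ℕ-Solver.solve-∀
    cancel : ∀ a b i → i ℕ.< P → a ℕ.* b ≡ 1 ℕ.+ l ℕ.* P → (i ℕ.* a % P) ℕ.* b % P ≡ i
    cancel a b i i< eq = begin
      (i ℕ.* a % P) ℕ.* b % P
        ≡⟨ %-distribˡ-* (i ℕ.* a % P) b P ⟩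
      ((i ℕ.* a % P % P) ℕ.* (b % P)) % P
        ≡⟨ cong (λ z → (z ℕ.* (b % P)) % P) (m%n%n≡m%n (i ℕ.* a) P) ⟩
      ((i ℕ.* a % P) ℕ.* (b % P)) % P
        ≡⟨ sym (%-distribˡ-* (i ℕ.* a) b P) ⟩
      i ℕ.* a ℕ.* b % P
        ≡⟨ cong (_% P) (trans (ℕₚ.*-assoc i a b) (trans (cong (i ℕ.*_) eq) (expand i l P))) ⟩
      (i ℕ.+ i ℕ.* l ℕ.* P) % P
        ≡⟨ [m+kn]%n≡m%n i (i ℕ.* l) P ⟩
      i % P
        ≡⟨ m<n⇒m%n≡m i< ⟩
      i ∎
      where open ≡-Reasoning

  module Convolution (u : ℕ → ℤ) where

    -- The linear convolution of `u` with itself; the missing term j = x would contain the factor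
    -- `u 0`, which is zero in the applications.
    G : ℕ → ℤ
    G x = Σ x λ j → u j * u (x ℕ.∸ j)

    h : ℕ → ℤ
    h x = u x * G x

    -- For fixed i the sum over j and k is `G (N ∸ i)`. Reflecting i lets the argument of `G` run
    -- upwards from 0, where its behaviour under shifts by a period can be used.
    tri-convolution : ∀ N (w : ℕ → ℤ) → u 0 ≡ 0ℤ → u N ≡ 0ℤ →
      tri N N (λ i j k → w i * prod u u u i j k) ≡ Σ N (λ i → w (N ℕ.∸ i) * (u (N ℕ.∸ i) * G i))
    tri-convolution N w u0 uN = begin
      tri N N (λ i j k → w i * prod u u u i j k)
        ≡⟨ (Σ-cong N λ i i< → inner i i<) ⟩
      Σ N (λ i → w i * (u i * G (N ℕ.∸ i)))
        ≡⟨ (Σ-cong N λ i i< → cong (λ z → w z * (u z * G (N ℕ.∸ i))) (sym (ℕₚ.m∸[m∸n]≡n (ℕₚ.<⇒≤ i<)))) ⟩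
      Σ N (λ i → w (N ℕ.∸ (N ℕ.∸ i)) * (u (N ℕ.∸ (N ℕ.∸ i)) * G (N ℕ.∸ i)))
        ≡⟨ Σ-reflect N (λ i → w (N ℕ.∸ i) * (u (N ℕ.∸ i) * G i)) boundary ⟩
      Σ N (λ i → w (N ℕ.∸ i) * (u (N ℕ.∸ i) * G i)) ∎
      where
      open ≡-Reasoning
      boundary : w N * (u N * G 0) ≡ w (N ℕ.∸ N) * (u (N ℕ.∸ N) * G N)
      boundary = trans (vanish (w N) uN)
        (sym (vanish (w (N ℕ.∸ N)) (trans (cong u (ℕₚ.n∸n≡0 N)) u0)))
        where
        vanish : ∀ x {y z} → y ≡ 0ℤ → x * (y * z) ≡ 0ℤ
        vanish x {z = z} refl = trans (cong (x *_) (*-zeroˡ z)) (*-zeroʳ x)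

      δ-sum : ∀ y → y ℕ.≤ N → Σ N (λ k → δ k y * u k) ≡ u y
      δ-sum y y≤N with ℕₚ.m≤n⇒m<n∨m≡n y≤N
      ... | inj₁ y<N  = Σ-δ N y u y<N
      ... | inj₂ refl = trans (Σ-δ-≢ N N u ℕₚ.≤-refl) (sym uN)

      row : ∀ x j → x ℕ.≤ N → j ℕ.< x → Σ N (λ k → δ (j ℕ.+ k) x * u k) ≡ u (x ℕ.∸ j)
      row x j x≤N j<x = trans
        (Σ-cong N λ k _ → cong (_* u k) (δ-cong (j ℕ.+ k) x k (x ℕ.∸ j)
          (λ e → sym (trans (cong (ℕ._∸ j) (sym e)) (ℕₚ.m+n∸m≡n j k)))
          (λ e → trans (cong (j ℕ.+_) e) (ℕₚ.m+[n∸m]≡n (ℕₚ.<⇒≤ j<x)))))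
        (δ-sum (x ℕ.∸ j) (ℕₚ.≤-trans (ℕₚ.m∸n≤m x j) x≤N))

      row-0 : ∀ x j → Σ N (λ k → δ (x ℕ.+ j ℕ.+ k) x * u k) ≡ 0ℤ
      row-0 x j = Σ-zero N λ k _ → trans
        (δ-*-cong (x ℕ.+ j ℕ.+ k) x {y = 0ℤ} λ e → trans (cong u (ℕₚ.m+n≡0⇒n≡0 j
          (ℕₚ.+-cancelˡ-≡ x _ _ (trans (sym (ℕₚ.+-assoc x j k)) (trans e (sym (ℕₚ.+-identityʳ x))))))) u0)
        (*-zeroʳ (δ (x ℕ.+ j ℕ.+ k) x))

      double : ∀ x → x ℕ.≤ N → Σ N (λ j → u j * Σ N (λ k → δ (j ℕ.+ k) x * u k)) ≡ G x
      double x x≤N = begin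
        Σ N (λ j → u j * Σ N (λ k → δ (j ℕ.+ k) x * u k))
          ≡⟨ cong (λ S → Σ S (λ j → u j * Σ N (λ k → δ (j ℕ.+ k) x * u k))) (sym (ℕₚ.m+[n∸m]≡n x≤N)) ⟩
        Σ (x ℕ.+ (N ℕ.∸ x)) (λ j → u j * Σ N (λ k → δ (j ℕ.+ k) x * u k))
          ≡⟨ Σ-split x (N ℕ.∸ x) _ ⟩
        Σ x (λ j → u j * Σ N (λ k → δ (j ℕ.+ k) x * u k)) +
        Σ (N ℕ.∸ x) (λ j → u (x ℕ.+ j) * Σ N (λ k → δ (x ℕ.+ j ℕ.+ k) x * u k))
          ≡⟨ cong₂ _+_ (Σ-cong x λ j j< → cong (u j *_) (row x j x≤N j<))
               (Σ-zero (N ℕ.∸ x) λ j _ → trans (cong (u (x ℕ.+ j) *_) (row-0 x j)) (*-zeroʳ (u (x ℕ.+ j)))) ⟩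
        G x + 0ℤ
          ≡⟨ +-identityʳ (G x) ⟩
        G x ∎

      inner : ∀ i → i ℕ.< N →
        Σ N (λ j → Σ N λ k → δ (i ℕ.+ j ℕ.+ k) N * (w i * prod u u u i j k)) ≡ w i * (u i * G (N ℕ.∸ i))
      inner i i< = begin
        Σ N (λ j → Σ N λ k → δ (i ℕ.+ j ℕ.+ k) N * (w i * prod u u u i j k))
          ≡⟨ (Σ-cong N λ j _ → Σ-cong N λ k _ → trans
               (cong (_* (w i * prod u u u i j k)) (trans (cong₂ δ (ℕₚ.+-assoc i j k) (sym (ℕₚ.m+[n∸m]≡n (ℕₚ.<⇒≤ i<)))) (δ-+ i (j ℕ.+ k) (N ℕ.∸ i))))
               (lem (δ (j ℕ.+ k) (N ℕ.∸ i)) (w i) (u i) (u j) (u k))) ⟩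
        Σ N (λ j → Σ N λ k → (w i * u i) * (u j * (δ (j ℕ.+ k) (N ℕ.∸ i) * u k)))
          ≡⟨ (Σ-cong N λ j _ → trans (Σ-*ˡ N (w i * u i) _) (cong (w i * u i *_) (Σ-*ˡ N (u j) _))) ⟩
        Σ N (λ j → (w i * u i) * (u j * Σ N λ k → δ (j ℕ.+ k) (N ℕ.∸ i) * u k))
          ≡⟨ Σ-*ˡ N (w i * u i) _ ⟩
        w i * u i * Σ N (λ j → u j * Σ N λ k → δ (j ℕ.+ k) (N ℕ.∸ i) * u k)
          ≡⟨ cong (w i * u i *_) (double (N ℕ.∸ i) (ℕₚ.m∸n≤m N i)) ⟩
        w i * u i * G (N ℕ.∸ i)
          ≡⟨ *-assoc (w i) (u i) _ ⟩
        w i * (u i * G (N ℕ.∸ i)) ∎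
        where
        opaque
          unfolding _+_
          lem : ∀ d w x y z → d * (w * (x * y * z)) ≡ (w * x) * (y * (d * z))
          lem = solve-∀ ring

    module Periodic (P : ℕ) (u-periodic : ∀ i → u (P ℕ.+ i) ≡ u i) where

      -- Lengthening the range of G by a full period adds the cyclic convolution c of u with itself.
      c : ℕ → ℤ
      c x = Σ P λ j → u j * u ((P ℕ.+ x) ℕ.∸ j)

      G-shift : ∀ x → G (P ℕ.+ x) ≡ G x + c x
      G-shift x = trans (Σ-split P x (λ j → u j * u ((P ℕ.+ x) ℕ.∸ j))) (trans (+-comm (c x) _)
        (cong (_+ c x) (Σ-cong x λ i _ → cong₂ _*_ (u-periodic i) (cong u (ℕₚ.[m+n]∸[m+o]≡n∸o P x i)))))

      c-shift : ∀ x → c (P ℕ.+ x) ≡ c x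
      c-shift x = Σ-cong P λ j j< → cong (u j *_)
        (trans (cong u (ℕₚ.+-∸-assoc P (ℕₚ.≤-trans (ℕₚ.<⇒≤ j<) (ℕₚ.m≤m+n P x)))) (u-periodic _))

      -- The increment of `h` over one period.
      k : ℕ → ℤ
      k x = u x * c x

      private
        reorder : ∀ s x → P ℕ.+ s ℕ.* P ℕ.+ x ≡ P ℕ.+ (s ℕ.* P ℕ.+ x)
        reorder s x = ℕₚ.+-assoc P (s ℕ.* P) x

      u-shift* : ∀ s x → u (s ℕ.* P ℕ.+ x) ≡ u x
      u-shift* zero    x = refl
      u-shift* (suc s) x = trans (cong u (reorder s x)) (trans (u-periodic _) (u-shift* s x))

      c-shift* : ∀ s x → c (s ℕ.* P ℕ.+ x) ≡ c x
      c-shift* zero    x = refl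
      c-shift* (suc s) x = trans (cong c (reorder s x)) (trans (c-shift _) (c-shift* s x))

      k-shift* : ∀ s x → k (s ℕ.* P ℕ.+ x) ≡ k x
      k-shift* s x = cong₂ _*_ (u-shift* s x) (c-shift* s x)

      -- The increment `c` is itself periodic, so `G`, and with it `h`, grows linearly along each
      -- residue class.
      h-shift* : ∀ s x → h (s ℕ.* P ℕ.+ x) ≡ h x + + s * k x
      h-shift* s x = trans (cong₂ _*_ (u-shift* s x) (G-shift* s)) (lem (u x) (G x) (+ s) (c x))
        where
        opaque
          unfolding _+_
          lem : ∀ u g s c → u * (g + s * c) ≡ u * g + s * (u * c)
          lem = solve-∀ ring
          next : ∀ g s c → g + s * c + c ≡ g + (1ℤ + s) * c
          next = solve-∀ ring
        G-shift* : ∀ s → G (s ℕ.* P ℕ.+ x) ≡ G x + + s * c x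
        G-shift* zero    = sym (trans (cong (_+_ (G x)) (*-zeroˡ (c x))) (+-identityʳ (G x)))
        G-shift* (suc s) = trans (cong G (reorder s x)) (trans (G-shift (s ℕ.* P ℕ.+ x))
          (trans (cong₂ _+_ (G-shift* s) (c-shift* s x))
            (trans (next (G x) (+ s) (c x)) (cong (λ z → G x + z * c x) (sym (pos-+ 1 s))))))

      module _
        (u-0   : u 0 ≡ 0ℤ)
        (u-neg : ∀ i j t → i ℕ.+ j ≡ t ℕ.* P → u i ≈ - u j [mod + P ])
        (u-mul : ∀ i j → u (i ℕ.* j) ≈ u i * u j [mod + P ])
        (κ ½ : ℤ) (½*2 : ½ * + 2 ≈ 1ℤ [mod + P ])
        (k-cube : ∀ x → k x ≈ κ * (u x * u x * u x) [mod + P ])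
        .{{_ : NonZero P}}
        where

        open Mod (+ P)

        private
          u³ : ℕ → ℤ
          u³ x = u x * u x * u x

          u-P : ∀ t → u (t ℕ.* P) ≡ 0ℤ
          u-P t = trans (cong u (sym (ℕₚ.+-identityʳ (t ℕ.* P)))) (trans (u-shift* t 0) u-0)

          W : ℤ
          W = tri P P (prod u u u)

        -- The cube of an odd function is odd, so the sum over a period equals its own negative, and
        -- 2 is invertible.
        Σu³≈0 : Σ P u³ ≈ 0ℤ
        Σu³≈0 = *-cancel ½ (+ 2) ½*2 (begin
          + 2 * Σ P u³
            ≡⟨ two (Σ P u³) ⟩
          Σ P u³ + Σ P u³
            ≡⟨ cong (_+ Σ P u³) (sym (Σ-reflect P u³ (cong (λ z → z * z * z) (trans u-0 (sym u-P₁))))) ⟩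
          Σ P (λ i → u³ (P ℕ.∸ i)) + Σ P u³
            ≈⟨ +-congʳ (Σ P u³) (Σ-cong≈ (+ P) P λ i i< →
                 let e = u-neg (P ℕ.∸ i) i 1 (trans (ℕₚ.m∸n+n≡m (ℕₚ.<⇒≤ i<)) (sym (ℕₚ.+-identityʳ P)))
                 in ≈-trans (*-cong (*-cong e e) e) (≈-reflexive (cube (u i)))) ⟩
          Σ P (λ i → - 1ℤ * u³ i) + Σ P u³
            ≡⟨ cong (_+ Σ P u³) (Σ-*ˡ P (- 1ℤ) u³) ⟩
          - 1ℤ * Σ P u³ + Σ P u³
            ≡⟨ neg (Σ P u³) ⟩
          + 2 * 0ℤ ∎)
          where
          open ≈-Reasoning
          u-P₁ : u P ≡ 0ℤ
          u-P₁ = trans (cong u (sym (ℕₚ.+-identityʳ P))) (u-P 1)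
          opaque
            unfolding _+_
            two : ∀ x → + 2 * x ≡ x + x
            two = solve-∀ ring
            cube : ∀ x → - x * - x * - x ≡ - 1ℤ * (x * x * x)
            cube = solve-∀ ring
            neg : ∀ x → - 1ℤ * x + x ≡ + 2 * 0ℤ
            neg = solve-∀ ring

        tri-weighted : ∀ t (w : ℕ → ℤ) → (∀ i → i ℕ.< t ℕ.* P → w (t ℕ.* P ℕ.∸ i) ≡ w i) →
          tri (t ℕ.* P) (t ℕ.* P) (λ i j k → w i * prod u u u i j k) ≈ - 1ℤ * Σ (t ℕ.* P) (λ i → w i * h i)
        tri-weighted t w w-refl = begin
          tri (t ℕ.* P) (t ℕ.* P) (λ i j k → w i * prod u u u i j k)
            ≡⟨ tri-convolution (t ℕ.* P) w u-0 (u-P t) ⟩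
          Σ (t ℕ.* P) (λ i → w (t ℕ.* P ℕ.∸ i) * (u (t ℕ.* P ℕ.∸ i) * G i))
            ≈⟨ (Σ-cong≈ (+ P) (t ℕ.* P) λ i i< → *-cong (≈-reflexive (w-refl i i<))
                 (*-congʳ (G i) (u-neg (t ℕ.* P ℕ.∸ i) i t (ℕₚ.m∸n+n≡m (ℕₚ.<⇒≤ i<))))) ⟩
          Σ (t ℕ.* P) (λ i → w i * (- u i * G i))
            ≡⟨ (Σ-cong (t ℕ.* P) λ i _ → lem (w i) (u i) (G i)) ⟩
          Σ (t ℕ.* P) (λ i → - 1ℤ * (w i * h i))
            ≡⟨ Σ-*ˡ (t ℕ.* P) (- 1ℤ) _ ⟩
          - 1ℤ * Σ (t ℕ.* P) (λ i → w i * h i) ∎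
          where
          open ≈-Reasoning
          opaque
            unfolding _+_
            lem : ∀ w u g → w * (- u * g) ≡ - 1ℤ * (w * (u * g))
            lem = solve-∀ ring

        W≈-Σh : W ≈ - 1ℤ * Σ P h
        W≈-Σh = begin
          W
            ≡⟨ cong (λ S → tri S S (prod u u u)) (sym (ℕₚ.+-identityʳ P)) ⟩
          tri (1 ℕ.* P) (1 ℕ.* P) (prod u u u)
            ≡⟨ tri-cong (1 ℕ.* P) (1 ℕ.* P) (λ i j k _ → sym (*-identityˡ _)) ⟩
          tri (1 ℕ.* P) (1 ℕ.* P) (λ i j k → 1ℤ * prod u u u i j k)
            ≈⟨ tri-weighted 1 (λ _ → 1ℤ) (λ _ _ → refl) ⟩
          - 1ℤ * Σ (1 ℕ.* P) (λ i → 1ℤ * h i)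
            ≡⟨ cong (- 1ℤ *_) (trans (Σ-cong (1 ℕ.* P) λ i _ → *-identityˡ (h i))
                 (cong (λ S → Σ S h) (ℕₚ.+-identityʳ P))) ⟩
          - 1ℤ * Σ P h ∎
          where open ≈-Reasoning

        -- The floor of r m / P counts the full periods below r m, hence the increments `k` that
        -- `h (r ℕ.* m)` has accumulated.
        Λ : ℕ → ℤ
        Λ m = Σ P λ r → + (r ℕ.* m / P) * u³ r

        module _ (m m′ l : ℕ) (m-inverse : m ℕ.* m′ ≡ 1 ℕ.+ l ℕ.* P) where

          k-mul : ∀ r → k (r ℕ.* m) ≈ κ * u³ m * u³ r
          k-mul r = ≈-trans (k-cube (r ℕ.* m))
            (≈-trans (*-congˡ κ (*-cong (*-cong (u-mul r m) (u-mul r m)) (u-mul r m)))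
                     (≈-reflexive (lem κ (u r) (u m))))
            where
            opaque
              unfolding _+_
              lem : ∀ k r m → k * (r * m * (r * m) * (r * m)) ≡ k * (m * m * m) * (r * r * r)
              lem = solve-∀ ring

          Σk≈0 : Σ P (λ r → k (r ℕ.* m)) ≈ 0ℤ
          Σk≈0 = begin
            Σ P (λ r → k (r ℕ.* m))          ≈⟨ Σ-cong≈ (+ P) P (λ r _ → k-mul r) ⟩
            Σ P (λ r → κ * u³ m * u³ r)      ≡⟨ Σ-*ˡ P (κ * u³ m) u³ ⟩
            κ * u³ m * Σ P u³                ≈⟨ *-congˡ (κ * u³ m) Σu³≈0 ⟩
            κ * u³ m * 0ℤ                    ≡⟨ *-zeroʳ _ ⟩
            0ℤ                               ∎
            where open ≈-Reasoning

          -- The remainders of r m modulo P run through all residues and contribute the sum of `h`,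
          -- which is - W; the quotients weight the increments and give `Λ m`.
          Σh≈ : Σ P (λ r → h (r ℕ.* m)) ≈ - 1ℤ * W + κ * u³ m * Λ m
          Σh≈ = begin
            Σ P (λ r → h (r ℕ.* m))
              ≡⟨ (Σ-cong P λ r _ → trans (cong h (quot-rem r))
                   (trans (h-shift* (r ℕ.* m / P) (r ℕ.* m % P))
                     (cong (λ z → h (r ℕ.* m % P) + + (r ℕ.* m / P) * z) (k-rem r)))) ⟩
            Σ P (λ r → h (r ℕ.* m % P) + + (r ℕ.* m / P) * k (r ℕ.* m))
              ≡⟨ Σ-+ P _ _ ⟩
            Σ P (λ r → h (r ℕ.* m % P)) + Σ P (λ r → + (r ℕ.* m / P) * k (r ℕ.* m))
              ≈⟨ +-cong (≈-trans (≈-reflexive (Σ-multiply P m m′ l m-inverse h)) (≈-trans (≈-reflexive (neg (Σ P h))) (*-congˡ (- 1ℤ) (≈-sym W≈-Σh))))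
                   (Σ-cong≈ (+ P) P λ r _ → ≈-trans (*-congˡ (+ (r ℕ.* m / P)) (k-mul r))
                      (≈-reflexive (lem (+ (r ℕ.* m / P)) (κ * u³ m) (u³ r)))) ⟩
            - 1ℤ * W + Σ P (λ r → κ * u³ m * (+ (r ℕ.* m / P) * u³ r))
              ≡⟨ cong (_+_ (- 1ℤ * W)) (Σ-*ˡ P (κ * u³ m) _) ⟩
            - 1ℤ * W + κ * u³ m * Λ m ∎
            where
            open ≈-Reasoning
            quot-rem : ∀ r → r ℕ.* m ≡ (r ℕ.* m / P) ℕ.* P ℕ.+ r ℕ.* m % P
            quot-rem r = trans (m≡m%n+[m/n]*n (r ℕ.* m) P) (ℕₚ.+-comm (r ℕ.* m % P) _)
            k-rem : ∀ r → k (r ℕ.* m % P) ≡ k (r ℕ.* m)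
            k-rem r = sym (trans (cong k (quot-rem r)) (k-shift* (r ℕ.* m / P) (r ℕ.* m % P)))
            opaque
              unfolding _+_
              neg : ∀ x → x ≡ - 1ℤ * (- 1ℤ * x)
              neg = solve-∀ ring
              lem : ∀ f a b → f * (a * b) ≡ a * (f * b)
              lem = solve-∀ ring

          -- Only i = (r + s P) m survive, where `h` exceeds its value at r m by s m times
          -- `k (r ℕ.* m)`. These excesses cancel in the sum over r, so all t blocks contribute
          -- equally.
          tri-multiples : ∀ {χ} → Indicates m χ → 0 ℕ.< m → ∀ t →
            tri (t ℕ.* P ℕ.* m) (t ℕ.* P ℕ.* m) (λ i j k → χ i * prod u u u i j k) ≈
            + t * (W - κ * u³ m * Λ m)
          tri-multiples {χ} ind m>0 t = begin
            tri N N (λ i j k → χ i * prod u u u i j k)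
              ≡⟨ cong (λ S → tri S S (λ i j k → χ i * prod u u u i j k)) (reassoc t P m) ⟩
            tri (t ℕ.* m ℕ.* P) (t ℕ.* m ℕ.* P) (λ i j k → χ i * prod u u u i j k)
              ≈⟨ tri-weighted (t ℕ.* m) χ (λ i i< → Indicates.symmetric ind _ i (t ℕ.* P)
                   (trans (ℕₚ.m∸n+n≡m (ℕₚ.<⇒≤ i<)) (sym (reassoc t P m)))) ⟩
            - 1ℤ * Σ (t ℕ.* m ℕ.* P) (λ i → χ i * h i)
              ≡⟨ cong (- 1ℤ *_) (trans (cong (λ S → Σ S (λ i → χ i * h i)) (sym (reassoc t P m)))
                   (trans (Σ-dilate ind m>0 (t ℕ.* P) h) (Σ-block P t (λ y → h (y ℕ.* m))))) ⟩
            - 1ℤ * Σ t (λ s → Σ P (λ r → h ((r ℕ.+ s ℕ.* P) ℕ.* m)))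
              ≡⟨ cong (- 1ℤ *_) (Σ-cong t λ s _ → trans
                   (Σ-cong P λ r _ → trans (cong h (distrib r s P m)) (h-shift* (s ℕ.* m) (r ℕ.* m)))
                   (trans (Σ-+ P _ _) (cong (_+_ (Σ P (λ r → h (r ℕ.* m)))) (Σ-*ˡ P (+ (s ℕ.* m)) _)))) ⟩
            - 1ℤ * Σ t (λ s → Σ P (λ r → h (r ℕ.* m)) + + (s ℕ.* m) * Σ P (λ r → k (r ℕ.* m)))
              ≈⟨ *-congˡ (- 1ℤ) (Σ-cong≈ (+ P) t λ s _ → +-cong Σh≈ (*-congˡ (+ (s ℕ.* m)) Σk≈0)) ⟩
            - 1ℤ * Σ t (λ s → - 1ℤ * W + κ * u³ m * Λ m + + (s ℕ.* m) * 0ℤ)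
              ≡⟨ cong (- 1ℤ *_) (trans (Σ-cong t λ s _ → drop (- 1ℤ * W + κ * u³ m * Λ m) (+ (s ℕ.* m)))
                   (Σ-const t _)) ⟩
            - 1ℤ * (+ t * (- 1ℤ * W + κ * u³ m * Λ m))
              ≡⟨ final (+ t) W (κ * u³ m * Λ m) ⟩
            + t * (W - κ * u³ m * Λ m) ∎
            where
            open ≈-Reasoning
            N : ℕ
            N = t ℕ.* P ℕ.* m
            reassoc : ∀ t P m → t ℕ.* P ℕ.* m ≡ t ℕ.* m ℕ.* P
            reassoc = ℕ-Solver.solve-∀
            distrib : ∀ r s P m → (r ℕ.+ s ℕ.* P) ℕ.* m ≡ (s ℕ.* m) ℕ.* P ℕ.+ r ℕ.* m
            distrib = ℕ-Solver.solve-∀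
            opaque
              unfolding _+_
              drop : ∀ a s → a + s * 0ℤ ≡ a
              drop = solve-∀ ring
              final : ∀ t w x → - 1ℤ * (t * (- 1ℤ * w + x)) ≡ t * (w - x)
              final = solve-∀ ring

        -- The case m = 1 of `tri-multiples`, where every floor is 0.
        tri-multiple-of-period : ∀ t → tri (t ℕ.* P) (t ℕ.* P) (prod u u u) ≈ + t * W
        tri-multiple-of-period t = begin
          tri (t ℕ.* P) (t ℕ.* P) (prod u u u)
            ≡⟨ cong (λ S → tri S S (prod u u u)) (sym (ℕₚ.*-identityʳ (t ℕ.* P))) ⟩
          tri (t ℕ.* P ℕ.* 1) (t ℕ.* P ℕ.* 1) (prod u u u)
            ≡⟨ tri-cong (t ℕ.* P ℕ.* 1) (t ℕ.* P ℕ.* 1) (λ i j k _ → sym (*-identityˡ _)) ⟩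
          tri (t ℕ.* P ℕ.* 1) (t ℕ.* P ℕ.* 1) (λ i j k → 1ℤ * prod u u u i j k)
            ≈⟨ tri-multiples 1 1 0 refl all (s≤s z≤n) t ⟩
          + t * (W - κ * u³ 1 * Λ 1)
            ≡⟨ cong (λ x → + t * (W - κ * u³ 1 * x)) (Σ-zero P λ r r< → trans
                 (cong (λ z → + z * u³ r) (m<n⇒m/n≡0 (subst (ℕ._< P) (sym (ℕₚ.*-identityʳ r)) r<)))
                 (*-zeroˡ (u³ r))) ⟩
          + t * (W - κ * u³ 1 * 0ℤ)
            ≡⟨ lem (+ t) W (κ * u³ 1) ⟩
          + t * W ∎
          where
          open ≈-Reasoning
          all : Indicates 1 (λ _ → 1ℤ)
          all = record { multiple = λ _ → refl ; nonmultiple = λ { r s (s≤s ()) } ; symmetric = λ _ _ _ _ → refl }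
          opaque
            unfolding _+_
            lem : ∀ t w x → t * (w - x * 0ℤ) ≡ t * w
            lem = solve-∀ ring

  -- Inverses modulo a prime power

  𝟙∣ : ℕ → ℕ → ℤ
  𝟙∣ m i = if does (m ∣? i) then 1ℤ else 0ℤ

  𝟙∣-yes : ∀ {m i} → m ∣ i → 𝟙∣ m i ≡ 1ℤ
  𝟙∣-yes {m} {i} d with m ∣? i
  ... | yes _ = refl
  ... | no ¬d = ⊥-elim (¬d d)

  𝟙∣-no : ∀ {m i} → ¬ (m ∣ i) → 𝟙∣ m i ≡ 0ℤ
  𝟙∣-no {m} {i} ¬d with m ∣? i
  ... | yes d = ⊥-elim (¬d d)
  ... | no _  = refl

  𝟙∣-cong : ∀ {m i j} → (m ∣ i → m ∣ j) → (m ∣ j → m ∣ i) → 𝟙∣ m i ≡ 𝟙∣ m j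
  𝟙∣-cong {m} {i} {j} f g with m ∣? i
  ... | yes d = sym (𝟙∣-yes (f d))
  ... | no ¬d = sym (𝟙∣-no (¬d ∘ g))

  ∣-≈ : ∀ {m i j} .{{_ : NonZero m}} → + i ≈ + j [mod + m ] → m ∣ i → m ∣ j
  ∣-≈ {m} h d = ≈0⇒∣ (Mod.≈-trans (+ m) (Mod.≈-sym (+ m) h) (∣⇒≈0 d))

  module InverseModPower (p : ℕ) (pr : Prime p) (a : ℕ) where

    private
      instance
        p≢0 : NonZero p
        p≢0 = prime⇒nonZero pr

    -- With α = a + 1 these are p^(α-1) and p^α.
    Q P : ℕ
    Q = p ℕ.^ a
    P = p ℕ.* Q

    instance
      Q≢0 : NonZero Q
      Q≢0 = ℕₚ.m^n≢0 p a
      P≢0 : NonZero P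
      P≢0 = ℕₚ.m*n≢0 p Q

    open Mod (+ P)

    private
      û₀ : ∀ i → Dec (p ∣ i) → ℕ
      û₀ i (yes _)  = 0
      û₀ i (no p∤i) = proj₁ (coprime⇒inverse i P (coprime-^ (prime∤⇒coprime pr p∤i) (suc a)))

      û₀< : ∀ i d → û₀ i d ℕ.< P
      û₀< i (yes _)  = ℕ.>-nonZero⁻¹ P
      û₀< i (no p∤i) = proj₁ (proj₂ (coprime⇒inverse i P (coprime-^ (prime∤⇒coprime pr p∤i) (suc a))))

      û₀-zero : ∀ i d → p ∣ i → û₀ i d ≡ 0
      û₀-zero i (yes _)  p∣i = refl
      û₀-zero i (no p∤i) p∣i = ⊥-elim (p∤i p∣i)

      û₀-inverse : ∀ i d → ¬ (p ∣ i) → + û₀ i d * + i ≈ 1ℤ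
      û₀-inverse i (yes p∣i) p∤i = ⊥-elim (p∤i p∣i)
      û₀-inverse i (no p∤i)  _   =
        proj₂ (proj₂ (coprime⇒inverse i P (coprime-^ (prime∤⇒coprime pr p∤i) (suc a))))

    opaque
      -- Evaluated at the residue of i, so that congruent arguments give equal and not merely
      -- congruent values. Natural values below P allow inversion to be iterated.
      û : ℕ → ℕ
      û i = û₀ (i % P) (p ∣? (i % P))

      û< : ∀ i → û i ℕ.< P
      û< i = û₀< (i % P) (p ∣? (i % P))

    u : ℕ → ℤ
    u i = + û i

    P⇒p : ∀ {x y} → x ≈ y → x ≈ y [mod + p ]
    P⇒p = weaken Q

    p∣-≈ : ∀ {i j} → + i ≈ + j → p ∣ i → p ∣ j
    p∣-≈ h = ∣-≈ (P⇒p h)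

    opaque
      unfolding û

      û-zero : ∀ {i} → p ∣ i → û i ≡ 0
      û-zero {i} p∣i = û₀-zero (i % P) (p ∣? (i % P)) (p∣-≈ (≈-sym (%≈ i P)) p∣i)

      u-inverse : ∀ {i} → ¬ (p ∣ i) → u i * + i ≈ 1ℤ
      u-inverse {i} p∤i = ≈-trans (*-congˡ (u i) (≈-sym (%≈ i P)))
        (û₀-inverse (i % P) (p ∣? (i % P)) (p∤i ∘ p∣-≈ (%≈ i P)))

      û-cong : ∀ {i j} → + i ≈ + j → û i ≡ û j
      û-cong h = cong (λ z → û₀ z (p ∣? z)) (≈⇒% h)

    u-zero : ∀ {i} → p ∣ i → u i ≡ 0ℤ
    u-zero p∣i = cong +_ (û-zero p∣i)

    u-0 : u 0 ≡ 0ℤ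
    u-0 = u-zero (p ∣0)

    u-unique : ∀ {i v} → ¬ (p ∣ i) → v * + i ≈ 1ℤ → u i ≈ v
    u-unique {i} p∤i h = inverse-unique (+ P) (u-inverse p∤i) h

    u-cong : ∀ {i j} → + i ≈ + j → u i ≡ u j
    u-cong h = cong +_ (û-cong h)

    P+ : ∀ i → + (P ℕ.+ i) ≈ + i
    P+ i = ≈-trans (≈-reflexive (pos-+ P i)) (≈-trans (+-congʳ (+ i) (∣⇒≈0 ∣-refl)) (≈-reflexive (+-identityˡ (+ i))))

    u-periodic : ∀ i → u (P ℕ.+ i) ≡ u i
    u-periodic i = u-cong (P+ i)

    u-neg : ∀ i j t → i ℕ.+ j ≡ t ℕ.* P → u i ≈ - u j
    u-neg i j t eq with p ∣? j
    ... | yes p∣j = ≈-reflexive (trans (u-zero p∣i) (sym (trans (cong -_ (u-zero p∣j)) neg0)))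
      where
      opaque
        unfolding _+_
        neg0 : - 0ℤ ≡ 0ℤ
        neg0 = refl
      p∣i : p ∣ i
      p∣i = ∣m+n∣m⇒∣n (subst (p ∣_) (trans (sym eq) (ℕₚ.+-comm i j)) (∣n⇒∣m*n t (m∣m*n Q))) p∣j
    ... | no p∤j = u-unique p∤i (begin
        - u j * + i        ≡⟨ lem₁ (u j) (+ i) (+ j) ⟩
        u j * + j - u j * (+ i + + j)
          ≈⟨ +-cong (u-inverse p∤j) (-‿cong (*-congˡ (u j) (≈-trans (≈-reflexive (trans (sym (pos-+ i j)) (cong +_ eq))) (∣⇒≈0 (n∣m*n t))))) ⟩
        1ℤ - u j * 0ℤ      ≡⟨ lem₂ (u j) ⟩
        1ℤ                 ∎)
      where
      open ≈-Reasoning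
      p∤i : ¬ (p ∣ i)
      p∤i p∣i = p∤j (∣m+n∣m⇒∣n (subst (p ∣_) (sym eq) (∣n⇒∣m*n t (m∣m*n Q))) p∣i)
      opaque
        unfolding _+_
        lem₁ : ∀ u i j → - u * i ≡ u * j - u * (i + j)
        lem₁ = solve-∀ ring
        lem₂ : ∀ u → 1ℤ - u * 0ℤ ≡ 1ℤ
        lem₂ = solve-∀ ring

    u-mul : ∀ i j → u (i ℕ.* j) ≈ u i * u j
    u-mul i j with p ∣? i | p ∣? j
    ... | yes p∣i | _       = ≈-reflexive (trans (u-zero (∣m⇒∣m*n j p∣i)) (sym (trans (cong (_* u j) (u-zero p∣i)) (*-zeroˡ (u j)))))
    ... | no p∤i  | yes p∣j = ≈-reflexive (trans (u-zero (∣n⇒∣m*n i p∣j)) (sym (trans (cong (u i *_) (u-zero p∣j)) (*-zeroʳ (u i)))))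
    ... | no p∤i  | no p∤j  = u-unique (λ d → [ p∤i , p∤j ]′ (euclidsLemma i j pr d))
      (≈-trans (≈-reflexive (trans (cong (u i * u j *_) (pos-* i j)) (lem (u i) (u j) (+ i) (+ j))))
        (≈-trans (*-cong (u-inverse p∤i) (u-inverse p∤j)) (≈-reflexive (*-identityˡ 1ℤ))))
      where
      opaque
        unfolding _+_
        lem : ∀ a b x y → a * b * (x * y) ≡ (a * x) * (b * y)
        lem = solve-∀ ring

    û-involutive : ∀ {i} → i ℕ.< P → ¬ (p ∣ i) → û (û i) ≡ i
    û-involutive {i} i< p∤i = begin
      û (û i)     ≡⟨ sym (m<n⇒m%n≡m (û< (û i))) ⟩
      û (û i) % P ≡⟨ ≈⇒% (u-unique p∤û (≈-trans (≈-reflexive (*-comm (+ i) (u i))) (u-inverse p∤i))) ⟩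
      i % P       ≡⟨ m<n⇒m%n≡m i< ⟩
      i           ∎
      where
      open ≡-Reasoning
      p∤û : ¬ (p ∣ û i)
      p∤û d = p∤i (≈0⇒∣ (Mod.≈-trans (+ p) (P⇒p (≈-trans (≈-reflexive (lem (+ i))) (*-congˡ (+ i) (≈-sym (u-inverse p∤i)))))
          (Mod.≈-trans (+ p) (Mod.*-congˡ (+ p) (+ i) (Mod.*-congʳ (+ p) (+ i) (∣⇒≈0 d))) (Mod.≈-reflexive (+ p) (lem₀ (+ i))))))
        where
        opaque
          unfolding _+_
          lem : ∀ x → x ≡ x * 1ℤ
          lem = solve-∀ ring
          lem₀ : ∀ x → x * (0ℤ * x) ≡ 0ℤ
          lem₀ = solve-∀ ring

    residue-class : ∀ r s → r ℕ.< p → s ℕ.< Q → r ℕ.+ s ℕ.* p ℕ.< P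
    residue-class r s r<p s<Q = begin-strict
      r ℕ.+ s ℕ.* p   <⟨ ℕₚ.+-monoˡ-< (s ℕ.* p) r<p ⟩
      p ℕ.+ s ℕ.* p   ≤⟨ ℕₚ.*-monoˡ-≤ p s<Q ⟩
      Q ℕ.* p         ≡⟨ ℕₚ.*-comm Q p ⟩
      P               ∎
      where open ℕₚ.≤-Reasoning

    residue-/ : ∀ r s → r ℕ.< p → (r ℕ.+ s ℕ.* p) / p ≡ s
    residue-/ r s r<p = trans (+-distrib-/-∣ʳ r (n∣m*n s)) (cong₂ ℕ._+_ (m<n⇒m/n≡0 r<p) (m*n/n≡m s p))

    residue-≈ : ∀ r s → + (r ℕ.+ s ℕ.* p) ≈ + r [mod + p ]
    residue-≈ r s = Mod.modulo (+ s) (trans (pos-+ r (s ℕ.* p)) (cong (_+_ (+ r)) (pos-* s p)))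

    u-inverse-p : ∀ {i} → ¬ (p ∣ i) → u i * + i ≈ 1ℤ [mod + p ]
    u-inverse-p p∤i = P⇒p (u-inverse p∤i)

    module InverseClass (r r′ : ℕ) (r<p : r ℕ.< p) (r′<p : r′ ℕ.< p) (rr′≈1 : + r * + r′ ≈ 1ℤ [mod + p ]) where

      -- Inversion sends r + s p to r′ + τ(s) p: this is inversion in the coordinate s of a residue
      -- class modulo p.
      τ : ℕ → ℕ
      τ s = û (r ℕ.+ s ℕ.* p) / p

      p∤ : ∀ s → ¬ (p ∣ r ℕ.+ s ℕ.* p)
      p∤ s d = 0≉1 (≈ₚ.≈-trans (≈ₚ.≈-reflexive (sym (*-zeroˡ (+ r′))))
        (≈ₚ.≈-trans (≈ₚ.*-congʳ (+ r′) (≈ₚ.≈-trans (≈ₚ.≈-sym (∣⇒≈0 d)) (residue-≈ r s))) rr′≈1))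
        where
        module ≈ₚ = Mod (+ p)
        0≉1 : ¬ (0ℤ ≈ 1ℤ [mod + p ])
        0≉1 h = prime⇒¬∣1 (≈0⇒∣ (≈ₚ.≈-sym h))
          where
          prime⇒¬∣1 : ¬ (p ∣ 1)
          prime⇒¬∣1 d = ℕₚ.<⇒≱ (ℕ.nonTrivial⇒n>1 p {{prime⇒nonTrivial pr}}) (∣⇒≤ d)

      û-decompose : ∀ s → û (r ℕ.+ s ℕ.* p) ≡ r′ ℕ.+ τ s ℕ.* p
      û-decompose s = trans (m≡m%n+[m/n]*n (û (r ℕ.+ s ℕ.* p)) p)
        (cong (ℕ._+ τ s ℕ.* p) (trans (≈⇒% (inverse-unique (+ p) (u-inverse-p (p∤ s)) r′-inverse)) (m<n⇒m%n≡m r′<p)))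
        where
        r′-inverse : + r′ * + (r ℕ.+ s ℕ.* p) ≈ 1ℤ [mod + p ]
        r′-inverse = Mod.≈-trans (+ p) (Mod.*-congˡ (+ p) (+ r′) (residue-≈ r s))
          (Mod.≈-trans (+ p) (Mod.≈-reflexive (+ p) (*-comm (+ r′) (+ r))) rr′≈1)

      τ< : ∀ s → τ s ℕ.< Q
      τ< s = m<n*o⇒m/o<n (subst (û (r ℕ.+ s ℕ.* p) ℕ.<_) (ℕₚ.*-comm p Q) (û< (r ℕ.+ s ℕ.* p)))

      τ-inverse : ∀ s → s ℕ.< Q → û (r′ ℕ.+ τ s ℕ.* p) / p ≡ s
      τ-inverse s s<Q = trans (cong (λ z → û z / p) (sym (û-decompose s)))
        (trans (cong (_/ p) (û-involutive (residue-class r s r<p s<Q) (p∤ s))) (residue-/ r s r<p))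

    -- Inversion maps the residue class of x modulo p bijectively onto that of 1/x, which turns the sum
    -- of inverses into an arithmetic progression.
    Σu-class : ∀ (½ : ℤ) → ½ * + 2 ≈ 1ℤ → ∀ x → ¬ (p ∣ x) → Σ Q (λ s → u (x % p ℕ.+ s ℕ.* p)) ≈ + Q * u x
    Σu-class ½ ½*2 x p∤x = ≈-trans
      (*-cancel ½ (+ 2) ½*2 (begin
        + 2 * Σ Q (λ s → u (ρ ℕ.+ s ℕ.* p))
          ≡⟨ cong (+ 2 *_) (trans (Σ-cong Q λ s _ → trans (cong +_ (C.û-decompose s))
                (trans (pos-+ ρ′ (C.τ s ℕ.* p)) (cong (_+_ (+ ρ′)) (trans (pos-* (C.τ s) p) (*-comm (+ (C.τ s)) (+ p))))))
              (trans (Σ-+ Q _ _) (cong₂ _+_ (Σ-const Q (+ ρ′)) (trans (Σ-*ˡ Q (+ p) (λ s → + (C.τ s)))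
                (cong (+ p *_) (Σ-permute Q C.τ C′.τ (λ s _ → C.τ< s) (λ s _ → C′.τ< s) C.τ-inverse C′.τ-inverse (λ i → + i))))))) ⟩
        + 2 * (+ Q * + ρ′ + + p * Σ Q (λ i → + i))
          ≡⟨ lem₁ (+ Q) (+ ρ′) (+ p) (Σ Q (λ i → + i)) ⟩
        + 2 * (+ Q * + ρ′) + + p * (+ 2 * Σ Q (λ i → + i))
          ≡⟨ cong (λ z → + 2 * (+ Q * + ρ′) + + p * z) (gauss Q) ⟩
        -- Gauss's formula for twice the sum of all i below Q leaves p Q (Q - 1), a multiple of P.
        + 2 * (+ Q * + ρ′) + + p * (+ Q * (+ Q - 1ℤ))
          ≡⟨ cong (_+_ (+ 2 * (+ Q * + ρ′))) (trans (lem₂ (+ p) (+ Q) (+ Q - 1ℤ)) (cong ((+ Q - 1ℤ) *_) (sym (pos-* p Q)))) ⟩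
        + 2 * (+ Q * + ρ′) + (+ Q - 1ℤ) * + P
          ≈⟨ +-congˡ (+ 2 * (+ Q * + ρ′)) (*M≈0 (+ Q - 1ℤ)) ⟩
        + 2 * (+ Q * + ρ′) + 0ℤ
          ≡⟨ +-identityʳ _ ⟩
        + 2 * (+ Q * + ρ′) ∎))
      (scale Q ρ′≈u)
      where
      open ≈-Reasoning
      module ≈ₚ = Mod (+ p)
      ρ ρ′ : ℕ
      ρ = x % p
      ρ′ = û x % p
      ρ′≈u : + ρ′ ≈ u x [mod + p ]
      ρ′≈u = %≈ (û x) p
      ρρ′≈1 : + ρ * + ρ′ ≈ 1ℤ [mod + p ]
      ρρ′≈1 = ≈ₚ.≈-trans (≈ₚ.*-cong (%≈ x p) ρ′≈u) (≈ₚ.≈-trans (≈ₚ.≈-reflexive (*-comm (+ x) (u x))) (u-inverse-p p∤x))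
      ρ′ρ≈1 : + ρ′ * + ρ ≈ 1ℤ [mod + p ]
      ρ′ρ≈1 = ≈ₚ.≈-trans (≈ₚ.≈-reflexive (*-comm (+ ρ′) (+ ρ))) ρρ′≈1
      module C  = InverseClass ρ ρ′ (m%n<n x p) (m%n<n (û x) p) ρρ′≈1
      module C′ = InverseClass ρ′ ρ (m%n<n (û x) p) (m%n<n x p) ρ′ρ≈1
      opaque
        unfolding _+_
        lem₁ : ∀ q r p s → + 2 * (q * r + p * s) ≡ + 2 * (q * r) + p * (+ 2 * s)
        lem₁ = solve-∀ ring
        lem₂ : ∀ p q r → p * (q * r) ≡ r * (p * q)
        lem₂ = solve-∀ ring
        lem₃ : ∀ s n → + 2 * (s + n) ≡ + 2 * s + + 2 * n
        lem₃ = solve-∀ ring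
        lem₄ : ∀ n → n * (n - 1ℤ) + + 2 * n ≡ (1ℤ + n) * (1ℤ + n - 1ℤ)
        lem₄ = solve-∀ ring
        gauss : ∀ n → + 2 * Σ n (λ i → + i) ≡ + n * (+ n - 1ℤ)
        gauss zero    = refl
        gauss (suc n) = trans (cong (+ 2 *_) (Σ-last n (λ i → + i))) (trans (lem₃ (Σ n (λ i → + i)) (+ n))
          (trans (cong (_+ + 2 * + n) (gauss n)) (lem₄ (+ n))))

    open Convolution u
    open Periodic P u-periodic

    module Cube (½ : ℤ) (½*2 : ½ * + 2 ≈ 1ℤ) where

      Σu≈0 : Σ P u ≈ 0ℤ
      Σu≈0 = *-cancel ½ (+ 2) ½*2 (begin
        + 2 * Σ P u                          ≡⟨ two (Σ P u) ⟩
        Σ P u + Σ P u                        ≡⟨ cong (_+ Σ P u) (sym (Σ-reflect P u (trans u-0 (sym (u-zero (m∣m*n Q)))))) ⟩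
        Σ P (λ i → u (P ℕ.∸ i)) + Σ P u      ≈⟨ +-congʳ (Σ P u) (Σ-cong≈ (+ P) P λ i i< → ≈-trans
                                                  (u-neg (P ℕ.∸ i) i 1 (trans (ℕₚ.m∸n+n≡m (ℕₚ.<⇒≤ i<)) (sym (ℕₚ.+-identityʳ P))))
                                                  (≈-reflexive (neg (u i)))) ⟩
        Σ P (λ i → - 1ℤ * u i) + Σ P u       ≡⟨ cong (_+ Σ P u) (Σ-*ˡ P (- 1ℤ) u) ⟩
        - 1ℤ * Σ P u + Σ P u                 ≡⟨ kill (Σ P u) ⟩
        + 2 * 0ℤ                             ∎)
        where
        open ≈-Reasoning
        opaque
          unfolding _+_
          two : ∀ x → + 2 * x ≡ x + x
          two = solve-∀ ring
          neg : ∀ x → - x ≡ - 1ℤ * x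
          neg = solve-∀ ring
          kill : ∀ x → - 1ℤ * x + x ≡ + 2 * 0ℤ
          kill = solve-∀ ring

      -- If j + y = x then x u(j) u(y) = (j u(j)) u(y) + u(j) (y u(y)), and j u(j) is the indicator of p ∤ j.
      module _ (x : ℕ) (p∤x : ¬ (p ∣ x)) where

        private
          -- This is x - j modulo P; the added period keeps the truncated subtraction exact for j <
          -- P.
          y : ℕ → ℕ
          y j = (P ℕ.+ x) ℕ.∸ j

          σ : ℕ → ℕ
          σ j = y j % P

          e : ℕ → ℤ
          e j = 1ℤ - 𝟙∣ p j

          opaque
            unfolding _+_
            cancel : ∀ a b → a ≡ a + b - b
            cancel = solve-∀ ring
            cancel′ : ∀ a b → a - (a - b) ≡ b
            cancel′ = solve-∀ ring

          y-≡ : ∀ j → j ℕ.< P → + (y j) ≡ + (P ℕ.+ x) - + j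
          y-≡ j j< = trans (cancel (+ (y j)) (+ j)) (cong (_- + j) (trans (sym (pos-+ (y j) j))
            (cong +_ (ℕₚ.m∸n+n≡m (ℕₚ.≤-trans (ℕₚ.<⇒≤ j<) (ℕₚ.m≤m+n P x))))))

          y-≈ : ∀ j → j ℕ.< P → + (y j) ≈ + x - + j
          y-≈ j j< = ≈-trans (≈-reflexive (y-≡ j j<)) (+-congʳ (- + j) (P+ x))

          yσ≈ : ∀ j → j ℕ.< P → + (y (σ j)) ≈ + j
          yσ≈ j j< = ≈-trans (y-≈ (σ j) (m%n<n (y j) P))
            (≈-trans (+-congˡ (+ x) (-‿cong (≈-trans (%≈ (y j) P) (y-≈ j j<)))) (≈-reflexive (cancel′ (+ x) (+ j))))

          σσ : ∀ j → j ℕ.< P → σ (σ j) ≡ j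
          σσ j j< = trans (≈⇒% (yσ≈ j j<)) (m<n⇒m%n≡m j<)

          e-cong : ∀ {i j} → + i ≈ + j → e i ≡ e j
          e-cong h = cong (_-_ 1ℤ) (𝟙∣-cong (p∣-≈ h) (p∣-≈ (≈-sym h)))

          ι≈e : ∀ j → + j * u j ≈ e j
          ι≈e j with p ∣? j
          ... | yes p∣j = ≈-reflexive (trans (cong (+ j *_) (u-zero p∣j)) (trans (*-zeroʳ (+ j)) one))
            where
            opaque
              unfolding _+_
              one : 0ℤ ≡ 1ℤ - 1ℤ
              one = refl
          ... | no p∤j = ≈-trans (≈-reflexive (*-comm (+ j) (u j))) (≈-trans (u-inverse p∤j) (≈-reflexive one))
            where
            opaque
              unfolding _+_
              one : 1ℤ ≡ 1ℤ - 0ℤ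
              one = refl

          term : ∀ j → j ℕ.< P → + x * (u j * u (y j)) ≈ e j * u (y j) + u j * e (y j)
          term j j< = begin
            + x * (u j * u (y j))
              ≈⟨ *-congʳ (u j * u (y j)) (≈-trans (≈-reflexive (sym (cancel′ (- + j) (+ x)) ))
                   (≈-trans (≈-reflexive (regroup (+ x) (+ j))) (+-congˡ (+ j) (≈-sym (y-≈ j j<))))) ⟩
            (+ j + + (y j)) * (u j * u (y j))
              ≡⟨ expand (+ j) (+ (y j)) (u j) (u (y j)) ⟩
            (+ j * u j) * u (y j) + u j * (+ (y j) * u (y j))
              ≈⟨ +-cong (*-congʳ (u (y j)) (ι≈e j)) (*-congˡ (u j) (ι≈e (y j))) ⟩
            e j * u (y j) + u j * e (y j) ∎
            where
            open ≈-Reasoning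
            opaque
              unfolding _+_
              regroup : ∀ x j → - j - (- j - x) ≡ j + (x - j)
              regroup = solve-∀ ring
              expand : ∀ j y a b → (j + y) * (a * b) ≡ (j * a) * b + a * (y * b)
              expand = solve-∀ ring

          B : ℤ
          B = Σ P (λ j → u j * e (y j))

          -- The involution j ↦ x - j modulo P exchanges the two halves of the partial fraction.
          swapped : Σ P (λ j → e j * u (y j)) ≡ B
          swapped = trans
            (Σ-cong P λ j j< → trans (*-comm (e j) (u (y j))) (cong₂ _*_
              (u-cong (≈-sym (%≈ (y j) P))) (e-cong (≈-sym (yσ≈ j j<)))))
            (Σ-permute P σ σ (λ j _ → m%n<n (y j) P) (λ j _ → m%n<n (y j) P) σσ σσ (λ j → u j * e (y j)))

          -- Since p divides x - j exactly when j ≡ x modulo p, each block of length p contributes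
          -- one term.
          class : Σ P (λ j → u j * 𝟙∣ p (y j)) ≡ Σ Q (λ s → u (x % p ℕ.+ s ℕ.* p))
          class = trans (cong (λ S → Σ S (λ j → u j * 𝟙∣ p (y j))) (ℕₚ.*-comm p Q))
            (trans (Σ-block p Q _) (Σ-cong Q λ s s< → trans
              (Σ-cong p λ r r< → trans (*-comm (u (r ℕ.+ s ℕ.* p)) _)
                (cong (_* u (r ℕ.+ s ℕ.* p)) (indicator r s r< s<)))
              (Σ-δ p (x % p) (λ r → u (r ℕ.+ s ℕ.* p)) (m%n<n x p))))
            where
            module ≈ₚ = Mod (+ p)
            opaque
              unfolding _+_
              back : ∀ x j → x ≡ (x - j) + j
              back = solve-∀ ring
              self : ∀ j → j - j ≡ 0ℤ
              self = solve-∀ ring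
            indicator : ∀ r s → r ℕ.< p → s ℕ.< Q → 𝟙∣ p (y (r ℕ.+ s ℕ.* p)) ≡ δ r (x % p)
            indicator r s r< s< with p ∣? y (r ℕ.+ s ℕ.* p)
            ... | yes d = sym (trans (cong (λ z → δ z (x % p)) r≡) (δ-refl (x % p)))
              where
              x≈r : + x ≈ + r [mod + p ]
              x≈r = ≈ₚ.≈-trans (≈ₚ.≈-reflexive (back (+ x) (+ (r ℕ.+ s ℕ.* p))))
                (≈ₚ.≈-trans (≈ₚ.+-cong (≈ₚ.≈-trans (≈ₚ.≈-sym (P⇒p (y-≈ _ (residue-class r s r< s<)))) (∣⇒≈0 d)) (residue-≈ r s))
                  (≈ₚ.≈-reflexive (+-identityˡ (+ r))))
              r≡ : r ≡ x % p
              r≡ = sym (trans (≈⇒% x≈r) (m<n⇒m%n≡m r<))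
            ... | no ¬d = sym (δ-≢ λ r≡ → ¬d (≈0⇒∣ (≈ₚ.≈-trans (P⇒p (y-≈ _ (residue-class r s r< s<)))
                (≈ₚ.≈-trans (≈ₚ.+-congˡ (+ x) (≈ₚ.-‿cong (≈ₚ.≈-trans (residue-≈ r s)
                   (≈ₚ.≈-trans (≈ₚ.≈-reflexive (cong +_ r≡)) (%≈ x p)))))
                  (≈ₚ.≈-reflexive (self (+ x)))))))

          -- The full sum of `u` vanishes by oddness, so excluding the class of x modulo p leaves
          -- minus the sum over that class.
          B≈ : B ≈ - (+ Q * u x)
          B≈ = begin
            Σ P (λ j → u j * e (y j))
              ≡⟨ (Σ-cong P λ j _ → expand (u j) (𝟙∣ p (y j))) ⟩
            Σ P (λ j → u j + - 1ℤ * (u j * 𝟙∣ p (y j)))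
              ≡⟨ trans (Σ-+ P _ _) (cong (_+_ (Σ P u)) (Σ-*ˡ P (- 1ℤ) _)) ⟩
            Σ P u + - 1ℤ * Σ P (λ j → u j * 𝟙∣ p (y j))
              ≈⟨ +-cong Σu≈0 (*-congˡ (- 1ℤ) (≈-trans (≈-reflexive class) (Σu-class ½ ½*2 x p∤x))) ⟩
            0ℤ + - 1ℤ * (+ Q * u x)
              ≡⟨ final (+ Q * u x) ⟩
            - (+ Q * u x) ∎
            where
            open ≈-Reasoning
            opaque
              unfolding _+_
              expand : ∀ a c → a * (1ℤ - c) ≡ a + - 1ℤ * (a * c)
              expand = solve-∀ ring
              final : ∀ a → 0ℤ + - 1ℤ * a ≡ - a
              final = solve-∀ ring

        xc≈ : + x * c x ≈ - (+ 2 * + Q * u x)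
        xc≈ = begin
          + x * c x
            ≡⟨ sym (Σ-*ˡ P (+ x) _) ⟩
          Σ P (λ j → + x * (u j * u (y j)))
            ≈⟨ Σ-cong≈ (+ P) P term ⟩
          Σ P (λ j → e j * u (y j) + u j * e (y j))
            ≡⟨ trans (Σ-+ P _ _) (cong (_+ B) swapped) ⟩
          B + B
            ≈⟨ +-cong B≈ B≈ ⟩
          - (+ Q * u x) + - (+ Q * u x)
            ≡⟨ lem (+ Q) (u x) ⟩
          - (+ 2 * + Q * u x) ∎
          where
          open ≈-Reasoning
          opaque
            unfolding _+_
            lem : ∀ q u → - (q * u) + - (q * u) ≡ - (+ 2 * q * u)
            lem = solve-∀ ring

      k-cube : ∀ x → k x ≈ - (+ 2 * + Q) * (u x * u x * u x)
      k-cube x with p ∣? x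
      ... | yes p∣x = ≈-reflexive (trans (cong (_* c x) (u-zero p∣x)) (trans (*-zeroˡ (c x))
          (sym (trans (cong (λ z → - (+ 2 * + Q) * (z * z * z)) (u-zero p∣x)) (zero³ (- (+ 2 * + Q)))))))
        where
        opaque
          unfolding _+_
          zero³ : ∀ a → a * (0ℤ * 0ℤ * 0ℤ) ≡ 0ℤ
          zero³ = solve-∀ ring
      ... | no p∤x = begin
        u x * c x                        ≡⟨ sym (trans (*-comm _ 1ℤ) (*-identityˡ _)) ⟩
        u x * c x * 1ℤ                   ≈⟨ *-congˡ (u x * c x) (≈-sym (u-inverse p∤x)) ⟩
        u x * c x * (u x * + x)          ≡⟨ lem₁ (u x) (c x) (+ x) ⟩
        u x * u x * (+ x * c x)          ≈⟨ *-congˡ (u x * u x) (xc≈ x p∤x) ⟩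
        u x * u x * - (+ 2 * + Q * u x)  ≡⟨ lem₂ (u x) (+ Q) ⟩
        - (+ 2 * + Q) * (u x * u x * u x) ∎
        where
        open ≈-Reasoning
        opaque
          unfolding _+_
          lem₁ : ∀ u c x → u * c * (u * x) ≡ u * u * (x * c)
          lem₁ = solve-∀ ring
          lem₂ : ∀ u q → u * u * - (+ 2 * q * u) ≡ - (+ 2 * q) * (u * u * u)
          lem₂ = solve-∀ ring

  -- Reduction of p-integral rationals

  -- The p-integral rational x is congruent to the integer a modulo M.
  record Reduces (p : ℕ) (M : ℤ) (x : ℚ) (a : ℤ) : Set where
    constructor reduces
    field
      numerator     : ℤ
      denominator-1 : ℕ
      fraction      : toℚᵘ x ≃ mkℚᵘ numerator denominator-1
      p∤denominator : ¬ (p ∣ suc denominator-1)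
      congruent     : numerator ≈ a * + suc denominator-1 [mod M ]

  module _ {p : ℕ} (pr : Prime p) (M : ℤ) where

    open Mod M

    private
      ∤-* : ∀ {m n} → ¬ (p ∣ m) → ¬ (p ∣ n) → ¬ (p ∣ m ℕ.* n)
      ∤-* p∤m p∤n d = [ p∤m , p∤n ]′ (euclidsLemma _ _ pr d)

      p∤1 : ¬ (p ∣ 1)
      p∤1 d = ℕₚ.<⇒≱ (ℕ.nonTrivial⇒n>1 p {{prime⇒nonTrivial pr}}) (∣⇒≤ d)

    opaque
      unfolding _+_

      reduces-+ : ∀ {x y a b} → Reduces p M x a → Reduces p M y b → Reduces p M (x ℚ.+ y) (a + b)
      reduces-+ {x} {y} {a} {b} (reduces e d x≃ p∤d e≈) (reduces f g y≃ p∤g f≈) = reduces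
        (e * + suc g + f * + suc d) (g ℕ.+ d ℕ.* suc g)
        (ℚᵘₚ.≃-trans (ℚₚ.toℚᵘ-homo-+ x y) (ℚᵘₚ.+-cong x≃ y≃))
        (∤-* p∤d p∤g)
        (≈-trans (+-cong (*-congʳ (+ suc g) e≈) (*-congʳ (+ suc d) f≈))
          (≈-reflexive (trans (lem a b (+ suc d) (+ suc g)) (cong ((a + b) *_) (sym (ℤₚ.pos-* (suc d) (suc g)))))))
        where
        lem : ∀ a b d g → a * d * g + b * g * d ≡ (a + b) * (d * g)
        lem = solve-∀ ring

      reduces-* : ∀ {x y a b} → Reduces p M x a → Reduces p M y b → Reduces p M (x ℚ.* y) (a * b)
      reduces-* {x} {y} {a} {b} (reduces e d x≃ p∤d e≈) (reduces f g y≃ p∤g f≈) = reduces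
        (e * f) (g ℕ.+ d ℕ.* suc g)
        (ℚᵘₚ.≃-trans (ℚₚ.toℚᵘ-homo-* x y) (ℚᵘₚ.*-cong x≃ y≃))
        (∤-* p∤d p∤g)
        (≈-trans (*-cong e≈ f≈)
          (≈-reflexive (trans (lem a b (+ suc d) (+ suc g)) (cong (a * b *_) (sym (ℤₚ.pos-* (suc d) (suc g)))))))
        where
        lem : ∀ a b d g → (a * d) * (b * g) ≡ a * b * (d * g)
        lem = solve-∀ ring

      reduces-neg : ∀ {x a} → Reduces p M x a → Reduces p M (ℚ.- x) (- a)
      reduces-neg {x} {a} (reduces e d x≃ p∤d e≈) = reduces (- e) d
        (ℚᵘₚ.≃-trans (ℚₚ.toℚᵘ-homo‿- x) (ℚᵘₚ.-‿cong x≃)) p∤d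
        (≈-trans (-‿cong e≈) (≈-reflexive (lem a (+ suc d))))
        where
        lem : ∀ a d → - (a * d) ≡ - a * d
        lem = solve-∀ ring

      reduces-/ : ∀ n d .{{_ : NonZero d}} {v} → ¬ (p ∣ d) → + n ≈ v * + d → Reduces p M (+ n ℚ./ d) v
      reduces-/ n (suc d) p∤d h = reduces (+ n) d (ℚₚ.toℚᵘ-fromℚᵘ (mkℚᵘ (+ n) d)) p∤d h

      reduces-ℕ : ∀ n → Reduces p M (ℕ→ℚ n) (+ n)
      reduces-ℕ n = reduces-/ n 1 p∤1 (≈-reflexive (sym (ℤₚ.*-identityʳ (+ n))))

      reduces-inv : ∀ n {v} → ¬ (p ∣ n) → v * + n ≈ 1ℤ → Reduces p M (inv n) v
      reduces-inv zero    p∤n h = ⊥-elim (p∤n (p ∣0))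
      reduces-inv (suc n) p∤n h = reduces-/ 1 (suc n) p∤n (≈-sym h)

      reduces-0 : Reduces p M 0ℚ 0ℤ
      reduces-0 = reduces 0ℤ 0 ℚᵘₚ.≃-refl p∤1 ≈-refl

      reduces-1 : Reduces p M 1ℚ 1ℤ
      reduces-1 = reduces 1ℤ 0 ℚᵘₚ.≃-refl p∤1 ≈-refl

    reduces-- : ∀ {x y a b} → Reduces p M x a → Reduces p M y b → Reduces p M (x ℚ.- y) (a - b)
    reduces-- rx ry = reduces-+ rx (reduces-neg ry)

    reduces-≈ : ∀ {x a b} → a ≈ b → Reduces p M x a → Reduces p M x b
    reduces-≈ a≈b (reduces e d x≃ p∤d e≈) = reduces e d x≃ p∤d (≈-trans e≈ (*-congʳ (+ suc d) a≈b))

  module _ {p : ℕ} (pr : Prime p) where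

    opaque
      unfolding _+_

      -- A factor Q raises the modulus from p to p Q; therefore the Bernoulli number has to be known
      -- only modulo p.
      reduces-scale : ∀ Q t {x b} → Reduces p (+ p) x b →
                      Reduces p (+ (p ℕ.* Q)) (ℕ→ℚ (Q ℕ.* t) ℚ.* x) (+ Q * (+ t * b))
      reduces-scale Q t {x} {b} (reduces e d x≃ p∤d e≈) = reduces
        (+ (Q ℕ.* t) * e) (d ℕ.+ 0)
        (ℚᵘₚ.≃-trans (ℚₚ.toℚᵘ-homo-* (ℕ→ℚ (Q ℕ.* t)) x)
          (ℚᵘₚ.*-cong (ℚₚ.toℚᵘ-fromℚᵘ (mkℚᵘ (+ (Q ℕ.* t)) 0)) x≃))
        (p∤d ∘ subst (λ z → p ∣ suc z) (ℕₚ.+-identityʳ d))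
        (≈-trans (≈-reflexive (trans (cong (_* e) (ℤₚ.pos-* Q t)) (ℤₚ.*-assoc (+ Q) (+ t) e)))
          (≈-trans (scale Q (Mod.*-congˡ (+ p) (+ t) e≈))
            (≈-reflexive (trans (lem (+ Q) (+ t) b (+ suc d)) (cong (λ z → + Q * (+ t * b) * + suc z) (sym (ℕₚ.+-identityʳ d)))))))
        where
        open Mod (+ (p ℕ.* Q))
        lem : ∀ q t b d → q * (t * (b * d)) ≡ q * (t * b) * d
        lem = solve-∀ ring

  module _ {p : ℕ} (pr : Prime p) (α : ℕ) where

    private
      instance
        p≢0 : NonZero p
        p≢0 = prime⇒nonZero pr
        pα≢0 : NonZero (p ℕ.^ α)
        pα≢0 = ℕₚ.m^n≢0 p α

    open Mod (+ (p ℕ.^ α))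

    opaque
      unfolding _+_

      private
        ≈0⇒∣∣ : ∀ {z} → z ≈ 0ℤ → p ℕ.^ α ∣ ℤ.∣ z ∣
        ≈0⇒∣∣ {z} (Mod.modulo k eq) = divides ℤ.∣ k ∣ (trans (cong ℤ.∣_∣ (trans eq (ℤₚ.+-identityˡ (k ℤ.* + (p ℕ.^ α))))) (ℤₚ.abs-* k (+ (p ℕ.^ α))))

      -- Cross-multiplication with the witnessing fraction: p^α passes to the reduced numerator
      -- because p does not divide the other denominator, and the reduced denominator divides that
      -- denominator.
      reduces-to-0 : ∀ {z} → Reduces p (+ (p ℕ.^ α)) z 0ℤ → (p ℕ.^ α) ∣ ℤ.∣ ↥ z ∣ × Coprime (↧ₙ z) p
      reduces-to-0 {mkℚ n d-1 n⊥d} (reduces e g (*≡* eq) p∤g e≈) =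
        Coprime.coprime-divisor (Coprime.sym (coprime-^ (prime∤⇒coprime pr p∤g) α)) pα∣ ,
        prime∤⇒coprime pr (λ p∣d → p∤g (∣-trans p∣d d∣g))
        where
        abs-eq : ℤ.∣ n ∣ ℕ.* suc g ≡ ℤ.∣ e ∣ ℕ.* suc d-1
        abs-eq = trans (sym (ℤₚ.abs-* n (+ suc g))) (trans (cong ℤ.∣_∣ eq) (ℤₚ.abs-* e (+ suc d-1)))
        e≈0 : e ≈ 0ℤ
        e≈0 = ≈-trans e≈ (≈-reflexive (ℤₚ.*-zeroˡ (+ suc g)))
        pα∣ : p ℕ.^ α ∣ suc g ℕ.* ℤ.∣ n ∣
        pα∣ = subst (p ℕ.^ α ∣_) (trans (sym abs-eq) (ℕₚ.*-comm ℤ.∣ n ∣ (suc g))) (∣m⇒∣m*n (suc d-1) (≈0⇒∣∣ e≈0))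
        d∣g : suc d-1 ∣ suc g
        d∣g = Coprime.coprime-divisor (Coprime.sym (Coprime.recompute n⊥d)) (divides ℤ.∣ e ∣ abs-eq)

    reduces⇒CongQ : ∀ {x y a b} → Reduces p (+ (p ℕ.^ α)) x a → Reduces p (+ (p ℕ.^ α)) y b → a ≈ b → CongQ p α x y
    reduces⇒CongQ {x} {y} {a} {b} rx ry a≈b = reduces-to-0 (reduces-≈ pr _
      (≈-trans (+-congʳ (- b) a≈b) (≈-reflexive (self b))) (reduces-- pr _ rx ry))
      where
      opaque
        unfolding _+_
        self : ∀ b → b - b ≡ 0ℤ
        self = solve-∀ ring

  -- Power sums and Bernoulli numbers

  C-absorb : ∀ n k → suc k ℕ.* (suc n C suc k) ≡ suc n ℕ.* (n C k)
  C-absorb zero    zero    = refl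
  C-absorb zero    (suc k) = trans (cong (suc (suc k) ℕ.*_) (k>n⇒nCk≡0 {1} {suc (suc k)} (s≤s (s≤s z≤n))))
    (trans (ℕₚ.*-zeroʳ (suc (suc k))) (sym (cong (1 ℕ.*_) (k>n⇒nCk≡0 {0} {suc k} (s≤s z≤n)))))
  C-absorb (suc m) zero    = trans (ℕₚ.+-identityʳ _) (trans (nC1≡n (suc (suc m))) (sym (ℕₚ.*-identityʳ _)))
  C-absorb (suc m) (suc k) = begin
    suc (suc k) ℕ.* (suc (suc m) C suc (suc k))
      ≡⟨ cong (suc (suc k) ℕ.*_) (sym (nCk+nC[k+1]≡[n+1]C[k+1] (suc m) (suc k))) ⟩
    suc (suc k) ℕ.* (X ℕ.+ (suc m C suc (suc k)))
      ≡⟨ expand k X (suc m C suc (suc k)) ⟩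
    X ℕ.+ (suc k ℕ.* X ℕ.+ suc (suc k) ℕ.* (suc m C suc (suc k)))
      ≡⟨ cong (X ℕ.+_) (cong₂ ℕ._+_ (C-absorb m k) (C-absorb m (suc k))) ⟩
    X ℕ.+ (suc m ℕ.* (m C k) ℕ.+ suc m ℕ.* (m C suc k))
      ≡⟨ cong (X ℕ.+_) (sym (ℕₚ.*-distribˡ-+ (suc m) (m C k) (m C suc k))) ⟩
    X ℕ.+ suc m ℕ.* ((m C k) ℕ.+ (m C suc k))
      ≡⟨ cong (λ z → X ℕ.+ suc m ℕ.* z) (nCk+nC[k+1]≡[n+1]C[k+1] m k) ⟩
    suc (suc m) ℕ.* X ∎
    where
    open ≡-Reasoning
    X : ℕ
    X = suc m C suc k
    expand : ∀ k x y → suc (suc k) ℕ.* (x ℕ.+ y) ≡ x ℕ.+ (suc k ℕ.* x ℕ.+ suc (suc k) ℕ.* y)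
    expand = ℕ-Solver.solve-∀

  [1+n]Cn≡1+n : ∀ n → suc n C n ≡ suc n
  [1+n]Cn≡1+n zero    = refl
  [1+n]Cn≡1+n (suc n) = trans (sym (nCk+nC[k+1]≡[n+1]C[k+1] (suc n) n))
    (trans (cong₂ ℕ._+_ ([1+n]Cn≡1+n n) (nCn≡1 (suc n))) (ℕₚ.+-comm (suc n) 1))

  -- Sealed for the same reason as the ring operations: _C_ unfolds on variables.
  opaque
    bin : ℕ → ℕ → ℤ
    bin n k = + (n C k)

    bin≡ : ∀ n k → bin n k ≡ + (n C k)
    bin≡ n k = refl

  bin-self : ∀ n → bin n n ≡ 1ℤ
  bin-self n = trans (bin≡ n n) (cong +_ (nCn≡1 n))

  binomial : ∀ a N → + (suc a ℕ.^ N) ≡ Σ (suc N) (λ j → bin N j * + (a ℕ.^ j))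
  binomial a zero    = sym (trans (+-identityʳ _) (trans (*-comm (bin 0 0) 1ℤ) (trans (*-identityˡ _) (bin-self 0))))
  binomial a (suc N) = begin
    + (suc a ℕ.* suc a ℕ.^ N)
      ≡⟨ pos-* (suc a) (suc a ℕ.^ N) ⟩
    + suc a * + (suc a ℕ.^ N)
      ≡⟨ cong₂ _*_ (pos-+ 1 a) (binomial a N) ⟩
    (1ℤ + + a) * Σ (suc N) t
      ≡⟨ lem (+ a) (Σ (suc N) t) ⟩
    + a * Σ (suc N) t + Σ (suc N) t
      ≡⟨ cong₂ _+_ (sym (Σ-*ˡ (suc N) (+ a) t)) extend ⟩
    Σ (suc N) (λ j → + a * t j) + (t 0 + Σ (suc N) (t ∘ suc))
      ≡⟨ lem₂ (Σ (suc N) (λ j → + a * t j)) (t 0) (Σ (suc N) (t ∘ suc)) ⟩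
    t 0 + (Σ (suc N) (λ j → + a * t j) + Σ (suc N) (t ∘ suc))
      ≡⟨ cong₂ _+_ (cong (_* 1ℤ) (trans (bin≡ N 0) (sym (bin≡ (suc N) 0)))) (trans (sym (Σ-+ (suc N) (λ j → + a * t j) (t ∘ suc))) (Σ-cong (suc N) λ j _ → pascal j)) ⟩
    bin (suc N) 0 * 1ℤ + Σ (suc N) (λ j → bin (suc N) (suc j) * + (a ℕ.^ suc j)) ∎
    where
    open ≡-Reasoning
    t : ℕ → ℤ
    t j = bin N j * + (a ℕ.^ j)
    opaque
      unfolding _+_
      lem : ∀ a s → (1ℤ + a) * s ≡ a * s + s
      lem = solve-∀ ring
      lem₂ : ∀ x y z → x + (y + z) ≡ y + (x + z)
      lem₂ = solve-∀ ring
      lem₃ : ∀ a c d x → a * (c * x) + d * (a * x) ≡ (c + d) * (a * x)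
      lem₃ = solve-∀ ring
    extend : Σ (suc N) t ≡ t 0 + Σ (suc N) (t ∘ suc)
    extend = sym (trans (Σ-last (suc N) t)
      (trans (cong (λ c → Σ (suc N) t + c * + (a ℕ.^ suc N)) (trans (bin≡ N (suc N)) (cong +_ (k>n⇒nCk≡0 {N} {suc N} ℕₚ.≤-refl))))
        (trans (cong (_+_ (Σ (suc N) t)) (*-zeroˡ _)) (+-identityʳ _))))
    pascal-bin : ∀ j → bin N j + bin N (suc j) ≡ bin (suc N) (suc j)
    pascal-bin j = trans (cong₂ _+_ (bin≡ N j) (bin≡ N (suc j))) (trans (sym (pos-+ (N C j) (N C suc j)))
      (trans (cong +_ (nCk+nC[k+1]≡[n+1]C[k+1] N j)) (sym (bin≡ (suc N) (suc j)))))
    pascal : ∀ j → + a * t j + t (suc j) ≡ bin (suc N) (suc j) * + (a ℕ.^ suc j)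
    pascal j = trans (cong (λ z → + a * t j + bin N (suc j) * z) (pos-* a (a ℕ.^ j)))
      (trans (lem₃ (+ a) (bin N j) (bin N (suc j)) (+ (a ℕ.^ j)))
        (cong₂ _*_ (pascal-bin j) (sym (pos-* a (a ℕ.^ j)))))

  -- Fermat's congruence

  module _ {p : ℕ} (pr : Prime p) where
    private
      instance
        p≢0 : NonZero p
        p≢0 = prime⇒nonZero pr

    open Mod (+ p)

    prime∣C : ∀ j → suc j ℕ.< p → p ∣ p C suc j
    prime∣C j j<p with euclidsLemma (suc j) (p C suc j) pr p∣
      where
      p∣ : p ∣ suc j ℕ.* (p C suc j)
      p∣ = subst (λ q → q ∣ suc j ℕ.* (q C suc j)) (ℕₚ.suc-pred p)
        (subst (suc (ℕ.pred p) ∣_) (sym (C-absorb (ℕ.pred p) j)) (m∣m*n (ℕ.pred p C j)))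
    ... | inj₁ d = ⊥-elim (ℕₚ.<⇒≱ j<p (∣⇒≤ d))
    ... | inj₂ d = d

    -- Induction on a: in the expansion of (a + 1)^p the inner binomial coefficients vanish modulo
    -- p.
    fermat : ∀ a → + (a ℕ.^ p) ≈ + a
    fermat a = subst (λ q → + (a ℕ.^ q) ≈ + a) (ℕₚ.suc-pred p) (go (ℕ.pred p) (ℕₚ.suc-pred p) a)
      where
      go : ∀ n → suc n ≡ p → ∀ a → + (a ℕ.^ suc n) ≈ + a
      go n eq zero    = ≈-refl
      go n eq (suc a) = begin
        + (suc a ℕ.^ suc n)
          ≡⟨ binomial a (suc n) ⟩
        t 0 + Σ (suc n) (t ∘ suc)
          ≡⟨ cong (_+_ (t 0)) (Σ-last n (t ∘ suc)) ⟩
        t 0 + (Σ n (t ∘ suc) + t (suc n))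
          ≈⟨ +-congˡ (t 0) (+-cong middle (*-cong (≈-reflexive (bin-self (suc n))) (go n eq a))) ⟩
        t 0 + (0ℤ + 1ℤ * + a)
          ≡⟨ cong (λ c → c * 1ℤ + (0ℤ + 1ℤ * + a)) (bin≡ (suc n) 0) ⟩
        1ℤ * 1ℤ + (0ℤ + 1ℤ * + a)
          ≡⟨ lem (+ a) ⟩
        1ℤ + + a
          ≡⟨ sym (pos-+ 1 a) ⟩
        + suc a ∎
        where
        open ≈-Reasoning
        t : ℕ → ℤ
        t j = bin (suc n) j * + (a ℕ.^ j)
        opaque
          unfolding _+_
          lem : ∀ a → 1ℤ * 1ℤ + (0ℤ + 1ℤ * a) ≡ 1ℤ + a
          lem = solve-∀ ring
        middle : Σ n (t ∘ suc) ≈ 0ℤ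
        middle = ≈-trans (Σ-cong≈ (+ p) n λ j j<n → ≈-trans
          (*-congʳ (+ (a ℕ.^ suc j)) (≈-trans (≈-reflexive (bin≡ (suc n) (suc j)))
            (∣⇒≈0 (subst (λ q → p ∣ q C suc j) (sym eq) (prime∣C j (subst (suc j ℕ.<_) eq (s≤s j<n)))))))
          (≈-reflexive (*-zeroˡ (+ (a ℕ.^ suc j))))) (≈-reflexive (Σ-zero n λ _ _ → refl))

  -- Bernoulli numbers and power sums

  lastOr-∷ʳ : ∀ d xs x → lastOr d (xs ++ (x ∷ [])) ≡ x
  lastOr-∷ʳ d []       x = refl
  lastOr-∷ʳ d (y ∷ ys) x = lastOr-∷ʳ y ys x

  -- Identifies the accumulated list with the values of `bernoulli`, which turns the recursion on
  -- lists into the usual recurrence.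
  bernList≡applyUpTo : ∀ n → bernList n ≡ applyUpTo bernoulli (suc n)
  bernList≡applyUpTo zero    = refl
  bernList≡applyUpTo (suc n) = begin
    bernList n ++ (b ∷ [])                             ≡⟨ cong₂ (λ xs x → xs ++ (x ∷ [])) (bernList≡applyUpTo n) (sym (lastOr-∷ʳ 0ℚ (bernList n) b)) ⟩
    applyUpTo bernoulli (suc n) ++ (bernoulli (suc n) ∷ []) ≡⟨ applyUpTo-∷ʳ bernoulli (suc n) ⟩
    applyUpTo bernoulli (suc (suc n))                  ∎
    where
    open ≡-Reasoning
    b : ℚ
    b = ℚ.- (inv (suc (suc n)) ℚ.* sumℚ (zipWith (λ i Bi → ℕ→ℚ (suc (suc n) C i) ℚ.* Bi) (upTo (suc n)) (bernList n)))

  zipWith-applyUpTo : ∀ {A B C : Set} (h : A → B → C) f g n →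
                      zipWith h (applyUpTo f n) (applyUpTo g n) ≡ applyUpTo (λ i → h (f i) (g i)) n
  zipWith-applyUpTo h f g zero    = refl
  zipWith-applyUpTo h f g (suc n) = cong (h (f 0) (g 0) ∷_) (zipWith-applyUpTo h (f ∘ suc) (g ∘ suc) n)

  bernoulli-suc : ∀ n → bernoulli (suc n) ≡
    ℚ.- (inv (suc (suc n)) ℚ.* sumℚ (applyUpTo (λ i → ℕ→ℚ (suc (suc n) C i) ℚ.* bernoulli i) (suc n)))
  bernoulli-suc n = trans (lastOr-∷ʳ 0ℚ (bernList n) _) (cong (λ xs → ℚ.- (inv (suc (suc n)) ℚ.* sumℚ xs))
    (trans (cong (zipWith _ (upTo (suc n))) (bernList≡applyUpTo n)) (zipWith-applyUpTo _ id bernoulli (suc n))))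

  reduces-Σ : ∀ {p} (pr : Prime p) M n (F : ℕ → ℚ) (a : ℕ → ℤ) →
              (∀ i → i ℕ.< n → Reduces p M (F i) (a i)) → Reduces p M (sumℚ (applyUpTo F n)) (Σ n a)
  reduces-Σ pr M zero    F a h = reduces-0 pr M
  reduces-Σ pr M (suc n) F a h = reduces-+ pr M (h 0 (s≤s z≤n)) (reduces-Σ pr M n (F ∘ suc) (a ∘ suc) λ i i<n → h (suc i) (s≤s i<n))

  reduces-bernoulli-suc : ∀ {p} (pr : Prime p) M n v R →
    Reduces p M (inv (suc (suc n))) v →
    Reduces p M (sumℚ (applyUpTo (λ i → ℕ→ℚ (suc (suc n) C i) ℚ.* bernoulli i) (suc n))) R →
    Reduces p M (bernoulli (suc n)) (- (v * R))
  reduces-bernoulli-suc {p} pr M n v R rv rR = subst (λ B → Reduces p M B (- (v * R))) (sym (bernoulli-suc n))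
    (reduces-neg pr M (reduces-* pr M rv rR))

  powerSum : ℕ → ℕ → ℤ
  powerSum n e = Σ n (λ r → + (r ℕ.^ e))

  -- The differences (r + 1)^(e+1) - r^(e+1) telescope to n^(e+1), while the binomial theorem
  -- expands them into lower powers; `powerSum n (suc e)` is added to both sides in place of a
  -- subtraction.
  powerSum-telescope : ∀ n e → Σ (suc e) (λ j → bin (suc e) j * powerSum n j) ≡ + (n ℕ.^ suc e)
  powerSum-telescope n e = +-cancelˡ (powerSum n (suc e)) (begin
    powerSum n (suc e) + Σ (suc e) (λ j → bin (suc e) j * powerSum n j)
      ≡⟨ trans (+-comm (powerSum n (suc e)) _) (cong₂ _+_
           (trans (Σ-cong (suc e) λ j _ → sym (Σ-*ˡ n (bin (suc e) j) (λ r → + (r ℕ.^ j)))) (Σ-swap (suc e) n (λ j r → t r j)))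
           (Σ-cong n λ r _ → sym (trans (cong (_* + (r ℕ.^ suc e)) (bin-self (suc e))) (*-identityˡ _)))) ⟩
    Σ n (λ r → Σ (suc e) (t r)) + Σ n (λ r → t r (suc e))
      ≡⟨ sym (Σ-+ n _ _) ⟩
    Σ n (λ r → Σ (suc e) (t r) + t r (suc e))
      ≡⟨ (Σ-cong n λ r _ → sym (trans (binomial r (suc e)) (Σ-last (suc e) (t r)))) ⟩
    Σ n (λ r → + (suc r ℕ.^ suc e))
      ≡⟨ sym (+-identityˡ _) ⟩
    Σ (suc n) (λ r → + (r ℕ.^ suc e))
      ≡⟨ Σ-last n (λ r → + (r ℕ.^ suc e)) ⟩
    powerSum n (suc e) + + (n ℕ.^ suc e) ∎)
    where
    open ≡-Reasoning
    t : ℕ → ℕ → ℤ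
    t r j = bin (suc e) j * + (r ℕ.^ j)

  -- In the expansion of Σ_{r<P} r^e by powers of P, the terms beyond P·B_e are divisible by p·P.
  module PowerSumBernoulli {p : ℕ} (pr : Prime p) (a : ℕ) where

    open InverseModPower p pr a

    private
      module ≈ₚ = Mod (+ p)
      instance
        p≢0 : NonZero p
        p≢0 = prime⇒nonZero pr

    -- The power sum is exactly P b, and b represents the Bernoulli number modulo p. An exact
    -- equation can be divided by P within the recurrence.
    Good : ℕ → ℤ → Set
    Good j b = powerSum P j ≡ + P * b × Reduces p (+ p) (bernoulli j) b

    good-0 : Good 0 1ℤ
    good-0 = Σ-const P 1ℤ , reduces-1 pr (+ p)

    -- Telescoping gives (n + 2) S = P (P^(n+1) - R) for the power sum S. As n + 2 < p is a unit, P
    -- divides S; after division the term P^(n+1) vanishes modulo p and the Bernoulli recurrence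
    -- remains.
    powerSum-divide : ∀ n → suc (suc n) ℕ.< p → (b : ℕ → ℤ) →
      (∀ j → j ℕ.< suc n → powerSum P j ≡ + P * b j) →
      ∃ λ x → powerSum P (suc n) ≡ + P * x ×
              - (u (suc (suc n)) * Σ (suc n) (λ j → bin (suc (suc n)) j * b j)) ≈ x [mod + p ]
    powerSum-divide n n<p b S≡Pb = conclude S≈0
      where
      open Mod (+ P)

      E : ℕ
      E = suc (suc n)

      p∤e : ¬ (p ∣ E)
      p∤e d = ℕₚ.<⇒≱ n<p (∣⇒≤ d)

      R S : ℤ
      R = Σ (suc n) (λ j → bin E j * b j)
      S = powerSum P (suc n)

      opaque
        unfolding _+_
        lem₁ : ∀ p b c → c * (p * b) ≡ p * (c * b)
        lem₁ = solve-∀ ring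
        lem₂ : ∀ E s p r → E * s ≡ p * r + E * s - p * r
        lem₂ = solve-∀ ring
        lem₃ : ∀ p q r → p * q - p * r ≡ (q - r) * p
        lem₃ = solve-∀ ring
        lem₄ : ∀ p x E → E * (p * x) ≡ (E * x) * p
        lem₄ = solve-∀ ring
        lem₅ : ∀ v e x → v * (e * x) ≡ (v * e) * x
        lem₅ = solve-∀ ring
        lem₆ : ∀ v q r → - (v * r) ≡ v * (q - r) - v * q
        lem₆ = solve-∀ ring
        lem₇ : ∀ x v → 1ℤ * x - v * 0ℤ ≡ x
        lem₇ = solve-∀ ring
        cancelP : ∀ {x y} → x * + P ≡ y * + P → x ≡ y
        cancelP {x} {y} = ℤₚ.*-cancelʳ-≡ x y (+ P)

      eC : bin E (suc n) ≡ + E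
      eC = trans (bin≡ E (suc n)) (cong +_ ([1+n]Cn≡1+n (suc n)))

      total : + P * R + + E * S ≡ + P * + (P ℕ.^ suc n)
      total = begin
        + P * R + + E * S
          ≡⟨ cong₂ _+_ (trans (sym (Σ-*ˡ (suc n) (+ P) (λ j → bin E j * b j))) (Σ-cong (suc n) λ j j< →
               trans (sym (lem₁ (+ P) (b j) (bin E j))) (cong (bin E j *_) (sym (S≡Pb j j<)))))
               (cong (_* S) (sym eC)) ⟩
        Σ (suc n) (λ j → bin E j * powerSum P j) + bin E (suc n) * S
          ≡⟨ sym (Σ-last (suc n) (λ j → bin E j * powerSum P j)) ⟩
        Σ E (λ j → bin E j * powerSum P j)
          ≡⟨ powerSum-telescope P (suc n) ⟩
        + (P ℕ.^ E)
          ≡⟨ pos-* P (P ℕ.^ suc n) ⟩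
        + P * + (P ℕ.^ suc n) ∎
        where open ≡-Reasoning

      eS≡ : + E * S ≡ (+ (P ℕ.^ suc n) - R) * + P
      eS≡ = trans (lem₂ (+ E) S (+ P) R) (trans (cong (_- + P * R) total) (lem₃ (+ P) (+ (P ℕ.^ suc n)) R))

      S≈0 : S ≈ 0ℤ
      S≈0 = *-cancel (u E) (+ E) (u-inverse p∤e) (≈-trans (≈-reflexive eS≡)
        (≈-trans (*M≈0 (+ (P ℕ.^ suc n) - R)) (≈-reflexive (sym (*-zeroʳ (+ E))))))

      conclude : S ≈ 0ℤ → ∃ λ x → S ≡ + P * x × - (u E * R) ≈ x [mod + p ]
      conclude (Mod.modulo x eq) = x , S≡ , ≈ₚ.≈-trans (≈ₚ.≈-reflexive (trans (lem₆ (u E) (+ (P ℕ.^ suc n)) R)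
          (cong (_- u E * + (P ℕ.^ suc n)) (trans (cong (u E *_) (sym ex≡)) (lem₅ (u E) (+ E) x)))))
        (≈ₚ.≈-trans (≈ₚ.+-cong (≈ₚ.*-congʳ x (P⇒p (u-inverse p∤e)))
           (≈ₚ.-‿cong (≈ₚ.*-congˡ (u E) (∣⇒≈0 (∣m⇒∣m*n (P ℕ.^ n) (m∣m*n Q))))))
          (≈ₚ.≈-reflexive (lem₇ x (u E))))
        where
        S≡ : S ≡ + P * x
        S≡ = trans eq (trans (+-identityˡ _) (*-comm x (+ P)))
        ex≡ : + E * x ≡ + (P ℕ.^ suc n) - R
        ex≡ = cancelP (trans (sym (lem₄ (+ P) x (+ E))) (trans (cong (+ E *_) (sym S≡)) eS≡))

    good-suc : ∀ n → suc (suc n) ℕ.< p → (b : ℕ → ℤ) → (∀ j → j ℕ.< suc n → Good j (b j)) → ∃ (Good (suc n))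
    good-suc n n<p b good = conclude (powerSum-divide n n<p b (λ j j< → proj₁ (good j j<)))
      where
      p∤e : ¬ (p ∣ suc (suc n))
      p∤e d = ℕₚ.<⇒≱ n<p (∣⇒≤ d)
      summand : ∀ j → j ℕ.< suc n →
        Reduces p (+ p) (ℕ→ℚ (suc (suc n) C j) ℚ.* bernoulli j) (bin (suc (suc n)) j * b j)
      summand j j< = reduces-* pr (+ p)
        (subst (Reduces p (+ p) (ℕ→ℚ (suc (suc n) C j))) (sym (bin≡ (suc (suc n)) j)) (reduces-ℕ pr (+ p) (suc (suc n) C j)))
        (proj₂ (good j j<))
      conclude : (∃ λ x → powerSum P (suc n) ≡ + P * x ×
                   - (u (suc (suc n)) * Σ (suc n) (λ j → bin (suc (suc n)) j * b j)) ≈ x [mod + p ]) → ∃ (Good (suc n))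
      conclude (x , S≡ , ≈x) = x , S≡ , reduces-≈ pr (+ p) ≈x (reduces-bernoulli-suc pr (+ p) n
        (u (suc (suc n))) (Σ (suc n) (λ j → bin (suc (suc n)) j * b j))
        (reduces-inv pr (+ p) (suc (suc n)) p∤e (P⇒p (u-inverse p∤e)))
        (reduces-Σ pr (+ p) (suc n) (λ i → ℕ→ℚ (suc (suc n) C i) ℚ.* bernoulli i) (λ j → bin (suc (suc n)) j * b j) summand))

    -- The recurrence refers to all earlier values, so they are gathered into one function that is
    -- extended by one point at a time.
    good-prefix : ∀ k → k ℕ.< p → ∃ λ (b : ℕ → ℤ) → ∀ j → j ℕ.< k → Good j (b j)
    good-prefix zero          _   = (λ _ → 0ℤ) , λ _ ()
    good-prefix (suc zero)    _   = (λ _ → 1ℤ) , λ { zero _ → good-0 ; (suc j) (s≤s ()) }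
    good-prefix (suc (suc n)) k<p = step (good-prefix (suc n) (ℕₚ.<⇒≤ k<p))
      where
      step : (∃ λ (b : ℕ → ℤ) → ∀ j → j ℕ.< suc n → Good j (b j)) →
             ∃ λ (b : ℕ → ℤ) → ∀ j → j ℕ.< suc (suc n) → Good j (b j)
      step (b , good) = extend-by (good-suc n k<p b good)
        where
        extend-by : ∃ (Good (suc n)) → ∃ λ (b : ℕ → ℤ) → ∀ j → j ℕ.< suc (suc n) → Good j (b j)
        extend-by (x , good-x) = (λ j → extend j (j ℕ.≟ suc n)) , λ j j< → extend-good j (j ℕ.≟ suc n) j<
          where
          extend : ∀ j → Dec (j ≡ suc n) → ℤ
          extend j (yes _) = x
          extend j (no _)  = b j
          extend-good : ∀ j (d : Dec (j ≡ suc n)) → j ℕ.< suc (suc n) → Good j (extend j d)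
          extend-good j (yes refl) _        = good-x
          extend-good j (no j≢)    (s≤s j≤) = good j (ℕₚ.≤∧≢⇒< j≤ j≢)

    powerSum-bernoulli : ∀ j → suc j ℕ.< p → ∃ (Good j)
    powerSum-bernoulli j j<p = let b , good = good-prefix (suc j) j<p in b j , good j ℕₚ.≤-refl

  -- Voronoi's congruence

  ^-distribʳ-* : ∀ e m n → (m ℕ.* n) ℕ.^ e ≡ m ℕ.^ e ℕ.* n ℕ.^ e
  ^-distribʳ-* zero    m n = refl
  ^-distribʳ-* (suc e) m n = trans (cong (m ℕ.* n ℕ.*_) (^-distribʳ-* e m n)) (interchange m n (m ℕ.^ e) (n ℕ.^ e))
    where
    interchange : ∀ a b c d → a ℕ.* b ℕ.* (c ℕ.* d) ≡ a ℕ.* c ℕ.* (b ℕ.* d)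
    interchange = ℕ-Solver.solve-∀

  module _ (M : ℤ) where
    open Mod M

    -- The binomial expansion stops after the linear term; y will be a multiple of P and the modulus
    -- P².
    power-expand : ∀ a y → + y * + y ≈ 0ℤ → ∀ d →
      + ((a ℕ.+ y) ℕ.^ suc d) ≈ + (a ℕ.^ suc d) + + suc d * + (a ℕ.^ d) * + y
    power-expand a y y²≈0 zero    = ≈-reflexive (trans (cong +_ (ℕₚ.*-identityʳ (a ℕ.+ y)))
      (trans (pos-+ a y) (cong₂ _+_ (cong +_ (sym (ℕₚ.*-identityʳ a))) (lem (+ y)))))
      where
      opaque
        unfolding _+_
        lem : ∀ y → y ≡ + 1 * + 1 * y
        lem = solve-∀ ring
    power-expand a y y²≈0 (suc d) = begin
      + ((a ℕ.+ y) ℕ.* (a ℕ.+ y) ℕ.^ suc d)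
        ≡⟨ trans (pos-* (a ℕ.+ y) ((a ℕ.+ y) ℕ.^ suc d)) (cong (_* + ((a ℕ.+ y) ℕ.^ suc d)) (pos-+ a y)) ⟩
      (+ a + + y) * + ((a ℕ.+ y) ℕ.^ suc d)
        ≈⟨ *-congˡ (+ a + + y) (power-expand a y y²≈0 d) ⟩
      (+ a + + y) * (+ (a ℕ.^ suc d) + + suc d * + (a ℕ.^ d) * + y)
        ≡⟨ cong (λ z → (+ a + + y) * (z + + suc d * + (a ℕ.^ d) * + y)) (pos-* a (a ℕ.^ d)) ⟩
      (+ a + + y) * (+ a * + (a ℕ.^ d) + + suc d * + (a ℕ.^ d) * + y)
        ≡⟨ lem (+ a) (+ y) (+ (a ℕ.^ d)) (+ suc d) ⟩
      + a * (+ a * + (a ℕ.^ d)) + (1ℤ + + suc d) * (+ a * + (a ℕ.^ d)) * + y + + suc d * + (a ℕ.^ d) * (+ y * + y)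
        ≈⟨ +-congˡ _ (*-congˡ (+ suc d * + (a ℕ.^ d)) y²≈0) ⟩
      + a * (+ a * + (a ℕ.^ d)) + (1ℤ + + suc d) * (+ a * + (a ℕ.^ d)) * + y + + suc d * + (a ℕ.^ d) * 0ℤ
        ≡⟨ trans (cong (_+_ (+ a * (+ a * + (a ℕ.^ d)) + (1ℤ + + suc d) * (+ a * + (a ℕ.^ d)) * + y)) (*-zeroʳ (+ suc d * + (a ℕ.^ d)))) (+-identityʳ _) ⟩
      + a * (+ a * + (a ℕ.^ d)) + (1ℤ + + suc d) * (+ a * + (a ℕ.^ d)) * + y
        ≡⟨ cong₂ _+_ (trans (cong (+ a *_) (sym (pos-* a (a ℕ.^ d)))) (sym (pos-* a (a ℕ.^ suc d))))
             (cong₂ (λ c z → c * z * + y) (sym (pos-+ 1 (suc d))) (sym (pos-* a (a ℕ.^ d)))) ⟩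
      + (a ℕ.^ suc (suc d)) + + suc (suc d) * + (a ℕ.^ suc d) * + y ∎
      where
      open ≈-Reasoning
      opaque
        unfolding _+_
        lem : ∀ a y x c → (a + y) * (a * x + c * x * y) ≡ a * (a * x) + (1ℤ + c) * (a * x) * y + c * x * (y * y)
        lem = solve-∀ ring

    ^-cong : ∀ {a b} → + a ≈ + b → ∀ d → + (a ℕ.^ d) ≈ + (b ℕ.^ d)
    ^-cong a≈b zero    = ≈-refl
    ^-cong {a} {b} a≈b (suc d) = ≈-trans (≈-reflexive (pos-* a (a ℕ.^ d)))
      (≈-trans (*-cong a≈b (^-cong a≈b d)) (≈-reflexive (sym (pos-* b (b ℕ.^ d)))))

  -- Voronoi's congruence: expand (r m)^(p-3) around the residue of r m modulo P and sum over r < P.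
  module Voronoi (c : ℕ) (pr : Prime (5 ℕ.+ c)) (a : ℕ) where

    private
      -- Here d = p - 4 and e = p - 3: the exponent d represents inverse cubes modulo p, and e is
      -- the index of the Bernoulli number.
      p d e : ℕ
      p = 5 ℕ.+ c
      d = suc c
      e = suc d

    open InverseModPower p pr a

    private
      module ≈ₚ = Mod (+ p)

      u³ : ℕ → ℤ
      u³ r = u r * u r * u r

    cube-* : ∀ m n → + (m ℕ.* (m ℕ.* (m ℕ.* n))) ≡ + m * + m * + m * + n
    cube-* m n = trans (pos-* m _) (trans (cong (+ m *_) (trans (pos-* m _) (cong (+ m *_) (pos-* m n)))) (lem (+ m) (+ n)))
      where
      opaque
        unfolding _+_
        lem : ∀ m n → m * (m * (m * n)) ≡ m * m * m * n
        lem = solve-∀ ring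

    m³m^d≈1 : ∀ m → ¬ (p ∣ m) → + m * + m * + m * + (m ℕ.^ d) ≈ 1ℤ [mod + p ]
    m³m^d≈1 m p∤m = ≈ₚ.*-cancel (u m) (+ m) (P⇒p (u-inverse p∤m)) (≈ₚ.≈-trans
      (≈ₚ.≈-reflexive (trans (cong (+ m *_) (sym (cube-* m (m ℕ.^ d)))) (sym (pos-* m _))))
      (≈ₚ.≈-trans (fermat pr m) (≈ₚ.≈-reflexive (sym (trans (*-comm (+ m) 1ℤ) (*-identityˡ (+ m)))))))

    -- For p not dividing r, Fermat gives r³ r^(p-4) ≡ 1. For p dividing r both sides vanish, the
    -- left one because p - 4 is positive.
    u³≈ : ∀ r → + (r ℕ.^ d) ≈ u³ r [mod + p ]
    u³≈ r = by-cases (p ∣? r)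
      where
      opaque
        unfolding _+_
        zero³ : 0ℤ ≡ 0ℤ * 0ℤ * 0ℤ
        zero³ = refl
        lem₁ : ∀ u r → (u * r) * (u * r) * (u * r) ≡ (u * u * u) * (r * r * r)
        lem₁ = solve-∀ ring
        one³ : 1ℤ * 1ℤ * 1ℤ ≡ 1ℤ
        one³ = refl
      by-cases : Dec (p ∣ r) → + (r ℕ.^ d) ≈ u³ r [mod + p ]
      by-cases (yes p∣r) = ≈ₚ.≈-trans (∣⇒≈0 (∣m⇒∣m*n (r ℕ.^ c) p∣r))
        (≈ₚ.≈-reflexive (trans zero³ (cong (λ z → z * z * z) (sym (u-zero p∣r)))))
      by-cases (no p∤r) = inverse-unique (+ p)
        (≈ₚ.≈-trans (≈ₚ.≈-reflexive (*-comm (+ (r ℕ.^ d)) (+ r * + r * + r))) (m³m^d≈1 r p∤r))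
        (≈ₚ.≈-trans (≈ₚ.≈-reflexive (sym (lem₁ (u r) (+ r))))
          (≈ₚ.≈-trans (≈ₚ.*-cong (≈ₚ.*-cong i i) i) (≈ₚ.≈-reflexive one³)))
        where
        i : u r * + r ≈ 1ℤ [mod + p ]
        i = P⇒p (u-inverse p∤r)

    module _ (b : ℤ) (S≡Pb : powerSum P e ≡ + P * b) (m m′ l : ℕ) (m-inverse : m ℕ.* m′ ≡ 1 ℕ.+ l ℕ.* P) where

      private
        F ρ : ℕ → ℕ
        F r = r ℕ.* m / P
        ρ r = r ℕ.* m % P

        Y Λ : ℤ
        Y = Σ P (λ r → + F r * + (ρ r ℕ.^ d))
        Λ = Σ P (λ r → + F r * u³ r)

      p∤m : ¬ (p ∣ m)
      p∤m p∣m = ℕₚ.<⇒≱ (s≤s (s≤s z≤n)) (∣⇒≤ (∣m+n∣m⇒∣n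
        (subst (p ∣_) (trans m-inverse (ℕₚ.+-comm 1 (l ℕ.* P))) (∣m⇒∣m*n m′ p∣m))
        (∣n⇒∣m*n l (m∣m*n Q))))

      -- The leading terms give the same power sum again, since the remainders of r m permute the
      -- residues. Both sides are multiples of P, so modulus P² leaves a congruence modulo P after
      -- division.
      expanded : + P * (+ (m ℕ.^ e) * b) ≈ + P * (b + + e * Y) [mod + (P ℕ.* P) ]
      expanded = begin
        + P * (+ (m ℕ.^ e) * b)
          ≡⟨ trans (lem₁ (+ P) (+ (m ℕ.^ e)) b) (cong (+ (m ℕ.^ e) *_) (sym S≡Pb)) ⟩
        + (m ℕ.^ e) * powerSum P e
          ≡⟨ trans (sym (Σ-*ˡ P (+ (m ℕ.^ e)) (λ r → + (r ℕ.^ e)))) (Σ-cong P λ r _ →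
               trans (*-comm (+ (m ℕ.^ e)) (+ (r ℕ.^ e))) (trans (sym (pos-* (r ℕ.^ e) (m ℕ.^ e)))
                 (cong +_ (sym (^-distribʳ-* e r m))))) ⟩
        Σ P (λ r → + ((r ℕ.* m) ℕ.^ e))
          ≈⟨ Σ-cong≈ (+ (P ℕ.* P)) P (λ r _ → ≈-trans
               (≈-reflexive (cong (λ z → + (z ℕ.^ e)) (m≡m%n+[m/n]*n (r ℕ.* m) P)))
               (power-expand (+ (P ℕ.* P)) (ρ r) (F r ℕ.* P) (square r) d)) ⟩
        Σ P (λ r → + (ρ r ℕ.^ e) + + e * + (ρ r ℕ.^ d) * + (F r ℕ.* P))
          ≡⟨ trans (Σ-+ P (λ r → + (ρ r ℕ.^ e)) (λ r → + e * + (ρ r ℕ.^ d) * + (F r ℕ.* P)))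
               (cong₂ _+_ (trans (Σ-multiply P m m′ l m-inverse (λ r → + (r ℕ.^ e))) S≡Pb)
                 (trans (Σ-cong P λ r _ → trans (cong (+ e * + (ρ r ℕ.^ d) *_) (pos-* (F r) P))
                          (lem₂ (+ e) (+ (ρ r ℕ.^ d)) (+ F r) (+ P)))
                   (Σ-*ˡ P (+ P * + e) (λ r → + F r * + (ρ r ℕ.^ d))))) ⟩
        + P * b + + P * + e * Y
          ≡⟨ lem₃ (+ P) b (+ e) Y ⟩
        + P * (b + + e * Y) ∎
        where
        open Mod (+ (P ℕ.* P))
        open ≈-Reasoning
        opaque
          unfolding _+_
          lem₁ : ∀ p m b → p * (m * b) ≡ m * (p * b)
          lem₁ = solve-∀ ring
          lem₂ : ∀ e x f p → e * x * (f * p) ≡ p * e * (f * x)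
          lem₂ = solve-∀ ring
          lem₃ : ∀ p b e y → p * b + p * e * y ≡ p * (b + e * y)
          lem₃ = solve-∀ ring
          lem₄ : ∀ f p → (f * p) * (f * p) ≡ f * f * (p * p)
          lem₄ = solve-∀ ring
        square : ∀ r → + (F r ℕ.* P) * + (F r ℕ.* P) ≈ 0ℤ
        square r = ≈-trans (≈-reflexive (trans (cong₂ _*_ (pos-* (F r) P) (pos-* (F r) P))
          (trans (lem₄ (+ F r) (+ P)) (cong (+ F r * + F r *_) (sym (pos-* P P)))))) (*M≈0 (+ F r * + F r))

      Y≈ : Y ≈ + (m ℕ.^ d) * Λ [mod + p ]
      Y≈ = begin
        Y
          ≈⟨ Σ-cong≈ (+ p) P (λ r _ → *-congˡ (+ F r) (≈-trans (^-cong (+ p) (P⇒p (%≈ (r ℕ.* m) P)) d)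
               (≈-trans (≈-reflexive (trans (cong +_ (^-distribʳ-* d r m)) (pos-* (r ℕ.^ d) (m ℕ.^ d))))
                 (*-congʳ (+ (m ℕ.^ d)) (u³≈ r))))) ⟩
        Σ P (λ r → + F r * (u³ r * + (m ℕ.^ d)))
          ≡⟨ trans (Σ-cong P λ r _ → lem (+ F r) (u³ r) (+ (m ℕ.^ d))) (Σ-*ˡ P (+ (m ℕ.^ d)) (λ r → + F r * u³ r)) ⟩
        + (m ℕ.^ d) * Λ ∎
        where
        open ≈ₚ
        open ≈-Reasoning
        opaque
          unfolding _+_
          lem : ∀ f x y → f * (x * y) ≡ y * (f * x)
          lem = solve-∀ ring

      -- Multiplying by m³ turns m^(p-3) into m^p ≡ m and m^(p-4) into 1, and the exponent p - 3
      -- appears as the coefficient -3.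
      voronoi : + 3 * Λ ≈ (+ m * + m * + m - + m) * b [mod + p ]
      voronoi = begin
        + 3 * Λ
          ≈⟨ ≈-sym (≈-trans (+-congʳ (+ 3 * Λ) difference) (≈-reflexive (+-identityˡ (+ 3 * Λ)))) ⟩
        (m³ * (b + + e * (+ (m ℕ.^ d) * Λ)) - + m * b) + + 3 * Λ
          ≡⟨ lem₁ m³ b (+ e) (+ (m ℕ.^ d)) Λ (+ m) ⟩
        (m³ - + m) * b + + e * (m³ * + (m ℕ.^ d)) * Λ + + 3 * Λ
          ≈⟨ +-congʳ (+ 3 * Λ) (+-congˡ ((m³ - + m) * b) (*-congʳ Λ (*-congˡ (+ e) (m³m^d≈1 m p∤m)))) ⟩
        (m³ - + m) * b + + e * 1ℤ * Λ + + 3 * Λ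
          ≡⟨ lem₂ ((m³ - + m) * b) (+ e) Λ ⟩
        (m³ - + m) * b + (+ 3 + + e) * Λ
          ≈⟨ +-congˡ ((m³ - + m) * b) (*-congʳ Λ (≈-trans (≈-reflexive (sym (pos-+ 3 e))) (∣⇒≈0 ∣-refl))) ⟩
        (m³ - + m) * b + 0ℤ * Λ
          ≡⟨ trans (cong (_+_ ((m³ - + m) * b)) (*-zeroˡ Λ)) (+-identityʳ _) ⟩
        (m³ - + m) * b ∎
        where
        open ≈ₚ
        open ≈-Reasoning
        m³ : ℤ
        m³ = + m * + m * + m
        opaque
          unfolding _+_
          lem₁ : ∀ m³ b e x Λ m → (m³ * (b + e * (x * Λ)) - m * b) + + 3 * Λ ≡ (m³ - m) * b + e * (m³ * x) * Λ + + 3 * Λ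
          lem₁ = solve-∀ ring
          lem₂ : ∀ x e Λ → x + e * 1ℤ * Λ + + 3 * Λ ≡ x + (+ 3 + e) * Λ
          lem₂ = solve-∀ ring
          self : ∀ x → x - x ≡ 0ℤ
          self = solve-∀ ring
        difference : m³ * (b + + e * (+ (m ℕ.^ d) * Λ)) - + m * b ≈ 0ℤ
        difference = ≈-trans (+-congʳ (- (+ m * b)) (begin
          m³ * (b + + e * (+ (m ℕ.^ d) * Λ))
            ≈⟨ *-congˡ m³ (+-congˡ b (*-congˡ (+ e) (≈-sym Y≈))) ⟩
          m³ * (b + + e * Y)
            ≈⟨ *-congˡ m³ (≈-sym (P⇒p (unscale P expanded))) ⟩
          m³ * (+ (m ℕ.^ e) * b)
            ≡⟨ trans (sym (*-assoc m³ (+ (m ℕ.^ e)) b)) (cong (_* b) (sym (cube-* m (m ℕ.^ e)))) ⟩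
          + (m ℕ.^ p) * b
            ≈⟨ *-congʳ b (fermat pr m) ⟩
          + m * b ∎)) (≈-reflexive (self (+ m * b)))

  -- Keeping the factor 3 on the left gives a form that includes p = 3.
  Λ-bernoulli : ∀ {p} (pr : Prime p) a → ¬ (2 ∣ p) → let open InverseModPower p pr a in
    ∃ λ b → Reduces p (+ p) (bernoulli (p ℕ.∸ 3)) b ×
      (∀ m m′ l → m ℕ.* m′ ≡ 1 ℕ.+ l ℕ.* P →
        + 3 * Σ P (λ r → + (r ℕ.* m / P) * (u r * u r * u r)) ≈ (+ m * + m * + m - + m) * b [mod + p ])
  Λ-bernoulli {0} pr a odd = ⊥-elim (¬prime[0] pr)
  Λ-bernoulli {1} pr a odd = ⊥-elim (¬prime[1] pr)
  Λ-bernoulli {2} pr a odd = ⊥-elim (odd ∣-refl)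
  -- Here the Bernoulli number is B_0 = 1, and both sides vanish modulo 3, the right one by Fermat's
  -- congruence.
  Λ-bernoulli {3} pr a odd = 1ℤ , reduces-1 pr (+ 3) , λ m _ _ _ → begin
      + 3 * Σ P (λ r → + (r ℕ.* m / P) * (u r * u r * u r))  ≈⟨ *-congʳ _ (∣⇒≈0 {3} ∣-refl) ⟩
      0ℤ * Σ P (λ r → + (r ℕ.* m / P) * (u r * u r * u r))   ≡⟨ trans (*-zeroˡ _) (zero-form (+ m)) ⟩
      (+ m - + m) * 1ℤ                                       ≈⟨ *-congʳ 1ℤ (+-congʳ (- + m) (≈-sym (fermat pr m))) ⟩
      (+ (m ℕ.^ 3) - + m) * 1ℤ                               ≡⟨ cong (λ z → (z - + m) * 1ℤ) (cube m) ⟩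
      (+ m * + m * + m - + m) * 1ℤ                           ∎
    where
    open InverseModPower 3 pr a
    open Mod (+ 3)
    open ≈-Reasoning
    opaque
      unfolding _+_
      zero-form : ∀ m → 0ℤ ≡ (m - m) * 1ℤ
      zero-form = solve-∀ ring
      rearrange : ∀ m → m * (m * (m * 1ℤ)) ≡ m * m * m
      rearrange = solve-∀ ring
    cube : ∀ m → + (m ℕ.^ 3) ≡ + m * + m * + m
    cube m = trans (pos-* m _) (trans (cong (+ m *_) (trans (pos-* m _) (cong (+ m *_) (pos-* m 1)))) (rearrange (+ m)))
  Λ-bernoulli {4} pr a odd = ⊥-elim (odd (divides 2 refl))
  Λ-bernoulli {suc (suc (suc (suc (suc c))))} pr a odd =
    let b , S≡Pb , B≈b = PowerSumBernoulli.powerSum-bernoulli pr a (suc (suc c)) (s≤s (s≤s (s≤s (s≤s (ℕₚ.n≤1+n c)))))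
    in b , B≈b , λ m m′ l m-inverse → Voronoi.voronoi c pr a b S≡Pb m m′ l m-inverse

  -- The sums of the statement

  sumℤ : List ℤ → ℤ
  sumℤ = foldr _+_ 0ℤ

  sumℤ-++ : ∀ xs ys → sumℤ (xs ++ ys) ≡ sumℤ xs + sumℤ ys
  sumℤ-++ []       ys = sym (+-identityˡ _)
  sumℤ-++ (x ∷ xs) ys = trans (cong (_+_ x) (sumℤ-++ xs ys)) (sym (+-assoc x _ _))

  sumℤ-concatMap : ∀ {A B : Set} (w : B → ℤ) (F : A → List B) xs →
                   sumℤ (map w (concatMap F xs)) ≡ sumℤ (map (λ x → sumℤ (map w (F x))) xs)
  sumℤ-concatMap w F []       = refl
  sumℤ-concatMap w F (x ∷ xs) = trans (cong sumℤ (map-++ w (F x) (concatMap F xs)))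
    (trans (sumℤ-++ (map w (F x)) _) (cong (_+_ (sumℤ (map w (F x)))) (sumℤ-concatMap w F xs)))

  sumℤ-applyUpTo : ∀ (f : ℕ → ℕ) (g : ℕ → ℤ) N → sumℤ (map g (applyUpTo f N)) ≡ Σ N (g ∘ f)
  sumℤ-applyUpTo f g zero    = refl
  sumℤ-applyUpTo f g (suc N) = cong (_+_ (g (f 0))) (sumℤ-applyUpTo (f ∘ suc) g N)

  sumℤ-cube : ∀ N (w : ℕ × ℕ × ℕ → ℤ) → let pos = applyUpTo suc N in
    sumℤ (map w (concatMap (λ i → concatMap (λ j → map (λ k → (i , j , k)) pos) pos) pos)) ≡
    Σ N (λ i → Σ N λ j → Σ N λ k → w (suc i , suc j , suc k))
  sumℤ-cube N w = trans (sumℤ-concatMap w _ pos) (trans (sumℤ-applyUpTo suc (λ i → sumℤ (map w (row i))) N)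
    (Σ-cong N λ i _ → trans (sumℤ-concatMap w _ pos) (trans (sumℤ-applyUpTo suc (λ j → sumℤ (map w (line (suc i) j))) N)
      (Σ-cong N λ j _ → trans (cong sumℤ (sym (map-∘ pos))) (sumℤ-applyUpTo suc (λ k → w (suc i , suc j , k)) N)))))
    where
    pos : List ℕ
    pos = applyUpTo suc N
    line : ℕ → ℕ → List (ℕ × ℕ × ℕ)
    line i j = map (λ k → (i , j , k)) pos
    row : ℕ → List (ℕ × ℕ × ℕ)
    row i = concatMap (line i) pos

  module _ {p : ℕ} (pr : Prime p) (M : ℤ) where

    open Mod M

    -- Rejected entries stay in the integer sum with weight 0, so the list of triples becomes a sum
    -- over a full box.
    reduces-filter : ∀ {A : Set} (b : A → Bool) (h : A → ℚ) (w : A → ℤ) xs →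
      (∀ x → b x ≡ true → Reduces p M (h x) (w x)) → (∀ x → b x ≡ false → w x ≡ 0ℤ) →
      Reduces p M (sumℚ (map h (filterᵇ b xs))) (sumℤ (map w xs))
    reduces-filter b h w []       yes′ no′ = reduces-0 pr M
    reduces-filter b h w (x ∷ xs) yes′ no′ with b x in eq
    ... | true  = reduces-+ pr M (yes′ x eq) (reduces-filter b h w xs yes′ no′)
    ... | false = subst (Reduces p M (sumℚ (map h (filterᵇ b xs))))
      (sym (trans (cong (_+ sumℤ (map w xs)) (no′ x eq)) (+-identityˡ _))) (reduces-filter b h w xs yes′ no′)

    module _ (m N : ℕ) (f : ℕ → ℤ)
      (f-unit    : ∀ i → inP m i ≡ true → ¬ (p ∣ i) × f i * + i ≈ 1ℤ)
      (f-nonunit : ∀ i → inP m i ≡ false → f i ≡ 0ℤ)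
      (f-0 : f 0 ≡ 0ℤ) (f-N : f N ≡ 0ℤ)
      where

      private
        Unit : ℕ → Set
        Unit i = ¬ (p ∣ i) × f i * + i ≈ 1ℤ

        fff : ℕ → ℕ → ℕ → ℤ
        fff = prod f f f

      triples-sum : (w : ℕ → ℤ) → ℤ
      triples-sum w = Σ N (λ i → Σ N λ j → Σ N λ k →
        δ (suc i ℕ.+ suc j ℕ.+ suc k) N * (w (suc i) * fff (suc i) (suc j) (suc k)))

      -- The listed indices run from 1 to N, those of `tri` from 0 to N - 1; each coordinate is
      -- rotated, since `f` vanishes at both 0 and N.
      triples-sum≡tri : ∀ w → triples-sum w ≡ tri N N (λ i j k → w i * fff i j k)
      triples-sum≡tri w = begin
        triples-sum w
          ≡⟨ (Σ-cong N λ i _ → Σ-cong N λ j _ → Σ-rotate N (λ k → F (suc i) (suc j) k) (trans (F₃ _ _ f-0) (sym (F₃ _ _ f-N)))) ⟩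
        Σ N (λ i → Σ N λ j → Σ N λ k → F (suc i) (suc j) k)
          ≡⟨ (Σ-cong N λ i _ → Σ-rotate N (λ j → Σ N λ k → F (suc i) j k)
               (trans (Σ-zero N λ k _ → F₂ _ _ f-0) (sym (Σ-zero N λ k _ → F₂ _ _ f-N)))) ⟩
        Σ N (λ i → Σ N λ j → Σ N λ k → F (suc i) j k)
          ≡⟨ Σ-rotate N (λ i → Σ N λ j → Σ N λ k → F i j k)
               (trans (Σ-zero N λ j _ → Σ-zero N λ k _ → F₁ _ _ f-0) (sym (Σ-zero N λ j _ → Σ-zero N λ k _ → F₁ _ _ f-N))) ⟩
        tri N N (λ i j k → w i * fff i j k) ∎
        where
        open ≡-Reasoning
        F : ℕ → ℕ → ℕ → ℤ
        F i j k = δ (i ℕ.+ j ℕ.+ k) N * (w i * fff i j k)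
        opaque
          unfolding _+_
          z₁ : ∀ d w x y → d * (w * (0ℤ * x * y)) ≡ 0ℤ
          z₁ = solve-∀ ring
          z₂ : ∀ d w x y → d * (w * (x * 0ℤ * y)) ≡ 0ℤ
          z₂ = solve-∀ ring
          z₃ : ∀ d w x y → d * (w * (x * y * 0ℤ)) ≡ 0ℤ
          z₃ = solve-∀ ring
        F₁ : ∀ {i} j k → f i ≡ 0ℤ → F i j k ≡ 0ℤ
        F₁ {i} j k e = trans (cong (λ z → δ (i ℕ.+ j ℕ.+ k) N * (w i * (z * f j * f k))) e) (z₁ (δ (i ℕ.+ j ℕ.+ k) N) (w i) (f j) (f k))
        F₂ : ∀ i {j} k → f j ≡ 0ℤ → F i j k ≡ 0ℤ
        F₂ i {j} k e = trans (cong (λ z → δ (i ℕ.+ j ℕ.+ k) N * (w i * (f i * z * f k))) e) (z₂ (δ (i ℕ.+ j ℕ.+ k) N) (w i) (f i) (f k))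
        F₃ : ∀ i j {k} → f k ≡ 0ℤ → F i j k ≡ 0ℤ
        F₃ i j {k} e = trans (cong (λ z → δ (i ℕ.+ j ℕ.+ k) N * (w i * (f i * f j * z))) e) (z₃ (δ (i ℕ.+ j ℕ.+ k) N) (w i) (f i) (f j))

      reduces-triples : (h : ℕ × ℕ × ℕ → ℚ) (w : ℕ → ℤ) →
        (∀ i j k → Unit i → Unit j → Unit k → Reduces p M (h (i , j , k)) (w i * fff i j k)) →
        Reduces p M (sumℚ (map h (triples m N))) (tri N N (λ i j k → w i * fff i j k))
      reduces-triples h w h-reduces = subst (Reduces p M (sumℚ (map h (triples m N))))
        (trans (sumℤ-cube N w′) (triples-sum≡tri w))
        (reduces-filter _ h w′ (concatMap (λ i → concatMap (λ j → map (λ k → (i , j , k)) pos) pos) pos) (λ { (i , j , k) → accepted i j k }) (λ { (i , j , k) → rejected i j k }))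
        where
        pos : List ℕ
        pos = applyUpTo suc N

        w′ : ℕ × ℕ × ℕ → ℤ
        w′ (i , j , k) = δ (i ℕ.+ j ℕ.+ k) N * (w i * fff i j k)

        accepted : ∀ i j k → ((i ℕ.+ j ℕ.+ k) ℕ.≡ᵇ N) ∧ inP m i ∧ inP m j ∧ inP m k ≡ true →
                   Reduces p M (h (i , j , k)) (w′ (i , j , k))
        accepted i j k eq with (i ℕ.+ j ℕ.+ k) ℕ.≡ᵇ N | inP m i in ei | inP m j in ej | inP m k in ek
        ... | true | true | true | true = subst (Reduces p M (h (i , j , k))) (sym (*-identityˡ _))
          (h-reduces i j k (f-unit i ei) (f-unit j ej) (f-unit k ek))

        rejected : ∀ i j k → ((i ℕ.+ j ℕ.+ k) ℕ.≡ᵇ N) ∧ inP m i ∧ inP m j ∧ inP m k ≡ false → w′ (i , j , k) ≡ 0ℤ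
        rejected i j k eq with (i ℕ.+ j ℕ.+ k) ℕ.≡ᵇ N | inP m i in ei | inP m j in ej | inP m k in ek
        ... | false | _     | _     | _     = *-zeroˡ _
        ... | true  | false | _     | _     = trans (cong (λ z → 1ℤ * (w i * (z * f j * f k))) (f-nonunit i ei)) (z₁ (w i) (f j) (f k))
          where
          opaque
            unfolding _+_
            z₁ : ∀ w x y → 1ℤ * (w * (0ℤ * x * y)) ≡ 0ℤ
            z₁ = solve-∀ ring
        ... | true  | true  | false | _     = trans (cong (λ z → 1ℤ * (w i * (f i * z * f k))) (f-nonunit j ej)) (z₂ (w i) (f i) (f k))
          where
          opaque
            unfolding _+_
            z₂ : ∀ w x y → 1ℤ * (w * (x * 0ℤ * y)) ≡ 0ℤ
            z₂ = solve-∀ ring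
        ... | true  | true  | true  | false = trans (cong (λ z → 1ℤ * (w i * (f i * f j * z))) (f-nonunit k ek)) (z₃ (w i) (f i) (f j))
          where
          opaque
            unfolding _+_
            z₃ : ∀ w x y → 1ℤ * (w * (x * y * 0ℤ)) ≡ 0ℤ
            z₃ = solve-∀ ring

      reduces-inv-product : ∀ i j k → Unit i → Unit j → Unit k → Reduces p M (inv (i ℕ.* j ℕ.* k)) (fff i j k)
      reduces-inv-product i j k (p∤i , fi) (p∤j , fj) (p∤k , fk) = reduces-inv pr M (i ℕ.* j ℕ.* k)
        (λ d → [ (λ d′ → [ p∤i , p∤j ]′ (euclidsLemma i j pr d′)) , p∤k ]′ (euclidsLemma (i ℕ.* j) k pr d))
        (≈-trans (≈-reflexive (trans (cong (fff i j k *_) (trans (pos-* (i ℕ.* j) k) (cong (_* + k) (pos-* i j))))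
            (regroup (f i) (f j) (f k) (+ i) (+ j) (+ k))))
          (≈-trans (*-cong (*-cong fi fj) fk) (≈-reflexive one)))
        where
        opaque
          unfolding _+_
          regroup : ∀ a b c x y z → a * b * c * (x * y * z) ≡ (a * x) * (b * y) * (c * z)
          regroup = solve-∀ ring
          one : 1ℤ * 1ℤ * 1ℤ ≡ 1ℤ
          one = refl

      reduces-sign : ∀ i → Reduces p M (sign i) (sgn i)
      reduces-sign zero          = subst (Reduces p M 1ℚ) one (reduces-1 pr M)
        where
        opaque
          unfolding _+_
          one : 1ℤ ≡ sgn 0
          one = refl
      reduces-sign (suc zero)    = subst (Reduces p M (ℚ.- 1ℚ)) -one (reduces-neg pr M (reduces-1 pr M))
        where
        opaque
          unfolding _+_
          -one : - 1ℤ ≡ sgn 1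
          -one = refl
      reduces-sign (suc (suc i)) = reduces-sign i

      reduces-altSum : Reduces p M (altSum m N) (tri N N (λ i j k → sgn i * fff i j k))
      reduces-altSum = reduces-triples _ sgn λ i j k ui uj uk →
        reduces-* pr M (reduces-sign i) (reduces-inv-product i j k ui uj uk)

      reduces-tripleSum : Reduces p M (sumℚ (map (λ { (i , j , k) → inv (i ℕ.* j ℕ.* k) }) (triples m N))) (tri N N fff)
      reduces-tripleSum = subst (Reduces p M _) (tri-cong N N λ i j k _ → *-identityˡ (fff i j k))
        (reduces-triples _ (λ _ → 1ℤ) λ i j k ui uj uk →
          subst (Reduces p M _) (sym (*-identityˡ (fff i j k))) (reduces-inv-product i j k ui uj uk))

  -- First-order expansions of reciprocals

  module Reciprocal (M : ℤ) (S : ℕ → Set) (S? : ∀ i → Dec (S i)) (f : ℕ → ℤ)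
    (f-out : ∀ {i} → ¬ S i → f i ≡ 0ℤ)
    (f-in  : ∀ {i} → S i → f i * + i ≈ 1ℤ [mod M ])
    where

    open Mod M

    private
      opaque
        unfolding _+_
        zero-shift : ∀ n → 0ℤ ≡ 0ℤ - n * (0ℤ * 0ℤ)
        zero-shift = solve-∀ ring
        zero-refl : ∀ n → 0ℤ ≡ - 0ℤ - n * (0ℤ * 0ℤ)
        zero-refl = solve-∀ ring
        shift : ∀ f n i → (f - n * (f * f)) * (n + i) ≡ f * i + f * n * (1ℤ - f * i) - n * n * (f * f)
        shift = solve-∀ ring
        reflect : ∀ f n i i′ → (- f - n * (f * f)) * i′ ≡ f * i - f * n * (1ℤ - f * i) - n * n * (f * f) - (f + n * (f * f)) * (i′ + i - n)
        reflect = solve-∀ ring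
        last₁ : ∀ x y → 1ℤ + x * (1ℤ - 1ℤ) - 0ℤ * y ≡ 1ℤ
        last₁ = solve-∀ ring
        last₂ : ∀ x y z n → 1ℤ - x * (1ℤ - 1ℤ) - 0ℤ * y - z * (n - n) ≡ 1ℤ
        last₂ = solve-∀ ring
        double : ∀ f i → + 2 * f * i ≡ f * (i * + 2)
        double = solve-∀ ring

    -- Two terms of the geometric series for 1/(n + i): multiplied by n + i they give 1 up to a
    -- multiple of n².
    f-shift : ∀ n i → + n * + n ≈ 0ℤ → (S (n ℕ.+ i) → S i) → (S i → S (n ℕ.+ i)) →
              f (n ℕ.+ i) ≈ f i - + n * (f i * f i)
    f-shift n i n²≈0 to from with S? i
    ... | no ¬s = ≈-reflexive (trans (f-out (¬s ∘ to)) (trans (zero-shift (+ n)) (cong (λ z → z - + n * (z * z)) (sym (f-out ¬s)))))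
    ... | yes s = inverse-unique M (f-in (from s)) (begin
      (f i - + n * (f i * f i)) * + (n ℕ.+ i)
        ≡⟨ trans (cong ((f i - + n * (f i * f i)) *_) (pos-+ n i)) (shift (f i) (+ n) (+ i)) ⟩
      f i * + i + f i * + n * (1ℤ - f i * + i) - + n * + n * (f i * f i)
        ≈⟨ +-cong (+-cong (f-in s) (*-congˡ (f i * + n) (+-congˡ 1ℤ (-‿cong (f-in s))))) (-‿cong (*-congʳ (f i * f i) n²≈0)) ⟩
      1ℤ + f i * + n * (1ℤ - 1ℤ) - 0ℤ * (f i * f i)
        ≡⟨ last₁ (f i * + n) (f i * f i) ⟩
      1ℤ ∎)
      where open ≈-Reasoning

    f-refl : ∀ n i → i ℕ.< n → + n * + n ≈ 0ℤ → (S (n ℕ.∸ i) → S i) → (S i → S (n ℕ.∸ i)) →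
             f (n ℕ.∸ i) ≈ - f i - + n * (f i * f i)
    f-refl n i i<n n²≈0 to from with S? i
    ... | no ¬s = ≈-reflexive (trans (f-out (¬s ∘ to)) (trans (zero-refl (+ n)) (cong (λ z → - z - + n * (z * z)) (sym (f-out ¬s)))))
    ... | yes s = inverse-unique M (f-in (from s)) (begin
      (- f i - + n * (f i * f i)) * + (n ℕ.∸ i)
        ≡⟨ reflect (f i) (+ n) (+ i) (+ (n ℕ.∸ i)) ⟩
      f i * + i - f i * + n * (1ℤ - f i * + i) - + n * + n * (f i * f i) - (f i + + n * (f i * f i)) * (+ (n ℕ.∸ i) + + i - + n)
        ≡⟨ cong (λ z → f i * + i - f i * + n * (1ℤ - f i * + i) - + n * + n * (f i * f i) - (f i + + n * (f i * f i)) * (z - + n))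
             (trans (sym (pos-+ (n ℕ.∸ i) i)) (cong +_ (ℕₚ.m∸n+n≡m (ℕₚ.<⇒≤ i<n)))) ⟩
      f i * + i - f i * + n * (1ℤ - f i * + i) - + n * + n * (f i * f i) - (f i + + n * (f i * f i)) * (+ n - + n)
        ≈⟨ +-congʳ _ (+-cong (+-cong (f-in s) (-‿cong (*-congˡ (f i * + n) (+-congˡ 1ℤ (-‿cong (f-in s)))))) (-‿cong (*-congʳ (f i * f i) n²≈0))) ⟩
      1ℤ - f i * + n * (1ℤ - 1ℤ) - 0ℤ * (f i * f i) - (f i + + n * (f i * f i)) * (+ n - + n)
        ≡⟨ last₂ (f i * + n) (f i * f i) (f i + + n * (f i * f i)) (+ n) ⟩
      1ℤ ∎)
      where open ≈-Reasoning

    f-double : ∀ i → (S (i ℕ.* 2) → S i) → (S i → S (i ℕ.* 2)) → + 2 * f (i ℕ.* 2) ≈ f i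
    f-double i to from with S? i
    ... | no ¬s = ≈-reflexive (trans (cong (+ 2 *_) (f-out (¬s ∘ to))) (trans (*-zeroʳ (+ 2)) (sym (f-out ¬s))))
    ... | yes s = inverse-unique M (≈-trans (≈-reflexive (trans (double (f (i ℕ.* 2)) (+ i)) (cong (f (i ℕ.* 2) *_) (sym (pos-* i 2))))) (f-in (from s))) (f-in s)

  -- Divisibility by the two primes

  ∤-+ : ∀ {m n i} → m ∣ n → ¬ (m ∣ i) → ¬ (m ∣ n ℕ.+ i)
  ∤-+ m∣n m∤i d = m∤i (∣m+n∣m⇒∣n d m∣n)

  ∤-+⁻ : ∀ {m n i} → m ∣ n → ¬ (m ∣ n ℕ.+ i) → ¬ (m ∣ i)
  ∤-+⁻ m∣n m∤ d = m∤ (∣m∣n⇒∣m+n m∣n d)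

  ∤-∸ : ∀ {m n i} → m ∣ n → i ℕ.< n → ¬ (m ∣ i) → ¬ (m ∣ n ℕ.∸ i)
  ∤-∸ {m} m∣n i<n m∤i d = m∤i (∣m+n∣m⇒∣n (subst (m ∣_) (sym (ℕₚ.m∸n+n≡m (ℕₚ.<⇒≤ i<n))) m∣n) d)

  ∤-∸⁻ : ∀ {m n i} → m ∣ n → i ℕ.< n → ¬ (m ∣ n ℕ.∸ i) → ¬ (m ∣ i)
  ∤-∸⁻ {m} {n} {i} m∣n i<n m∤ d = m∤ (∣m+n∣m⇒∣n (subst (m ∣_) (sym (ℕₚ.m+[n∸m]≡n (ℕₚ.<⇒≤ i<n))) m∣n) d)

  distinct-primes-∤ : ∀ {p q} → Prime p → Prime q → p ≢ q → ¬ (p ∣ q)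
  distinct-primes-∤ pp pq p≢q p∣q with prime⇒irreducible pq p∣q
  ... | inj₁ refl = ℕₚ.<⇒≢ (ℕ.nonTrivial⇒n>1 1 {{prime⇒nonTrivial pp}}) refl
  ... | inj₂ p≡q  = p≢q p≡q

  ∤-double : ∀ {m} → Prime m → ¬ (2 ∣ m) → ∀ i → ¬ (m ∣ i) → ¬ (m ∣ i ℕ.* 2)
  ∤-double pm odd i m∤i d with euclidsLemma i 2 pm d
  ... | inj₁ m∣i = m∤i m∣i
  ... | inj₂ m∣2 = distinct-primes-∤ pm prime[2] (λ { refl → odd ∣-refl }) m∣2

  ∤-double⁻ : ∀ {m} i → ¬ (m ∣ i ℕ.* 2) → ¬ (m ∣ i)
  ∤-double⁻ i m∤ d = m∤ (∣m⇒∣m*n 2 d)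

  coprime⇒∤ : ∀ {m r i} → Prime r → r ∣ m → Coprime i m → ¬ (r ∣ i)
  coprime⇒∤ {r = r} pr r∣m i⊥m r∣i =
    ℕₚ.<⇒≢ (ℕ.nonTrivial⇒n>1 r {{prime⇒nonTrivial pr}}) (sym (i⊥m (r∣i , r∣m)))

  module _ {p q : ℕ} (pp : Prime p) (pq : Prime q) where

    inP-true : ∀ m i → p ∣ m → q ∣ m → inP m i ≡ true → ¬ (p ∣ i) × ¬ (q ∣ i)
    inP-true m i p∣m q∣m = by-cases (coprime? i m)
      where
      by-cases : (d : Dec (Coprime i m)) → does d ≡ true → ¬ (p ∣ i) × ¬ (q ∣ i)
      by-cases (yes i⊥m) _ = coprime⇒∤ pp p∣m i⊥m , coprime⇒∤ pq q∣m i⊥m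

    inP-false : ∀ m i → (∀ {j} → Coprime j p → Coprime j q → Coprime j m) → inP m i ≡ false → ¬ (¬ (p ∣ i) × ¬ (q ∣ i))
    inP-false m i coprime eq (p∤i , q∤i) = by-cases (coprime? i m) eq
      where
      by-cases : (d : Dec (Coprime i m)) → ¬ (does d ≡ false)
      by-cases (no ¬i⊥m) _ = ¬i⊥m (coprime (prime∤⇒coprime pp p∤i) (prime∤⇒coprime pq q∤i))

  module PunctuatedInverse {p q : ℕ} (pp : Prime p) (pq : Prime q) (p≢q : p ≢ q) (a : ℕ) where

    open InverseModPower p pp a public

    open Mod (+ P)

    Unit : ℕ → Set
    Unit i = ¬ (p ∣ i) × ¬ (q ∣ i)

    Unit? : ∀ i → Dec (Unit i)
    Unit? i with p ∣? i | q ∣? i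
    ... | yes d | _     = no (λ { (p∤i , _) → p∤i d })
    ... | no _  | yes d = no (λ { (_ , q∤i) → q∤i d })
    ... | no d  | no d′ = yes (d , d′)

    -- Multiples of q, although invertible modulo P when prime to p, are cut out, so that the
    -- support consists of the integers prime to p q.
    f : ℕ → ℤ
    f i = (1ℤ - 𝟙∣ q i) * u i

    f-out : ∀ {i} → ¬ Unit i → f i ≡ 0ℤ
    f-out {i} ¬unit with p ∣? i
    ... | yes p∣i = trans (cong ((1ℤ - 𝟙∣ q i) *_) (u-zero p∣i)) (*-zeroʳ (1ℤ - 𝟙∣ q i))
    ... | no p∤i with q ∣? i
    ...   | yes q∣i = trans (cong (_* u i) self) (*-zeroˡ (u i))
      where
      opaque
        unfolding _+_
        self : 1ℤ - 1ℤ ≡ 0ℤ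
        self = refl
    ...   | no q∤i = ⊥-elim (¬unit (p∤i , q∤i))

    f-in : ∀ {i} → Unit i → f i * + i ≈ 1ℤ
    f-in {i} (p∤i , q∤i) = ≈-trans (≈-reflexive (trans (cong (λ z → (1ℤ - z) * u i * + i) (𝟙∣-no q∤i)) (drop (u i) (+ i)))) (u-inverse p∤i)
      where
      opaque
        unfolding _+_
        drop : ∀ u i → (1ℤ - 0ℤ) * u * i ≡ u * i
        drop = solve-∀ ring

    f-zero : ∀ {i} → p ∣ i → f i ≡ 0ℤ
    f-zero p∣i = f-out (λ { (p∤i , _) → p∤i p∣i })

    module Doubled (n : ℕ) (p∣n : p ∣ n) (q∣n : q ∣ n) (¬2∣p : ¬ (2 ∣ p)) (¬2∣q : ¬ (2 ∣ q))
      (n²≈0 : + n * + n ≈ 0ℤ) (3n≈0 : + 3 * + n ≈ 0ℤ) where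

      open Reciprocal (+ P) Unit Unit? f f-out f-in

      6A≈-3Z : + 6 * tri (n ℕ.+ n) (n ℕ.+ n) (λ i j k → sgn i * prod f f f i j k) ≈ - (+ 3 * tri n n (prod f f f))
      6A≈-3Z = Double.6A≈-3Z (+ P) f n (f-zero (p ∣0)) (f-zero p∣n)
        (λ i → f-shift n i n²≈0 (λ { (x , y) → ∤-+⁻ p∣n x , ∤-+⁻ q∣n y }) (λ { (x , y) → ∤-+ p∣n x , ∤-+ q∣n y }))
        (λ i i<n → f-refl n i i<n n²≈0 (λ { (x , y) → ∤-∸⁻ p∣n i<n x , ∤-∸⁻ q∣n i<n y }) (λ { (x , y) → ∤-∸ p∣n i<n x , ∤-∸ q∣n i<n y }))
        n²≈0 3n≈0
        (λ i → f-double i (λ { (x , y) → ∤-double⁻ i x , ∤-double⁻ i y }) (λ { (x , y) → ∤-double pp ¬2∣p i x , ∤-double pq ¬2∣q i y }))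

  module PrimeDoubled {p : ℕ} (pp : Prime p) (¬2∣p : ¬ (2 ∣ p)) (a : ℕ) where

    open InverseModPower p pp a
    open Mod (+ P)

    open Reciprocal (+ P) (λ i → ¬ (p ∣ i)) (λ i → ¬? (p ∣? i)) u (λ {i} ¬¬d → u-zero (decidable-stable (p ∣? i) ¬¬d)) u-inverse

    -- The parity count with n = P and units prime to p alone; n is then the modulus, so both
    -- smallness conditions are immediate.
    12V≈9W : + 12 * tri (P ℕ.+ P) (P ℕ.+ P) (λ i j k → ε i * prod u u u i j k) ≈ + 9 * tri P P (prod u u u)
    12V≈9W = Double.12V≈9Z (+ P) u P u-0 (u-zero (m∣m*n Q))
      (λ i → f-shift P i P²≈0 (∤-+⁻ p∣P) (∤-+ p∣P))
      (λ i i<P → f-refl P i i<P P²≈0 (∤-∸⁻ p∣P i<P) (∤-∸ p∣P i<P))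
      P²≈0 (*M≈0 (+ 3))
      (λ i → f-double i (∤-double⁻ i) (∤-double pp ¬2∣p i))
      where
      p∣P : p ∣ P
      p∣P = m∣m*n Q
      P²≈0 : + P * + P ≈ 0ℤ
      P²≈0 = *M≈0 (+ P)

  -- Evaluation

  prime[3] : Prime 3
  prime[3] = from-yes (prime? 3)

  𝟙∣-indicates : ∀ m → Indicates m (𝟙∣ m)
  𝟙∣-indicates m = record
    { multiple    = λ s → 𝟙∣-yes {m} {s ℕ.* m} (n∣m*n s)
    ; nonmultiple = λ r s r<m → 𝟙∣-no λ d → ℕₚ.<⇒≱ r<m (∣⇒≤ (∣m+n∣m⇒∣n (subst (m ∣_) (ℕₚ.+-comm (suc r) (s ℕ.* m)) d) (n∣m*n s)))
    ; symmetric   = λ i j s eq → 𝟙∣-cong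
        (λ d → ∣m+n∣m⇒∣n (subst (m ∣_) (sym eq) (n∣m*n s)) d)
        (λ d → ∣m+n∣m⇒∣n (subst (m ∣_) (trans (sym eq) (ℕₚ.+-comm i j)) (n∣m*n s)) d)
    }

  -- If m divides the sum and two of the entries, it divides the third.
  𝟙∣-product : ∀ m i j k → m ∣ i ℕ.+ j ℕ.+ k → 𝟙∣ m i * 𝟙∣ m j ≡ 𝟙∣ m i * (𝟙∣ m j * 𝟙∣ m k)
  𝟙∣-product m i j k d with m ∣? i | m ∣? j
  ... | no _  | _     = trans (*-zeroˡ _) (sym (*-zeroˡ _))
  ... | yes _ | no _  = cong (1ℤ *_) (sym (*-zeroˡ (𝟙∣ m k)))
  ... | yes x | yes y = cong (1ℤ *_) (trans (sym (*-identityˡ 1ℤ)) (cong (1ℤ *_) (sym (𝟙∣-yes (∣m+n∣m⇒∣n d (∣m∣n⇒∣m+n x y))))))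

  -- Each of the three pair terms equals the triple term, so the latter has coefficient 3 - 1 = 2.
  inclusion-exclusion : ∀ q n → q ∣ n → (u : ℕ → ℤ) → let χ = 𝟙∣ q ; f = λ i → (1ℤ - χ i) * u i in
    tri n n (prod f f f) ≡ tri n n (prod u u u) - + 3 * tri n n (λ i j k → χ i * prod u u u i j k)
                           + + 2 * tri n n (λ i j k → χ i * (χ j * (χ k * prod u u u i j k)))
  inclusion-exclusion q n q∣n u = begin
    tri n n (prod f f f)
      ≡⟨ tri-cong n n pointwise ⟩
    tri n n (λ i j k → D i j k + - 1ℤ * B i j k)
      ≡⟨ trans (tri-+ n n D (λ i j k → - 1ℤ * B i j k)) (cong₂ _+_
           (trans (tri-+ n n (prod u u u) (λ i j k → + 2 * X i j k)) (cong (_+_ W) (tri-*ˡ n n (+ 2) X)))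
           (trans (tri-*ˡ n n (- 1ℤ) B) (cong (- 1ℤ *_) B≡))) ⟩
    W + + 2 * tri n n X + - 1ℤ * (V′ + V′ + V′)
      ≡⟨ collect W (tri n n X) V′ ⟩
    W - + 3 * V′ + + 2 * tri n n X
      ≡⟨ cong (λ v → W - + 3 * v + + 2 * tri n n X) (tri-cong n n λ i j k _ → assoc (χ i) (u i) (u j) (u k)) ⟩
    W - + 3 * tri n n (λ i j k → χ i * prod u u u i j k) + + 2 * tri n n X ∎
    where
    open ≡-Reasoning
    χ f χu : ℕ → ℤ
    χ = 𝟙∣ q
    f i = (1ℤ - χ i) * u i
    χu i = χ i * u i
    X D B : ℕ → ℕ → ℕ → ℤ
    X i j k = χ i * (χ j * (χ k * prod u u u i j k))
    D i j k = prod u u u i j k + + 2 * X i j k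
    B i j k = prod χu u u i j k + prod u χu u i j k + prod u u χu i j k
    W V′ : ℤ
    W = tri n n (prod u u u)
    V′ = tri n n (prod χu u u)
    opaque
      unfolding _+_
      collect : ∀ w x v → w + + 2 * x + - 1ℤ * (v + v + v) ≡ w - + 3 * v + + 2 * x
      collect = solve-∀ ring
      assoc : ∀ a x y z → a * x * y * z ≡ a * (x * y * z)
      assoc = solve-∀ ring
      expand : ∀ a b c x y z → ((1ℤ - a) * x) * ((1ℤ - b) * y) * ((1ℤ - c) * z) ≡
        (1ℤ - a - b - c + a * b + b * c + c * a - a * (b * c)) * (x * y * z)
      expand = solve-∀ ring
      gather : ∀ a b c x y z → (1ℤ - a - b - c + a * (b * c) + b * (c * a) + c * (a * b) - a * (b * c)) * (x * y * z) ≡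
        x * y * z + + 2 * (a * (b * (c * (x * y * z)))) + - 1ℤ * (a * x * y * z + x * (b * y) * z + x * y * (c * z))
      gather = solve-∀ ring
    B≡ : tri n n B ≡ V′ + V′ + V′
    B≡ = trans (tri-+ n n (λ i j k → prod χu u u i j k + prod u χu u i j k) (prod u u χu)) (cong₂ _+_
      (trans (tri-+ n n (prod χu u u) (prod u χu u)) (cong (_+_ V′) (tri-prod₂ χu u n n))) (tri-prod₃ χu u n n))
    pointwise : ∀ i j k → i ℕ.+ j ℕ.+ k ≡ n → prod f f f i j k ≡ D i j k + - 1ℤ * B i j k
    pointwise i j k eq = trans (expand (χ i) (χ j) (χ k) (u i) (u j) (u k))
      (trans (cong (_* prod u u u i j k) (cong (_- χ i * (χ j * χ k)) (cong₂ _+_ (cong₂ _+_ (cong (_+_ (1ℤ - χ i - χ j - χ k))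
          (𝟙∣-product q i j k (subst (q ∣_) (sym eq) q∣n)))
          (𝟙∣-product q j k i (subst (q ∣_) (trans (sym eq) (rotate₁ i j k)) q∣n)))
          (𝟙∣-product q k i j (subst (q ∣_) (trans (sym eq) (rotate₂ i j k)) q∣n)))))
        (gather (χ i) (χ j) (χ k) (u i) (u j) (u k)))
      where
      rotate₁ : ∀ i j k → i ℕ.+ j ℕ.+ k ≡ j ℕ.+ k ℕ.+ i
      rotate₁ = ℕ-Solver.solve-∀
      rotate₂ : ∀ i j k → i ℕ.+ j ℕ.+ k ≡ k ℕ.+ i ℕ.+ j
      rotate₂ = ℕ-Solver.solve-∀

  module Evaluation {p : ℕ} (pp : Prime p) (¬2∣p : ¬ (2 ∣ p)) (a : ℕ) where

    open InverseModPower p pp a public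
    open Mod (+ P)

    private
      instance
        p≢0 : NonZero p
        p≢0 = prime⇒nonZero pp

    p∤2 : ¬ (p ∣ 2)
    p∤2 = distinct-primes-∤ pp prime[2] λ { refl → ¬2∣p ∣-refl }

    natural-inverse : ∀ m → ¬ (p ∣ m) → ∃ λ l → m ℕ.* û m ≡ 1 ℕ.+ l ℕ.* P
    natural-inverse m p∤m = m ℕ.* û m / P , trans (m≡m%n+[m/n]*n (m ℕ.* û m) P) (cong (ℕ._+ (m ℕ.* û m / P) ℕ.* P)
      (trans (≈⇒% (≈-trans (≈-reflexive (trans (pos-* m (û m)) (*-comm (+ m) (u m)))) (u-inverse p∤m))) (m<n⇒m%n≡m 1<P)))
      where
      1<P : 1 ℕ.< P
      1<P = ℕₚ.<-≤-trans (ℕ.nonTrivial⇒n>1 p {{prime⇒nonTrivial pp}}) (ℕₚ.m≤m*n p Q)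

    private
      ½ : ℤ
      ½ = u 2
      κ : ℤ
      κ = - (+ 2 * + Q)
      Λ-B = Λ-bernoulli pp a ¬2∣p
      module Pd = Convolution.Periodic u P u-periodic

    B : ℤ
    B = proj₁ Λ-B

    B-reduces : Reduces p (+ p) (bernoulli (p ℕ.∸ 3)) B
    B-reduces = proj₁ (proj₂ Λ-B)

    -- `X` stands for p^(α-1) B_{p-3}: `B` represents the Bernoulli number modulo p, which
    -- determines `+ Q * B` modulo P.
    W X : ℤ
    W = tri P P (prod u u u)
    X = + Q * B

    tri-period : ∀ t → tri (t ℕ.* P) (t ℕ.* P) (prod u u u) ≈ + t * W
    tri-period = Pd.tri-multiple-of-period u-0 u-neg u-mul κ ½ (u-inverse p∤2) (Cube.k-cube ½ (u-inverse p∤2))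

    -- Cleared of the denominator 3 m³: m³ comes from the inverse cubes in the increments of `h`,
    -- and 3 from Voronoi's congruence, where it cannot be cancelled if p = 3.
    tri-weighted-multiples : ∀ m → ¬ (p ∣ m) → ∀ {χ} → Indicates m χ → 0 ℕ.< m → ∀ t →
      + 3 * (+ m * + m * + m) * tri (t ℕ.* P ℕ.* m) (t ℕ.* P ℕ.* m) (λ i j k → χ i * prod u u u i j k) ≈
      + t * (+ 3 * (+ m * + m * + m) * W + + 2 * ((+ m * + m * + m - + m) * X))
    tri-weighted-multiples m p∤m {χ} ind m>0 t = begin
      + 3 * m³ * tri (t ℕ.* P ℕ.* m) (t ℕ.* P ℕ.* m) (λ i j k → χ i * prod u u u i j k)
        ≈⟨ *-congˡ (+ 3 * m³) (Pd.tri-multiples u-0 u-neg u-mul κ ½ (u-inverse p∤2) (Cube.k-cube ½ (u-inverse p∤2))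
             m (û m) (proj₁ (natural-inverse m p∤m)) (proj₂ (natural-inverse m p∤m)) ind m>0 t) ⟩
      + 3 * m³ * (+ t * (W - κ * (u m * u m * u m) * Λ))
        ≡⟨ lem₁ (+ t) (+ m) W (u m) (+ Q) Λ ⟩
      + t * (+ 3 * m³ * W + + 2 * ((u m * + m) * (u m * + m) * (u m * + m) * (+ Q * (+ 3 * Λ))))
        -- Voronoi's congruence holds modulo p; the factor Q contributed by `κ` lifts it to modulus
        -- P.
        ≈⟨ *-congˡ (+ t) (+-congˡ (+ 3 * m³ * W) (*-congˡ (+ 2) (*-cong (*-cong (*-cong i i) i)
             (scale Q (proj₂ (proj₂ Λ-B) m (û m) (proj₁ (natural-inverse m p∤m)) (proj₂ (natural-inverse m p∤m))))))) ⟩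
      + t * (+ 3 * m³ * W + + 2 * (1ℤ * 1ℤ * 1ℤ * (+ Q * ((m³ - + m) * B))))
        ≡⟨ lem₂ (+ t) (+ 3 * m³ * W) (+ Q) (m³ - + m) B ⟩
      + t * (+ 3 * m³ * W + + 2 * ((m³ - + m) * X)) ∎
      where
      open ≈-Reasoning
      m³ Λ : ℤ
      m³ = + m * + m * + m
      Λ = Pd.Λ u-0 u-neg u-mul κ ½ (u-inverse p∤2) (Cube.k-cube ½ (u-inverse p∤2)) m
      i : u m * + m ≈ 1ℤ
      i = u-inverse p∤m
      opaque
        unfolding _+_
        lem₁ : ∀ t m w u q l → + 3 * (m * m * m) * (t * (w - - (+ 2 * q) * (u * u * u) * l)) ≡
          t * (+ 3 * (m * m * m) * w + + 2 * ((u * m) * (u * m) * (u * m) * (q * (+ 3 * l))))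
        lem₁ = solve-∀ ring
        lem₂ : ∀ t w q c b → t * (w + + 2 * (1ℤ * 1ℤ * 1ℤ * (q * (c * b)))) ≡ t * (w + + 2 * (c * (q * b)))
        lem₂ = solve-∀ ring

    -- No triple with sum 2 P has all its entries odd, so parity alone determines the weighted sum for m = 2 a second time.
    6W≈-12X : + 6 * W ≈ - (+ 12 * X)
    6W≈-12X = begin
      + 6 * W
        ≡⟨ lem₁ W V ⟩
      -- The quantity 24 V is evaluated twice: as 18 W by the parity count, and as 24 W + 12 X by
      -- the formula for multiples of 2.
      + 24 * W + + 2 * (+ 12 * V - + 9 * W) - + 3 * (+ 2 * + 2 * + 2) * V
        ≈⟨ +-cong (+-congˡ (+ 24 * W) (*-congˡ (+ 2) (+-congʳ (- (+ 9 * W)) 12V≈9W)))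
             (-‿cong (≈-trans (≈-reflexive (cong (λ S → + 3 * (+ 2 * + 2 * + 2) * tri S S (λ i j k → ε i * prod u u u i j k)) (sizes P)))
               (tri-weighted-multiples 2 p∤2 ε-indicates (s≤s z≤n) 1))) ⟩
      + 24 * W + + 2 * (+ 9 * W - + 9 * W) - + 1 * (+ 3 * (+ 2 * + 2 * + 2) * W + + 2 * ((+ 2 * + 2 * + 2 - + 2) * X))
        ≡⟨ lem₂ W X ⟩
      - (+ 12 * X) ∎
      where
      open ≈-Reasoning
      open PrimeDoubled pp ¬2∣p a
      V : ℤ
      V = tri (P ℕ.+ P) (P ℕ.+ P) (λ i j k → ε i * prod u u u i j k)
      sizes : ∀ P → P ℕ.+ P ≡ 1 ℕ.* P ℕ.* 2
      sizes = ℕ-Solver.solve-∀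
      opaque
        unfolding _+_
        lem₁ : ∀ w v → + 6 * w ≡ + 24 * w + + 2 * (+ 12 * v - + 9 * w) - + 3 * (+ 2 * + 2 * + 2) * v
        lem₁ = solve-∀ ring
        lem₂ : ∀ w x → + 24 * w + + 2 * (+ 9 * w - + 9 * w) - + 1 * (+ 3 * (+ 2 * + 2 * + 2) * w + + 2 * ((+ 2 * + 2 * + 2 - + 2) * x)) ≡ - (+ 12 * x)
        lem₂ = solve-∀ ring

  -- The sum over triples prime to p q

  module _ {p q : ℕ} (pp : Prime p) (pq : Prime q) (p≢q : p ≢ q) (¬2∣p : ¬ (2 ∣ p)) (a b : ℕ) where

    open Evaluation pp ¬2∣p a
    open PunctuatedInverse pp pq p≢q a using (f)
    open Mod (+ P)

    private
      t n : ℕ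
      t = q ℕ.^ b
      n = P ℕ.* (q ℕ.* t)

      q³ Zn : ℤ
      q³ = + q * + q * + q
      Zn = tri n n (prod f f f)

      p∤q : ¬ (p ∣ q)
      p∤q = distinct-primes-∤ pp pq p≢q

      q>0 : 0 ℕ.< q
      q>0 = ℕ.>-nonZero⁻¹ q {{prime⇒nonZero pq}}

      n≡tPq : n ≡ t ℕ.* P ℕ.* q
      n≡tPq = lem P q t
        where
        lem : ∀ P q t → P ℕ.* (q ℕ.* t) ≡ t ℕ.* P ℕ.* q
        lem = ℕ-Solver.solve-∀

      χ : ℕ → ℤ
      χ = 𝟙∣ q

    -- A triple of multiples of q with sum n is q times a triple with sum t P, and each of its
    -- reciprocals carries a factor 1/q.
    q³U≈tW : q³ * tri n n (λ i j k → χ i * (χ j * (χ k * prod u u u i j k))) ≈ + t * W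
    q³U≈tW = begin
      q³ * tri n n (λ i j k → χ i * (χ j * (χ k * prod u u u i j k)))
        ≡⟨ cong (q³ *_) (trans (cong (λ S → tri S S (λ i j k → χ i * (χ j * (χ k * prod u u u i j k)))) n≡tPq)
             (tri-dilate (𝟙∣-indicates q) q>0 (t ℕ.* P) (prod u u u))) ⟩
      q³ * tri (t ℕ.* P) (t ℕ.* P) (λ i j k → prod u u u (i ℕ.* q) (j ℕ.* q) (k ℕ.* q))
        ≡⟨ sym (tri-*ˡ (t ℕ.* P) (t ℕ.* P) q³ _) ⟩
      tri (t ℕ.* P) (t ℕ.* P) (λ i j k → q³ * prod u u u (i ℕ.* q) (j ℕ.* q) (k ℕ.* q))
        ≈⟨ tri-cong≈ (+ P) (t ℕ.* P) (t ℕ.* P) (λ i j k _ _ _ _ →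
             ≈-trans (≈-reflexive (distribute (+ q) (u (i ℕ.* q)) (u (j ℕ.* q)) (u (k ℕ.* q))))
               (*-cong (*-cong (undilate i) (undilate j)) (undilate k))) ⟩
      tri (t ℕ.* P) (t ℕ.* P) (prod u u u)
        ≈⟨ tri-period t ⟩
      + t * W ∎
      where
      open ≈-Reasoning
      opaque
        unfolding _+_
        distribute : ∀ q x y z → q * q * q * (x * y * z) ≡ (q * x) * (q * y) * (q * z)
        distribute = solve-∀ ring
        regroup : ∀ q x v → q * (x * v) ≡ x * (v * q)
        regroup = solve-∀ ring
        one : ∀ x → x * 1ℤ ≡ x
        one = solve-∀ ring
      undilate : ∀ i → + q * u (i ℕ.* q) ≈ u i
      undilate i = ≈-trans (*-congˡ (+ q) (u-mul i q)) (≈-trans (≈-reflexive (regroup (+ q) (u i) (u q)))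
        (≈-trans (*-congˡ (u i) (u-inverse p∤q)) (≈-reflexive (one (u i)))))

    -- Inclusion-exclusion with n read as q t periods in the full sum and as t P q in the sums over
    -- multiples of q; the coefficient of W collects q⁴, -3 q³ and 2 from these sums.
    q³Z≈ : q³ * Zn ≈ + t * ((+ q * q³ - + 3 * q³ + + 2) * W - + 2 * ((q³ - + q) * X))
    q³Z≈ = begin
      q³ * Zn
        ≡⟨ cong (q³ *_) (inclusion-exclusion q n (subst (q ∣_) (sym n≡tPq) (n∣m*n (t ℕ.* P))) u) ⟩
      q³ * (tri n n (prod u u u) - + 3 * V + + 2 * U)
        ≡⟨ lem₁ q³ (tri n n (prod u u u)) V U ⟩
      q³ * tri n n (prod u u u) - + 3 * q³ * V + + 2 * (q³ * U)
        ≈⟨ +-cong (+-cong (*-congˡ q³ W-n) (-‿cong V-n)) (*-congˡ (+ 2) q³U≈tW) ⟩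
      q³ * (+ q * + t * W) - + t * (+ 3 * q³ * W + + 2 * ((q³ - + q) * X)) + + 2 * (+ t * W)
        ≡⟨ lem₂ q³ (+ q) (+ t) W X ⟩
      + t * ((+ q * q³ - + 3 * q³ + + 2) * W - + 2 * ((q³ - + q) * X)) ∎
      where
      open ≈-Reasoning
      U V : ℤ
      U = tri n n (λ i j k → χ i * (χ j * (χ k * prod u u u i j k)))
      V = tri n n (λ i j k → χ i * prod u u u i j k)
      W-n : tri n n (prod u u u) ≈ + q * + t * W
      W-n = ≈-trans (≈-reflexive (cong (λ S → tri S S (prod u u u)) (ℕₚ.*-comm P (q ℕ.* t))))
        (≈-trans (tri-period (q ℕ.* t)) (≈-reflexive (cong (_* W) (pos-* q t))))
      V-n : + 3 * q³ * V ≈ + t * (+ 3 * q³ * W + + 2 * ((q³ - + q) * X))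
      V-n = ≈-trans (≈-reflexive (cong (λ S → + 3 * q³ * tri S S (λ i j k → χ i * prod u u u i j k)) n≡tPq))
        (tri-weighted-multiples q p∤q (𝟙∣-indicates q) q>0 t)
      opaque
        unfolding _+_
        lem₁ : ∀ q w v u → q * (w - + 3 * v + + 2 * u) ≡ q * w - + 3 * q * v + + 2 * (q * u)
        lem₁ = solve-∀ ring
        lem₂ : ∀ c q t w x → c * (q * t * w) - t * (+ 3 * c * w + + 2 * ((c - q) * x)) + + 2 * (t * w) ≡
          t * ((q * c - + 3 * c + + 2) * w - + 2 * ((c - q) * x))
        lem₂ = solve-∀ ring

    -- Three divides a coefficient on each side when p = 3; otherwise 6 is invertible.
    -q³Z≈ : - (q³ * Zn) ≈ + 2 * ((+ q - + 2) * (q³ - 1ℤ)) * (+ t * X)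
    -q³Z≈ = by-cases (p ℕ.≟ 3)
      where
      open ≈-Reasoning
      opaque
        unfolding _+_
        lem₁ : ∀ t q w x → + 6 * (- (t * ((q * (q * q * q) - + 3 * (q * q * q) + + 2) * w - + 2 * ((q * q * q - q) * x)))) ≡
          - (t * ((q * (q * q * q) - + 3 * (q * q * q) + + 2) * (+ 6 * w) - + 12 * ((q * q * q - q) * x)))
        lem₁ = solve-∀ ring
        lem₂ : ∀ t q x → - (t * ((q * (q * q * q) - + 3 * (q * q * q) + + 2) * (- (+ 12 * x)) - + 12 * ((q * q * q - q) * x))) ≡
          + 6 * (+ 2 * ((q - + 2) * (q * q * q - 1ℤ)) * (t * x))
        lem₂ = solve-∀ ring
        six : ∀ w → + 6 * w ≡ + 2 * (+ 3 * w)
        six = solve-∀ ring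
        four : ∀ x → - (+ 12 * x) ≡ - + 4 * (+ 3 * x)
        four = solve-∀ ring
        null : - + 4 * 0ℤ ≡ + 2 * 0ℤ
        null = refl
        assoc₃ : ∀ k w → (0ℤ + k * + 3) * w ≡ k * (+ 3 * w)
        assoc₃ = solve-∀ ring
        to-X : ∀ c t x → + 2 * c * (t * x) ≡ + 2 * t * (c * x)
        to-X = solve-∀ ring
        vanish₁ : ∀ t → - (t * (0ℤ - + 2 * 0ℤ)) ≡ 0ℤ
        vanish₁ = solve-∀ ring
        vanish₂ : ∀ t → 0ℤ ≡ + 2 * t * 0ℤ
        vanish₂ = solve-∀ ring
        factor₁ : ∀ q → q * (q * q * q) - + 3 * (q * q * q) + + 2 ≡ (q * q * q - q) * (q - + 3) + (q * q - 1ℤ) + (1ℤ - q) * + 3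
        factor₁ = solve-∀ ring
        factor₂ : ∀ q → (q - + 2) * (q * q * q - 1ℤ) ≡ (q - + 2) * (q * q * q - q) + (q * q - 1ℤ) + (1ℤ - q) * + 3
        factor₂ = solve-∀ ring
        zero₁ : ∀ q → 0ℤ * q + 0ℤ + 0ℤ ≡ 0ℤ
        zero₁ = solve-∀ ring
        zero₂ : ∀ q → q * 0ℤ + 0ℤ + 0ℤ ≡ 0ℤ
        zero₂ = solve-∀ ring
        self : ∀ x → x - x ≡ 0ℤ
        self = solve-∀ ring

      by-cases : Dec (p ≡ 3) → - (q³ * Zn) ≈ + 2 * ((+ q - + 2) * (q³ - 1ℤ)) * (+ t * X)
      by-cases (no p≢3) = *-cancel (u 6) (+ 6) (u-inverse p∤6) (begin
        + 6 * - (q³ * Zn)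
          ≈⟨ *-congˡ (+ 6) (-‿cong q³Z≈) ⟩
        + 6 * (- (+ t * ((+ q * q³ - + 3 * q³ + + 2) * W - + 2 * ((q³ - + q) * X))))
          ≡⟨ lem₁ (+ t) (+ q) W X ⟩
        - (+ t * ((+ q * q³ - + 3 * q³ + + 2) * (+ 6 * W) - + 12 * ((q³ - + q) * X)))
          ≈⟨ -‿cong (*-congˡ (+ t) (+-congʳ _ (*-congˡ (+ q * q³ - + 3 * q³ + + 2) 6W≈-12X))) ⟩
        -- The coefficients of 12 X combine: (q⁴ - 3 q³ + 2) + (q³ - q) = (q - 2)(q³ - 1).
        - (+ t * ((+ q * q³ - + 3 * q³ + + 2) * (- (+ 12 * X)) - + 12 * ((q³ - + q) * X)))
          ≡⟨ lem₂ (+ t) (+ q) X ⟩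
        + 6 * (+ 2 * ((+ q - + 2) * (q³ - 1ℤ)) * (+ t * X)) ∎)
        where
        p∤6 : ¬ (p ∣ 6)
        p∤6 d = [ p∤2 , distinct-primes-∤ pp prime[3] p≢3 ]′ (euclidsLemma 2 3 pp d)
      -- Here 3 Q = P, so 3 X ≈ 0, and 3 W ≈ 0 follows from 6 W ≈ - 12 X. All coefficients of W and
      -- X are divisible by 3, by q³ ≡ q and q² ≡ 1, so both sides vanish.
      by-cases (yes p≡3) = ≈-trans (≈-trans (-‿cong q³Z≈)
          (≈-trans (-‿cong (*-congˡ (+ t) (+-cong (multiple-of-3 W coefficient₁ 3W≈0) (-‿cong (*-congˡ (+ 2) (multiple-of-3 X q³-q≈0 3X≈0))))))
            (≈-reflexive (vanish₁ (+ t)))))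
        (≈-sym (≈-trans (≈-reflexive (to-X ((+ q - + 2) * (q³ - 1ℤ)) (+ t) X))
          (≈-trans (*-congˡ (+ 2 * + t) (multiple-of-3 X coefficient₂ 3X≈0)) (≈-reflexive (sym (vanish₂ (+ t)))))))
        where
        module ≈₃ = Mod (+ 3)
        multiple-of-3 : ∀ {c} w → c ≈ 0ℤ [mod + 3 ] → + 3 * w ≈ 0ℤ → c * w ≈ 0ℤ
        multiple-of-3 w (Mod.modulo k refl) h = ≈-trans (≈-reflexive (assoc₃ k w)) (≈-trans (*-congˡ k h) (≈-reflexive (*-zeroʳ k)))
        3Q≈0 : + 3 * + Q ≈ 0ℤ
        3Q≈0 = ≈-trans (≈-reflexive (trans (cong (λ z → + z * + Q) (sym p≡3)) (sym (pos-* p Q)))) (∣⇒≈0 ∣-refl)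
        3X≈0 : + 3 * X ≈ 0ℤ
        3X≈0 = ≈-trans (≈-reflexive (sym (*-assoc (+ 3) (+ Q) B))) (≈-trans (*-congʳ B 3Q≈0) (≈-reflexive (*-zeroˡ B)))
        3W≈0 : + 3 * W ≈ 0ℤ
        3W≈0 = *-cancel (u 2) (+ 2) (u-inverse p∤2) (≈-trans (≈-reflexive (sym (six W))) (≈-trans 6W≈-12X
          (≈-trans (≈-reflexive (four X)) (≈-trans (*-congˡ (- + 4) 3X≈0) (≈-reflexive null)))))
        q³≈q : q³ ≈ + q [mod + 3 ]
        q³≈q = ≈₃.≈-trans (≈₃.≈-reflexive (trans (cong (_* + q) (sym (pos-* q q))) (trans (sym (pos-* (q ℕ.* q) q)) (cong +_ (cube q))))) (fermat prime[3] q)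
          where
          cube : ∀ q → q ℕ.* q ℕ.* q ≡ q ℕ.^ 3
          cube q = trans (ℕₚ.*-assoc q q q) (cong (λ z → q ℕ.* (q ℕ.* z)) (sym (ℕₚ.*-identityʳ q)))
        q³-q≈0 : q³ - + q ≈ 0ℤ [mod + 3 ]
        q³-q≈0 = ≈₃.≈-trans (≈₃.+-congʳ (- + q) q³≈q) (≈₃.≈-reflexive (self (+ q)))
        q-inverse : u q * + q ≈ 1ℤ [mod + 3 ]
        q-inverse = subst (λ z → u q * + q ≈ 1ℤ [mod + z ]) p≡3 (P⇒p (u-inverse p∤q))
        q²-1≈0 : + q * + q - 1ℤ ≈ 0ℤ [mod + 3 ]
        q²-1≈0 = ≈₃.≈-trans (≈₃.+-congʳ (- 1ℤ) (≈₃.*-cancel (u q) (+ q) q-inverse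
          (≈₃.≈-trans (≈₃.≈-reflexive (sym (*-assoc (+ q) (+ q) (+ q)))) (≈₃.≈-trans q³≈q (≈₃.≈-reflexive (sym (trans (*-comm (+ q) 1ℤ) (*-identityˡ (+ q)))))))))
          (≈₃.≈-reflexive (self 1ℤ))
        coefficient₁ : + q * q³ - + 3 * q³ + + 2 ≈ 0ℤ [mod + 3 ]
        coefficient₁ = ≈₃.≈-trans (≈₃.≈-reflexive (factor₁ (+ q))) (≈₃.≈-trans
          (≈₃.+-cong (≈₃.+-cong (≈₃.*-congʳ (+ q - + 3) q³-q≈0) q²-1≈0) (≈₃.*M≈0 (1ℤ - + q)))
          (≈₃.≈-reflexive (zero₁ (+ q - + 3))))
        coefficient₂ : (+ q - + 2) * (q³ - 1ℤ) ≈ 0ℤ [mod + 3 ]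
        coefficient₂ = ≈₃.≈-trans (≈₃.≈-reflexive (factor₂ (+ q))) (≈₃.≈-trans
          (≈₃.+-cong (≈₃.+-cong (≈₃.*-congˡ (+ q - + 2) q³-q≈0) q²-1≈0) (≈₃.*M≈0 (1ℤ - + q)))
          (≈₃.≈-reflexive (zero₂ (+ q - + 2))))

  -- The two congruences between rationals

  module Congruences {p q : ℕ} (pp : Prime p) (pq : Prime q) (p≢q : p ≢ q)
    (¬2∣p : ¬ (2 ∣ p)) (¬2∣q : ¬ (2 ∣ q)) (a b : ℕ) where

    open Evaluation pp ¬2∣p a
    open Mod (+ P)

    private
      module I = PunctuatedInverse pp pq p≢q

      t n : ℕ
      t = q ℕ.^ b
      n = P ℕ.* (q ℕ.* t)

      instance
        p≢0 : NonZero p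
        p≢0 = prime⇒nonZero pp

      p∣n : p ∣ n
      p∣n = ∣m⇒∣m*n (q ℕ.* t) (m∣m*n Q)

      q∣n : q ∣ n
      q∣n = ∣n⇒∣m*n P (m∣m*n t)

      Unit : ℕ → Set
      Unit i = ¬ (p ∣ i) × ¬ (q ∣ i)

      A Z′ : (ℕ → ℤ) → ℤ
      A f = tri (n ℕ.+ n) (n ℕ.+ n) (λ i j k → sgn i * prod f f f i j k)
      Z′ f = tri n n (prod f f f)

    -- Admits both the inverse modulo P and the one modulo p P, so that the rational sums can be
    -- reduced along either.
    record Inverts (f : ℕ → ℤ) : Set where
      field
        inverse : ∀ {i} → Unit i → f i * + i ≈ 1ℤ
        out     : ∀ {i} → ¬ Unit i → f i ≡ 0ℤ

      zero-p : ∀ {i} → p ∣ i → f i ≡ 0ℤ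
      zero-p d = out (λ { (p∤i , _) → p∤i d })

    -- The factor 3 lost in 6 A ≈ - 3 Z is regained, when p = 3, by inverting modulo p P instead of P.
    halved : ∃ λ f → Inverts f × + 2 * A f ≈ - Z′ f
    halved = by-cases (p ℕ.≟ 3)
      where
      opaque
        unfolding _+_
        lem₁ : ∀ x → + 6 * x ≡ + 3 * (+ 2 * x)
        lem₁ = solve-∀ ring
        lem₂ : ∀ x → - (+ 3 * x) ≡ + 3 * - x
        lem₂ = solve-∀ ring

      by-cases : Dec (p ≡ 3) → ∃ λ f → Inverts f × + 2 * A f ≈ - Z′ f
      by-cases (no p≢3) = I.f a , record { inverse = I.f-in a ; out = I.f-out a } ,
        *-cancel (u 3) (+ 3) (u-inverse (distinct-primes-∤ pp prime[3] p≢3))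
          (≈-trans (≈-reflexive (sym (lem₁ (A (I.f a))))) (≈-trans (I.Doubled.6A≈-3Z a n p∣n q∣n ¬2∣p ¬2∣q n²≈0 3n≈0)
            (≈-reflexive (lem₂ (Z′ (I.f a))))))
        where
        n≈0 : + n ≈ 0ℤ
        n≈0 = ∣⇒≈0 (m∣m*n (q ℕ.* t))
        n²≈0 : + n * + n ≈ 0ℤ
        n²≈0 = ≈-trans (*-congˡ (+ n) n≈0) (≈-reflexive (*-zeroʳ (+ n)))
        3n≈0 : + 3 * + n ≈ 0ℤ
        3n≈0 = ≈-trans (*-congˡ (+ 3) n≈0) (≈-reflexive (*-zeroʳ (+ 3)))
      -- Modulo p P one still has n² ≈ 0, as p and P both divide n, and 3 n = p n ≈ 0. Dividing the
      -- resulting congruence by 3 = p returns to modulus P.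
      by-cases (yes p≡3) = f′ , record { inverse = λ {i} unit → weaken p (subst (λ M → f′ i * + i ≈ 1ℤ [mod + M ]) (ℕₚ.*-comm p P) (I.f-in (suc a) unit)) ; out = I.f-out (suc a) } ,
        unscale 3 (subst (λ M → + 3 * (+ 2 * A f′) ≈ + 3 * - Z′ f′ [mod + M ]) (trans (ℕₚ.*-comm p P) (cong (P ℕ.*_) p≡3))
          (≈′.≈-trans (≈′.≈-reflexive (sym (lem₁ (A f′)))) (≈′.≈-trans (I.Doubled.6A≈-3Z (suc a) n p∣n q∣n ¬2∣p ¬2∣q n²≈0 3n≈0)
            (≈′.≈-reflexive (lem₂ (Z′ f′))))))
        where
        module ≈′ = Mod (+ (p ℕ.* P))
        f′ : ℕ → ℤ
        f′ = I.f (suc a)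
        n²≈0 : + n * + n ≈ 0ℤ [mod + (p ℕ.* P) ]
        n²≈0 = ≈′.≈-trans (≈′.≈-reflexive (sym (pos-* n n))) (∣⇒≈0 (*-pres-∣ p∣n (m∣m*n (q ℕ.* t))))
        3n≈0 : + 3 * + n ≈ 0ℤ [mod + (p ℕ.* P) ]
        3n≈0 = ≈′.≈-trans (≈′.≈-reflexive (trans (cong (λ z → + z * + n) (sym p≡3)) (sym (pos-* p n))))
          (∣⇒≈0 (*-monoʳ-∣ p (m∣m*n (q ℕ.* t))))

    module _ {f : ℕ → ℤ} (inverts : Inverts f) where
      open Inverts inverts

      private
        module R (m N : ℕ) (p∣m : p ∣ m) (q∣m : q ∣ m) (coprime : ∀ {j} → Coprime j p → Coprime j q → Coprime j m) (p∣N : p ∣ N) where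
          unit : ∀ i → inP m i ≡ true → ¬ (p ∣ i) × f i * + i ≈ 1ℤ
          unit i eq = let d = inP-true pp pq m i p∣m q∣m eq in proj₁ d , inverse d
          nonunit : ∀ i → inP m i ≡ false → f i ≡ 0ℤ
          nonunit i eq = out (inP-false pp pq m i coprime eq)

          altSum-reduces : Reduces p (+ P) (altSum m N) (tri N N (λ i j k → sgn i * prod f f f i j k))
          altSum-reduces = reduces-altSum pp (+ P) m N f unit nonunit (zero-p (p ∣0)) (zero-p p∣N)

          tripleSum-reduces = reduces-tripleSum pp (+ P) m N f unit nonunit (zero-p (p ∣0)) (zero-p p∣N)

      reduces-A : Reduces p (+ P) (altSum (p ℕ.* q) (2 ℕ.* n)) (A f)
      reduces-A = subst (λ S → Reduces p (+ P) (altSum (p ℕ.* q) (2 ℕ.* n)) (tri S S (λ i j k → sgn i * prod f f f i j k)))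
        (cong (n ℕ.+_) (ℕₚ.+-identityʳ n))
        (R.altSum-reduces (p ℕ.* q) (2 ℕ.* n) (m∣m*n q) (n∣m*n p) coprime-* (∣n⇒∣m*n 2 p∣n))

      reduces-Z : Reduces p (+ P) (Z n) (Z′ f)
      reduces-Z = R.tripleSum-reduces n n p∣n q∣n
        (λ j⊥p j⊥q → coprime-* (coprime-^ j⊥p (suc a)) (coprime-^ j⊥q (suc b))) p∣n

      reduces--½Z : Reduces p (+ P) (ℚ.- ((+ 1 ℚ./ 2) ℚ.* Z n)) (- (u 2 * Z′ f))
      reduces--½Z = reduces-neg pp (+ P) (reduces-* pp (+ P)
        (reduces-/ pp (+ P) 1 2 p∤2 (≈-sym (u-inverse p∤2))) reduces-Z)

    2*-½ : ∀ z → + 2 * - (u 2 * z) ≈ - z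
    2*-½ z = ≈-trans (≈-reflexive (lem₁ (u 2) z)) (≈-trans (-‿cong (*-congʳ z (u-inverse p∤2))) (≈-reflexive (cong -_ (*-identityˡ z))))
      where
      opaque
        unfolding _+_
        lem₁ : ∀ h z → + 2 * - (h * z) ≡ - (h * + 2 * z)
        lem₁ = solve-∀ ring

    altSum≡-½Z : CongQ p (suc a) (altSum (p ℕ.* q) (2 ℕ.* n)) (ℚ.- ((+ 1 ℚ./ 2) ℚ.* Z n))
    altSum≡-½Z = let f , inverts , 2A≈-Z = halved in
      reduces⇒CongQ pp (suc a) (reduces-A inverts) (reduces--½Z inverts)
        (*-cancel (u 2) (+ 2) (u-inverse p∤2) (≈-trans 2A≈-Z (≈-sym (2*-½ (Z′ f)))))

    -½Z≡bernoulli : CongQ p (suc a) (ℚ.- ((+ 1 ℚ./ 2) ℚ.* Z n))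
      (((ℕ→ℚ q ℚ.- ℕ→ℚ 2) ℚ.* (1ℚ ℚ.- inv (q ℕ.^ 3))) ℚ.* (ℕ→ℚ (Q ℕ.* t) ℚ.* bernoulli (p ℕ.∸ 3)))
    -½Z≡bernoulli = reduces⇒CongQ pp (suc a) (reduces--½Z (record { inverse = I.f-in a ; out = I.f-out a }))
      (reduces-* pp (+ P)
        (reduces-* pp (+ P) (reduces-- pp (+ P) (reduces-ℕ pp (+ P) q) (reduces-ℕ pp (+ P) 2))
          (reduces-- pp (+ P) (reduces-1 pp (+ P)) (reduces-inv pp (+ P) (q ℕ.^ 3) p∤q³ (u-inverse p∤q³))))
        (reduces-scale pp Q t B-reduces))
      -- The two sides are compared after multiplication by the units q³ and 2, which clears the
      -- denominators.
      (*-cancel (u q³) (+ q³) (u-inverse p∤q³) (*-cancel (u 2) (+ 2) (u-inverse p∤2) (begin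
        + 2 * (+ q³ * - (u 2 * Z₀))
          ≡⟨ lem₁ (+ q³) (- (u 2 * Z₀)) ⟩
        + q³ * (+ 2 * - (u 2 * Z₀))
          ≈⟨ *-congˡ (+ q³) (2*-½ Z₀) ⟩
        + q³ * - Z₀
          ≡⟨ trans (lem₂ (+ q³) Z₀) (cong (λ z → - (z * Z₀)) q³≡) ⟩
        - (+ q * + q * + q * Z₀)
          ≈⟨ -q³Z≈ pp pq p≢q ¬2∣p a b ⟩
        + 2 * ((+ q - + 2) * (+ q * + q * + q - 1ℤ)) * (+ t * X)
          ≡⟨ cong (λ z → + 2 * ((+ q - + 2) * (z - 1ℤ)) * (+ t * X)) (sym q³≡) ⟩
        + 2 * ((+ q - + 2) * (+ q³ - 1ℤ)) * (+ t * (+ Q * B))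
          -- Replacing 1 by `u q³ * + q³` lets the factor q³ be taken out of q³ - 1, leaving 1 -
          -- 1/q³.
          ≈⟨ *-congʳ (+ t * (+ Q * B)) (*-congˡ (+ 2) (*-congˡ (+ q - + 2) (+-congˡ (+ q³) (-‿cong (≈-sym (u-inverse p∤q³)))))) ⟩
        + 2 * ((+ q - + 2) * (+ q³ - u q³ * + q³)) * (+ t * (+ Q * B))
          ≡⟨ lem₃ (+ q) (+ q³) (u q³) (+ t) (+ Q) B ⟩
        + 2 * (+ q³ * ((+ q - + 2) * (1ℤ - u q³) * (+ Q * (+ t * B)))) ∎)))
      where
      open ≈-Reasoning
      q³ : ℕ
      q³ = q ℕ.^ 3
      Z₀ : ℤ
      Z₀ = Z′ (I.f a)
      p∤q³ : ¬ (p ∣ q³)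
      p∤q³ p∣q³ = coprime⇒∤ pp p∣q³ (coprime-^ (Coprime.sym (prime∤⇒coprime pp (distinct-primes-∤ pp pq p≢q))) 3) ∣-refl
      opaque
        unfolding _+_
        lem₁ : ∀ q z → + 2 * (q * z) ≡ q * (+ 2 * z)
        lem₁ = solve-∀ ring
        lem₂ : ∀ q z → q * - z ≡ - (q * z)
        lem₂ = solve-∀ ring
        lem₃ : ∀ q c v t d b → + 2 * ((q - + 2) * (c - v * c)) * (t * (d * b)) ≡ + 2 * (c * ((q - + 2) * (1ℤ - v) * (d * (t * b))))
        lem₃ = solve-∀ ring
      q³≡ : + q³ ≡ + q * + q * + q
      q³≡ = trans (cong +_ (trans (cong (λ z → q ℕ.* (q ℕ.* z)) (ℕₚ.*-identityʳ q)) (sym (ℕₚ.*-assoc q q q))))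
        (trans (pos-* (q ℕ.* q) q) (cong (_* + q) (pos-* q q)))

open import Defs
open import Data.Nat using (ℕ; _^_; _≥_; _∸_; _*_)
open import Data.Nat.Divisibility using (_∣_)
open import Data.Nat.Primality using (Prime)
open import Data.Product using (_×_)
open import Data.Rational using (ℚ; 1ℚ; _-_; -_; _/_) renaming (_*_ to _*ℚ_)
open import Data.Integer using (+_)
open import Relation.Binary.PropositionalEquality using (_≢_)
open import Relation.Nullary using (¬_)
open import Data.Nat using (suc; s≤s)
open import Data.Product using (_,_)
open Proof using (module Congruences)

theorem1 : (p q α β : ℕ) → Prime p → Prime q → p ≢ q → ¬ (2 ∣ p) → ¬ (2 ∣ q) → α ≥ 1 → β ≥ 1 →
    CongQ p α (altSum (p * q) (2 * (p ^ α * q ^ β))) (- ((+ 1 / 2) *ℚ Z (p ^ α * q ^ β)))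
    × CongQ p α (- ((+ 1 / 2) *ℚ Z (p ^ α * q ^ β)))
    (((ℕ→ℚ q - ℕ→ℚ 2) *ℚ (1ℚ - inv (q ^ 3))) *ℚ (ℕ→ℚ (p ^ (α ∸ 1) * q ^ (β ∸ 1)) *ℚ bernoulli (p ∸ 3)))
-- With a = α - 1 and b = β - 1 the truncated exponents of the statement compute to those of `Q` and
-- `t`.
theorem1 p q (suc a) (suc b) pp pq p≢q ¬2∣p ¬2∣q (s≤s _) (s≤s _) = altSum≡-½Z , -½Z≡bernoulli
  where open Congruences pp pq p≢q ¬2∣p ¬2∣q a b
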